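{- Let $G=(V,E)$ be a finite simple connected graph. Then $\beth^{3}(K^{\chi(G)})\le \beth^{3}(G)$; that is, $$\binom{\chi(G)}{4}-\binom{\chi(G)}{3}+\binom{\chi(G)}{2}-\binom{\chi(G)}{1}\le \beth^{3}(G).$$
   Context: All graphs are finite and simple. $K^{t}$ is the complete graph on $t$ vertices and $\chi(G)$ is the chromatic number of $G$. $C(G)$ is the set of all induced cycles in $G$ (of length at least 3). Solid graphs are the graphs of the following four kinds. (1) Pyramid: a graph consisting of a cycle $C$ and a vertex $w\notin V(C)$ together with at least three edges between $w$ and $C$. (2) Trihedron: the union of three paths $P_1,P_2,P_3$, each of length at least 2, having the same two (distinct) endpoints, such that no interior vertex of any of the paths is used in another of the paths. (3) Stamp: the union of a triangle $T$ and three paths $P_1,P_2,P_3$ of length $\ge 1$ that start at the three different vertices of $T$ and all end at the same vertex $x\notin V(T)$, such that the $P_i-x$ are pairwise vertex-disjoint and each $P_i$ meets $T$ only in its starting vertex. (4) Prism: $T\cup T'\cup P_1\cup P_2\cup P_3$ where $T,T'$ are vertex-disjoint triangles with vertices $x_1,x_2,x_3$ and $y_1,y_2,y_3$ respectively, and the $P_i$ are pairwise vertex-disjoint paths from $x_i$ to $y_i$ (so $P_i$ meets $T\cup T'$ only in $x_i,y_i$). A solid in $G$ is an induced subgraph of $G$ that is isomorphic to a solid graph; $S(G)$ is the set of all solids in $G$. The third graph characteristic is $\beth^{3}(G)=|S(G)|-|C(G)|+|E(G)|-|V(G)|$. -}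

module Defs where

open import Data.Nat using (ℕ; zero; suc; z≤n; s≤s; s≤s⁻¹; _≤?_) renaming (_≤_ to _≤ⁿ_)
open import Data.Integer using (ℤ; +_; _+_; _-_)
open import Data.Fin using (Fin; zero; suc; _<?_)
import Data.Fin.Properties as Finₚ
open import Data.Fin.Subset using (Subset; inside; outside) renaming (_∈_ to _∈ˢ_)
import Data.Fin.Subset.Properties as Subsetₚ
open import Data.Vec using (Vec; []; _∷_; lookup; tabulate)
open import Data.Vec.Properties using (lookup∘tabulate)
open import Data.List using (List; []; _∷_; _++_; map; length; filter; allFin; cartesianProduct)
import Data.List as List
open import Data.List.Relation.Unary.All using (All; []; _∷_)
import Data.List.Relation.Unary.All as All
import Data.List.Relation.Unary.All.Properties as Allₚ
open import Data.List.Relation.Unary.AllPairs using ([]; _∷_; allPairs?)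
open import Data.List.Relation.Unary.Unique.Propositional using (Unique)
open import Data.List.Membership.Propositional using (_∈_)
open import Data.List.Membership.Propositional.Properties using (∈-lookup)
import Data.List.Membership.DecPropositional as DecMembership
open import Data.Product using (∃; ∃₂; _×_; _,_; proj₁; proj₂)
open import Data.Product.Properties using (≡-dec)
open import Data.Sum using (_⊎_; inj₁; inj₂)
open import Function using (_∘_; id; _⇔_; mk⇔; Equivalence)
open import Level using (0ℓ)
open import Relation.Binary using (Rel; Symmetric; Irreflexive)
import Relation.Binary as B
open import Relation.Binary.Construct.Closure.ReflexiveTransitive using (Star)
open import Relation.Binary.PropositionalEquality
  using (_≡_; _≢_; refl; sym; trans; cong; ≢-sym)
open import Relation.Nullary using (Dec; yes; no; ¬?; contradiction)
open import Relation.Nullary.Decidable using (map′; _×-dec_; _⊎-dec_; _→-dec_)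
open import Relation.Unary using (Pred; Decidable)

record Graph (n : ℕ) : Set₁ where
  field
    _~_    : Rel (Fin n) 0ℓ
    ~-sym  : Symmetric _~_
    ~-irr  : Irreflexive _≡_ _~_
    _~?_   : B.Decidable _~_

-- The one-vertex graph is connected, the empty graph is not.
Connected : ∀ {n} → Graph n → Set
Connected {n} G = Fin n × (∀ u v → Star _~_ u v)
  where open Graph G

K : (t : ℕ) → Graph t
K t = record
  { _~_   = _≢_
  ; ~-sym = ≢-sym
  ; ~-irr = λ u≡v u≢v → u≢v u≡v
  ; _~?_  = λ u v → ¬? (u Finₚ.≟ v)
  }

∣E∣ : ∀ {n} → Graph n → ℕ
∣E∣ {n} G = length (filter edge? (cartesianProduct (allFin n) (allFin n)))
  where
  open Graph G
  edge? = λ ((u , v) : Fin n × Fin n) → (u <? v) ×-dec (u ~? v)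

IsProper : ∀ {n k} → Graph n → (Fin n → Fin k) → Set
IsProper G c = ∀ u v → u ~ v → c u ≢ c v
  where open Graph G

Colorable : ∀ {n} → Graph n → ℕ → Set
Colorable {n} G k = ∃ λ (c : Fin n → Fin k) → IsProper G c

IsChromaticNumber : ∀ {n} → Graph n → ℕ → Set
IsChromaticNumber G k = Colorable G k × (∀ j → Colorable G j → k ≤ⁿ j)

anyVec? : ∀ {n k} {P : Vec (Fin k) n → Set} → Decidable P → Dec (∃ P)
anyVec? {zero}  P? = map′ ([] ,_) (λ { ([] , p) → p }) (P? [])
anyVec? {suc n} P? =
  map′ (λ (x , xs , p) → x ∷ xs , p) (λ { (x ∷ xs , p) → x , xs , p })
       (Finₚ.any? λ x → anyVec? λ xs → P? (x ∷ xs))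

isProper? : ∀ {n k} (G : Graph n) (c : Fin n → Fin k) → Dec (IsProper G c)
isProper? G c = Finₚ.all? λ u → Finₚ.all? λ v → (u ~? v) →-dec ¬? (c u Finₚ.≟ c v)
  where open Graph G

colorable? : ∀ {n} (G : Graph n) k → Dec (Colorable G k)
colorable? G k =
  map′ (λ (cs , p) → lookup cs , p)
       (λ (c , p) → tabulate c , λ u v u~v eq →
          p u v u~v (trans (sym (lookup∘tabulate c u)) (trans eq (lookup∘tabulate c v))))
       (anyVec? λ cs → isProper? G (lookup cs))

least : ∀ {P : Pred ℕ 0ℓ} → Decidable P → ∀ m → P m → ∃ λ k → P k × (∀ j → P j → k ≤ⁿ j)
least P? m p with P? 0
least P? m       p | yes p₀ = 0 , p₀ , λ _ _ → z≤n
least P? zero    p | no ¬p₀ = contradiction p ¬p₀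
least P? (suc m) p | no ¬p₀ =
  let k , pₖ , min = least (P? ∘ suc) m p in
  suc k , pₖ , λ { zero p₀ → contradiction p₀ ¬p₀ ; (suc j) pⱼ → s≤s (min j pⱼ) }

chromaticNumber : ∀ {n} (G : Graph n) → ∃ (IsChromaticNumber G)
chromaticNumber {n} G = least (colorable? G) n (id , λ _ _ u~v u≡v → ~-irr u≡v u~v)
  where open Graph G

χ : ∀ {n} → Graph n → ℕ
χ G = proj₁ (chromaticNumber G)

-- A concrete graph is given by a list of its vertices and a list of its
-- edges, the edge {u , v} being listed as (u , v) or as (v , u).  The
-- union of graphs corresponds to concatenation of the edge lists.

Edges : Set → Set
Edges V = List (V × V)

-- The path from a to b with interior vertices p; its length is
-- suc (length p).
path : ∀ {V : Set} → V → List V → V → Edges V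
path a []      b = (a , b) ∷ []
path a (x ∷ p) b = (a , x) ∷ path x p b

triangle : ∀ {V : Set} → V → V → V → Edges V
triangle x y z = (x , y) ∷ (y , z) ∷ (z , x) ∷ []

data Cycle {V : Set} : List V → Edges V → Set where
  cycle : ∀ v c → Unique (v ∷ c) → 3 ≤ⁿ length (v ∷ c) → Cycle (v ∷ c) (path v c v)

-- ns lists the neighbours of w on the cycle.
data Pyramid {V : Set} : List V → Edges V → Set where
  pyramid : ∀ {cs es} w ns → Cycle cs es → All (w ≢_) cs →
            Unique ns → All (_∈ cs) ns → 3 ≤ⁿ length ns →
            Pyramid (w ∷ cs) (es ++ map (w ,_) ns)

-- In the remaining three families uniqueness of the full vertex list says
-- both that each Pᵢ is a path and that the Pᵢ meet only where prescribed.

data Trihedron {V : Set} : List V → Edges V → Set where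
  trihedron : ∀ a b p₁ p₂ p₃ →
              Unique (a ∷ b ∷ p₁ ++ p₂ ++ p₃) →
              1 ≤ⁿ length p₁ → 1 ≤ⁿ length p₂ → 1 ≤ⁿ length p₃ →
              Trihedron (a ∷ b ∷ p₁ ++ p₂ ++ p₃)
                        (path a p₁ b ++ path a p₂ b ++ path a p₃ b)

data Stamp {V : Set} : List V → Edges V → Set where
  stamp : ∀ x₁ x₂ x₃ x p₁ p₂ p₃ →
          Unique (x₁ ∷ x₂ ∷ x₃ ∷ x ∷ p₁ ++ p₂ ++ p₃) →
          Stamp (x₁ ∷ x₂ ∷ x₃ ∷ x ∷ p₁ ++ p₂ ++ p₃)
                (triangle x₁ x₂ x₃ ++ path x₁ p₁ x ++ path x₂ p₂ x ++ path x₃ p₃ x)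

data Prism {V : Set} : List V → Edges V → Set where
  prism : ∀ x₁ x₂ x₃ y₁ y₂ y₃ p₁ p₂ p₃ →
          Unique (x₁ ∷ x₂ ∷ x₃ ∷ y₁ ∷ y₂ ∷ y₃ ∷ p₁ ++ p₂ ++ p₃) →
          Prism (x₁ ∷ x₂ ∷ x₃ ∷ y₁ ∷ y₂ ∷ y₃ ∷ p₁ ++ p₂ ++ p₃)
                (triangle x₁ x₂ x₃ ++ triangle y₁ y₂ y₃ ++
                 path x₁ p₁ y₁ ++ path x₂ p₂ y₂ ++ path x₃ p₃ y₃)

Solid : ∀ {V : Set} → List V → Edges V → Set
Solid vs es = Pyramid vs es ⊎ Trihedron vs es ⊎ Stamp vs es ⊎ Prism vs es

-- The subgraph of G induced on S is the graph (vs , es).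
Induces : ∀ {n} → Graph n → Subset n → List (Fin n) → Edges (Fin n) → Set
Induces {n} G S vs es =
  (∀ v → v ∈ˢ S ⇔ v ∈ vs) ×
  (∀ u v → u ∈ˢ S → v ∈ˢ S → (u ~ v) ⇔ ((u , v) ∈ es ⊎ (v , u) ∈ es))
  where open Graph G

-- Every graph isomorphic to a cycle (a solid graph) is itself a cycle
-- (a solid graph), so no isomorphism has to be mentioned.
InducedCycle : ∀ {n} → Graph n → Pred (Subset n) 0ℓ
InducedCycle G S = ∃₂ λ vs es → Cycle vs es × Induces G S vs es

InducedSolid : ∀ {n} → Graph n → Pred (Subset n) 0ℓ
InducedSolid G S = ∃₂ λ vs es → Solid vs es × Induces G S vs es

private
  ⇔-dec : ∀ {A B : Set} → Dec A → Dec B → Dec (A ⇔ B)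
  ⇔-dec a? b? = map′ (λ (f , g) → mk⇔ f g) (λ e → Equivalence.to e , Equivalence.from e)
                     ((a? →-dec b?) ×-dec (b? →-dec a?))

  unique? : ∀ {n} → Decidable (Unique {A = Fin n})
  unique? = allPairs? λ x y → ¬? (x Finₚ.≟ y)

  unique-++⁻ : ∀ {A : Set} (xs : List A) {ys} → Unique (xs ++ ys) → Unique xs × Unique ys
  unique-++⁻ []       u       = [] , u
  unique-++⁻ (x ∷ xs) (x∉ ∷ u) =
    let uxs , uys = unique-++⁻ xs u in (Allₚ.++⁻ˡ xs x∉ ∷ uxs) , uys

  unique-++₃⁻ : ∀ {A : Set} (xs ys : List A) {zs} → Unique (xs ++ ys ++ zs) →
                Unique xs × Unique ys × Unique zs
  unique-++₃⁻ xs ys u = let uxs , u′ = unique-++⁻ xs u in uxs , unique-++⁻ ys u′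

  lookup-injective : ∀ {A : Set} {xs : List A} → Unique xs → ∀ {i j} →
                     List.lookup xs i ≡ List.lookup xs j → i ≡ j
  lookup-injective (_ ∷ _)  {zero}  {zero}  _  = refl
  lookup-injective {xs = _ ∷ xs} (x∉ ∷ _) {zero}  {suc j} eq =
    contradiction eq (All.lookup x∉ (∈-lookup {xs = xs} j))
  lookup-injective {xs = _ ∷ xs} (x∉ ∷ _) {suc i} {zero}  eq =
    contradiction (sym eq) (All.lookup x∉ (∈-lookup {xs = xs} i))
  lookup-injective (_ ∷ u)  {suc i} {suc j} eq = cong suc (lookup-injective u eq)

  unique⇒length≤ : ∀ {n} {xs : List (Fin n)} → Unique xs → length xs ≤ⁿ n
  unique⇒length≤ u = Finₚ.injective⇒≤ (lookup-injective u)

  anyListUpTo? : ∀ {n} m {P : List (Fin n) → Set} → Decidable P →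
                 Dec (∃ λ xs → length xs ≤ⁿ m × P xs)
  anyListUpTo? m P? with P? []
  anyListUpTo? m       P? | yes p = yes ([] , z≤n , p)
  anyListUpTo? zero    P? | no ¬p = no λ { ([] , _ , p) → ¬p p }
  anyListUpTo? (suc m) P? | no ¬p =
    map′ (λ (x , xs , l , p) → x ∷ xs , s≤s l , p)
         (λ { ([] , _ , p)     → contradiction p ¬p
            ; (x ∷ xs , l , p) → x , xs , s≤s⁻¹ l , p })
         (Finₚ.any? λ x → anyListUpTo? m λ xs → P? (x ∷ xs))

  -- The uniqueness of the list is only used to bound the search.
  anyUnique? : ∀ {n} {P : List (Fin n) → Set} → Decidable P → Dec (∃ λ xs → Unique xs × P xs)
  anyUnique? {n} P? =
    map′ (λ (xs , _ , p) → xs , p)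
         (λ (xs , u , p) → xs , unique⇒length≤ u , u , p)
         (anyListUpTo? n λ xs → unique? xs ×-dec P? xs)

  -- map′ with the decision first, so that its type is known when the
  -- conversions are checked.
  via : ∀ {A B : Set} → Dec A → (A → B) → (B → A) → Dec B
  via a? to from = map′ to from a?

  module _ {n : ℕ} where
    open DecMembership (Finₚ._≟_ {n}) using (_∈?_)
    open DecMembership (≡-dec (Finₚ._≟_ {n}) (Finₚ._≟_ {n})) using () renaming (_∈?_ to _∈ᵉ?_)

    induces? : (G : Graph n) (S : Subset n) → ∀ vs es → Dec (Induces G S vs es)
    induces? G S vs es =
      (Finₚ.all? λ v → ⇔-dec (v Subsetₚ.∈? S) (v ∈? vs)) ×-dec
      (Finₚ.all? λ u → Finₚ.all? λ v →
        (u Subsetₚ.∈? S) →-dec ((v Subsetₚ.∈? S) →-dec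
          ⇔-dec (u ~? v) (((u , v) ∈ᵉ? es) ⊎-dec ((v , u) ∈ᵉ? es))))
      where open Graph G

    module _ {Q : List (Fin n) → Edges (Fin n) → Set} (Q? : ∀ vs es → Dec (Q vs es)) where

      anyCycle? : Dec (∃₂ λ vs es → Cycle vs es × Q vs es)
      anyCycle? =
        via (Finₚ.any? λ v → anyUnique? λ c →
               unique? (v ∷ c) ×-dec (3 ≤? length (v ∷ c)) ×-dec Q? _ _)
             (λ (v , c , _ , u , l , q) → _ , _ , cycle v c u l , q)
             (λ { (_ , _ , cycle v c u@(_ ∷ u′) l , q) → v , c , u′ , u , l , q })

      anyTrihedron? : Dec (∃₂ λ vs es → Trihedron vs es × Q vs es)
      anyTrihedron? =
        via (Finₚ.any? λ a → Finₚ.any? λ b →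
              anyUnique? λ p₁ → anyUnique? λ p₂ → anyUnique? λ p₃ →
               unique? _ ×-dec (1 ≤? length p₁) ×-dec (1 ≤? length p₂) ×-dec
               (1 ≤? length p₃) ×-dec Q? _ _)
             (λ (a , b , p₁ , _ , p₂ , _ , p₃ , _ , u , l₁ , l₂ , l₃ , q) →
                _ , _ , trihedron a b p₁ p₂ p₃ u l₁ l₂ l₃ , q)
             (λ { (_ , _ , trihedron a b p₁ p₂ p₃ u@(_ ∷ _ ∷ u′) l₁ l₂ l₃ , q) →
                  let u₁ , u₂ , u₃ = unique-++₃⁻ p₁ p₂ u′ in
                  a , b , p₁ , u₁ , p₂ , u₂ , p₃ , u₃ , u , l₁ , l₂ , l₃ , q })

      anyStamp? : Dec (∃₂ λ vs es → Stamp vs es × Q vs es)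
      anyStamp? =
        via (Finₚ.any? λ x₁ → Finₚ.any? λ x₂ → Finₚ.any? λ x₃ → Finₚ.any? λ x →
              anyUnique? λ p₁ → anyUnique? λ p₂ → anyUnique? λ p₃ →
               unique? _ ×-dec Q? _ _)
             (λ (x₁ , x₂ , x₃ , x , p₁ , _ , p₂ , _ , p₃ , _ , u , q) →
                _ , _ , stamp x₁ x₂ x₃ x p₁ p₂ p₃ u , q)
             (λ { (_ , _ , stamp x₁ x₂ x₃ x p₁ p₂ p₃ u@(_ ∷ _ ∷ _ ∷ _ ∷ u′) , q) →
                  let u₁ , u₂ , u₃ = unique-++₃⁻ p₁ p₂ u′ in
                  x₁ , x₂ , x₃ , x , p₁ , u₁ , p₂ , u₂ , p₃ , u₃ , u , q })

      anyPrism? : Dec (∃₂ λ vs es → Prism vs es × Q vs es)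
      anyPrism? =
        via (Finₚ.any? λ x₁ → Finₚ.any? λ x₂ → Finₚ.any? λ x₃ →
              Finₚ.any? λ y₁ → Finₚ.any? λ y₂ → Finₚ.any? λ y₃ →
              anyUnique? λ p₁ → anyUnique? λ p₂ → anyUnique? λ p₃ →
               unique? _ ×-dec Q? _ _)
             (λ (x₁ , x₂ , x₃ , y₁ , y₂ , y₃ , p₁ , _ , p₂ , _ , p₃ , _ , u , q) →
                _ , _ , prism x₁ x₂ x₃ y₁ y₂ y₃ p₁ p₂ p₃ u , q)
             (λ { (_ , _ , prism x₁ x₂ x₃ y₁ y₂ y₃ p₁ p₂ p₃ u@(_ ∷ _ ∷ _ ∷ _ ∷ _ ∷ _ ∷ u′) , q) →
                  let u₁ , u₂ , u₃ = unique-++₃⁻ p₁ p₂ u′ in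
                  x₁ , x₂ , x₃ , y₁ , y₂ , y₃ , p₁ , u₁ , p₂ , u₂ , p₃ , u₃ , u , q })

    anyPyramid? : ∀ {Q : List (Fin n) → Edges (Fin n) → Set} → (∀ vs es → Dec (Q vs es)) →
                  Dec (∃₂ λ vs es → Pyramid vs es × Q vs es)
    anyPyramid? Q? =
      via (Finₚ.any? λ w → anyUnique? λ ns → anyCycle? λ cs es →
             All.all? (λ x → ¬? (w Finₚ.≟ x)) cs ×-dec All.all? (_∈? cs) ns ×-dec
             (3 ≤? length ns) ×-dec Q? _ _)
           (λ (w , ns , u , _ , _ , C , w∉ , ns⊆ , l , q) →
              _ , _ , pyramid w ns C w∉ u ns⊆ l , q)
           (λ { (_ , _ , pyramid w ns C w∉ u ns⊆ l , q) →
                w , ns , u , _ , _ , C , w∉ , ns⊆ , l , q })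

inducedCycle? : ∀ {n} (G : Graph n) → Decidable (InducedCycle G)
inducedCycle? G S = anyCycle? (induces? G S)

inducedSolid? : ∀ {n} (G : Graph n) → Decidable (InducedSolid G)
inducedSolid? G S =
  map′ (λ { (inj₁ (_ , _ , s , i))               → _ , _ , inj₁ s , i
          ; (inj₂ (inj₁ (_ , _ , s , i)))        → _ , _ , inj₂ (inj₁ s) , i
          ; (inj₂ (inj₂ (inj₁ (_ , _ , s , i)))) → _ , _ , inj₂ (inj₂ (inj₁ s)) , i
          ; (inj₂ (inj₂ (inj₂ (_ , _ , s , i)))) → _ , _ , inj₂ (inj₂ (inj₂ s)) , i })
       (λ { (_ , _ , inj₁ s , i)               → inj₁ (_ , _ , s , i)
          ; (_ , _ , inj₂ (inj₁ s) , i)        → inj₂ (inj₁ (_ , _ , s , i))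
          ; (_ , _ , inj₂ (inj₂ (inj₁ s)) , i) → inj₂ (inj₂ (inj₁ (_ , _ , s , i)))
          ; (_ , _ , inj₂ (inj₂ (inj₂ s)) , i) → inj₂ (inj₂ (inj₂ (_ , _ , s , i))) })
       (anyPyramid? Q? ⊎-dec anyTrihedron? Q? ⊎-dec anyStamp? Q? ⊎-dec anyPrism? Q?)
  where Q? = induces? G S

subsets : ∀ n → List (Subset n)
subsets zero    = [] ∷ []
subsets (suc n) = map (outside ∷_) (subsets n) ++ map (inside ∷_) (subsets n)

∣C∣ : ∀ {n} → Graph n → ℕ
∣C∣ {n} G = length (filter (inducedCycle? G) (subsets n))

∣S∣ : ∀ {n} → Graph n → ℕ
∣S∣ {n} G = length (filter (inducedSolid? G) (subsets n))

ℶ³ : ∀ {n} → Graph n → ℤ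
ℶ³ {n} G = + ∣S∣ G - + ∣C∣ G + + ∣E∣ G - + n

{-# OPTIONS --safe #-}

-- The vertices are deleted one at a time.  A connected vertex set W contains a
-- vertex v for which there is a connected D ⊆ W ∖ N[v] such that every neighbour
-- of v in W either has a neighbour in D or is adjacent to all other neighbours
-- of v.  Let d be the degree of v in W.  Any three neighbours of v are exactly
-- the neighbours of v in some solid, completed through D; this gives d C 3 solids
-- in which v has degree 3.  For two neighbours a and b of v, consider the induced
-- cycles in which v has the neighbours a and b.  Any two of them are linked by a
-- chain of solids each containing just two consecutive ones: otherwise take two
-- unlinked cycles with minimal union; the union contains no third such cycle, and
-- this leaves so few edges that the union is a solid.  So, for each of the d C 2
-- pairs a, b, all but one of these cycles are paid for by solids in which v has
-- degree 2.
--
-- Hence deleting v decreases |S| − |C| + |E| − |V| by at least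
-- d C 3 − d C 2 + d − 1 = (d − 1) C 3.  A colouring of W ∖ v with k + 1 colours
-- extends to v if d ≤ k, and otherwise k + 2 colours suffice while
-- (d − 1) C 3 ≥ k C 3.  By Pascal's rule, W has a colouring with some k + 1
-- colours for which |S| − |C| + |E| − |V| + 1 ≥ k C 4 in W.  The alternating sum
-- of binomial coefficients of χ = k + 1 is k C 4 − 1.

module Submission where

open import Defs
open import Data.Bool using (if_then_else_)
open import Data.Nat using (ℕ; zero; suc; _∸_; z≤n; s≤s; s≤s⁻¹)
  renaming (_+_ to _+ⁿ_; _≤_ to _≤ⁿ_; _<_ to _<ⁿ_; _≟_ to _≟ⁿ_)
import Data.Nat.Properties as ℕₚ
open ℕₚ using (+-assoc; +-cancelʳ-≤; +-comm; +-identityʳ; +-mono-≤; +-monoʳ-≤; +-monoˡ-≤; +-suc; <-irrefl; m≤m+n;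
   m≤n+m; m≤n⇒m≤1+n; n≤1+n; suc-injective; ∸-monoˡ-≤; ≤-antisym; ≤-reflexive; ≤-trans; ≤⇒≯; ≤∧≢⇒<; ≮⇒≥; ≰⇒>)
open import Data.Nat.Combinatorics using (_C_; nCn≡1; nC1≡n; nCk≡nC[n∸k]; nCk+nC[k+1]≡[n+1]C[k+1])
open import Data.Nat.Tactic.RingSolver using (solve-∀)
open import Data.Fin using (Fin; zero; suc) renaming (_<_ to _<ᶠ_; _<?_ to _<ᶠ?_)
import Data.Fin.Properties as Finₚ
open import Data.Fin.Subset using (Subset; inside; outside; ∣_∣; _⊆_; _∩_; _∪_; ⊤; ⁅_⁆; Nonempty)
  renaming (_∈_ to _∈ˢ_; _∉_ to _∉ˢ_; _-_ to _∖_; ⊥ to ∅)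
open import Data.Fin.Subset.Properties using (_⊆?_; out⊆; in⊆in; ∣p∣≤n; Empty-unique; drop-there; nonempty?;
   p⊂q⇒∣p∣<∣q∣; p⊆p∪q; p─q⊆p; p─q─q≡p─q; x∈p⇒∣p-x∣<∣p∣; x∈p∧x≢y⇒x∈p-y; x∈p∩q⁺; x∈p∩q⁻; x∈p∪q⁺; x∈p∪q⁻; x∈⁅x⁆;
   x∈⁅y⁆⇒x≡y; ∈⊤; ∉⊥; ∣⊤∣≡n; ∣⊥∣≡0; ⊆-antisym; ⊆-max)
  renaming (_∈?_ to _∈ˢ?_)
open import Data.Vec using ([]; _∷_; here; there)
import Data.Vec as Vec
import Data.Vec.Properties as Vecₚ
open import Data.List using (List; []; _∷_; _++_; map; length; filter; allFin; cartesianProduct; reverse;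
   initLast; _∷ʳ′_)
open import Data.List.Properties using (++-assoc; filter-++; filter-all; filter-none; length-++; length-map;
   length-reverse; length-tabulate; reverse-++; unfold-reverse; ∷-injectiveʳ; ∷-injectiveˡ; ∷ʳ-injectiveʳ)
open import Data.List.Relation.Unary.All using (All; []; _∷_; lookup; tabulate)
import Data.List.Relation.Unary.All as All
open import Data.List.Relation.Unary.All.Properties using (++⁺; ++⁻ʳ; ++⁻ˡ; All¬⇒¬Any; all-filter; filter⁺; map⁺;
   ¬All⇒Any¬; ¬Any⇒All¬)
open import Data.List.Relation.Unary.Any using (Any; here; there)
import Data.List.Relation.Unary.Any as Any
import Data.List.Relation.Unary.Any.Properties as Anyₚ
open import Data.List.Relation.Unary.AllPairs using (AllPairs; []; _∷_)
import Data.List.Relation.Unary.AllPairs as AllPairs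
import Data.List.Relation.Unary.AllPairs.Properties as AllPairsₚ
open import Data.List.Relation.Unary.Unique.Propositional using (Unique)
import Data.List.Relation.Unary.Unique.Propositional.Properties as Uniqueₚ
open import Data.List.Membership.Propositional using (_∈_; _∉_; find; lose)
open import Data.List.Membership.Propositional.Properties
  using (∈-∃++; ∈-++⁺ˡ; ∈-++⁺ʳ; ∈-++⁻; ∈-map⁺; ∈-map⁻; ∈-filter⁺; ∈-filter⁻; ∈-allFin; ∈-cartesianProduct⁺)
open import Data.Product using (∃; ∃₂; _×_; _,_; proj₁; proj₂)
open import Data.Sum using (_⊎_; inj₁; inj₂; [_,_]′)
open import Data.Empty using (⊥; ⊥-elim)
open import Function using (_∘_; id; _⇔_; mk⇔; Equivalence; case_of_)
open import Relation.Binary using (DecidableEquality)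
open import Relation.Binary.PropositionalEquality
  using (_≡_; _≢_; refl; sym; trans; cong; cong₂; subst; subst₂; ≢-sym)
open import Relation.Nullary using (¬_; Dec; yes; no; ¬?; contradiction; does)
open import Relation.Nullary.Decidable using (_×-dec_; _⊎-dec_; _→-dec_; dec-true)
open import Relation.Unary using (Pred; Decidable)
open import Level using (0ℓ)
open import Relation.Binary.Construct.Closure.ReflexiveTransitive using (Star; ε; _◅_; _◅◅_)
open import Data.List.Relation.Binary.Permutation.Propositional using (_↭_; ↭-sym; ↭-refl; ↭-trans; refl; prep;
   swap)
import Data.List.Relation.Binary.Permutation.Propositional.Properties as ↭ₚ

-- Chains of solids are never constructed. Instead, a labelling of the cycles through `v` is
-- considered that agrees on any two cycles linked by a solid, and it is shown to be constant on the
-- cycles with given neighbours `a` and `b` of `v`. A solid links only one pair, so it can merge at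
-- most two labels. Two paths from `a` to `b` may cross many times. They are therefore compared
-- through a `Fork`: two paths with a common beginning and a common end that are disjoint in
-- between. A path inside a fork that contains one of the two middle parts entirely is one of the
-- two given paths; a third path thus misses a vertex of each middle part and can be compared with
-- each given path inside a smaller vertex set. This is where minimality enters. The condition on
-- `D` has a second use: it keeps the remaining set connected after the deletion of `v`. Hence `d`
-- is positive at every deletion but the last. For `d` = 0 the identity for the gain would fail, its
-- left side being -1; this loss at the last vertex is the `+ 1` in the invariant.

-- Counting with duplicate-free lists, and merging labels along links.

module Counting where
  open import Data.Nat using (_+_; _≤_)

  module _ {A : Set} where

    Unique-⊆⇒length≤ : {xs ys : List A} → Unique xs → (∀ {x} → x ∈ xs → x ∈ ys) →
                       length xs ≤ length ys
    Unique-⊆⇒length≤ {[]} _ _ = z≤n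
    Unique-⊆⇒length≤ {x ∷ xs} (x∉ ∷ u) ⊆ys with ∈-∃++ (⊆ys (here refl))
    ... | as , bs , refl = ≤-trans (s≤s (Unique-⊆⇒length≤ u ⊆as++bs))
                             (≤-reflexive (sym (length-insert as)))
      where
      length-insert : ∀ as {x : A} {bs} → length (as ++ x ∷ bs) ≡ suc (length (as ++ bs))
      length-insert []       = refl
      length-insert (_ ∷ as) = cong suc (length-insert as)
      ⊆as++bs : ∀ {y} → y ∈ xs → y ∈ as ++ bs
      ⊆as++bs y∈ with ∈-++⁻ as (⊆ys (there y∈))
      ... | inj₁ y∈as           = ∈-++⁺ˡ y∈as
      ... | inj₂ (here refl)    = contradiction refl (lookup x∉ y∈)
      ... | inj₂ (there y∈bs)   = ∈-++⁺ʳ as y∈bs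

    count : {P : Pred A 0ℓ} → Decidable P → List A → ℕ
    count P? xs = length (filter P? xs)

    module _ {P Q : Pred A 0ℓ} (P? : Decidable P) (Q? : Decidable Q) where

      count-mono : (∀ {x} → P x → Q x) → ∀ xs → count P? xs ≤ count Q? xs
      count-mono P⊆Q []       = z≤n
      count-mono P⊆Q (x ∷ xs) with P? x | Q? x
      ... | yes _ | yes _ = s≤s (count-mono P⊆Q xs)
      ... | yes p | no ¬q = contradiction (P⊆Q p) ¬q
      ... | no _  | yes _ = m≤n⇒m≤1+n (count-mono P⊆Q xs)
      ... | no _  | no _  = count-mono P⊆Q xs

      module _ {R : Pred A 0ℓ} (R? : Decidable R) {xs : List A} (u : Unique xs) where

        count-cover : (∀ {x} → R x → P x ⊎ Q x) → count R? xs ≤ count P? xs + count Q? xs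
        count-cover f = subst (count R? xs ≤_) (length-++ (filter P? xs))
          (Unique-⊆⇒length≤ (Uniqueₚ.filter⁺ R? u) λ x∈ → let x∈xs , r = ∈-filter⁻ R? {xs = xs} x∈ in
            [ ∈-++⁺ˡ ∘ ∈-filter⁺ P? x∈xs , ∈-++⁺ʳ (filter P? xs) ∘ ∈-filter⁺ Q? x∈xs ]′ (f r))

        count-disjoint : (∀ {x} → P x → R x) → (∀ {x} → Q x → R x) → (∀ {x} → P x → ¬ Q x) →
                         count P? xs + count Q? xs ≤ count R? xs
        count-disjoint f g d = subst (_≤ count R? xs) (length-++ (filter P? xs))
          (Unique-⊆⇒length≤ (Uniqueₚ.++⁺ (Uniqueₚ.filter⁺ P? u) (Uniqueₚ.filter⁺ Q? u)
              λ (x∈ , x∈′) → d (proj₂ (∈-filter⁻ P? {xs = xs} x∈)) (proj₂ (∈-filter⁻ Q? {xs = xs} x∈′)))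
            λ x∈ → [ (λ x∈ → let x∈xs , p = ∈-filter⁻ P? {xs = xs} x∈ in ∈-filter⁺ R? x∈xs (f p))
                   , (λ x∈ → let x∈xs , q = ∈-filter⁻ Q? {xs = xs} x∈ in ∈-filter⁺ R? x∈xs (g q)) ]′
                   (∈-++⁻ (filter P? xs) x∈))

  count-map : ∀ {A B : Set} (f : A → B) {P : Pred B 0ℓ} (P? : Decidable P) xs →
              count P? (map f xs) ≡ count (P? ∘ f) xs
  count-map f P? []       = refl
  count-map f P? (x ∷ xs) with P? (f x)
  ... | yes _ = cong suc (count-map f P? xs)
  ... | no _  = count-map f P? xs

  count-++ : ∀ {A : Set} {P : Pred A 0ℓ} (P? : Decidable P) xs ys →
             count P? (xs ++ ys) ≡ count P? xs + count P? ys
  count-++ P? xs ys = trans (cong length (filter-++ P? xs ys)) (length-++ (filter P? xs))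

  count-none : ∀ {A : Set} {P : Pred A 0ℓ} (P? : Decidable P) → (∀ {x} → ¬ P x) → ∀ xs → count P? xs ≡ 0
  count-none P? ¬P xs = cong length (filter-none P? (All.universal (λ _ → ¬P) xs))

  -- A labelling of X that is constant along the links of every U ∈ Y is
  -- built by merging two labels for each such U, starting from the identity.
  module Links {A B : Set} (_≟_ : DecidableEquality A)
               (Link : B → A → A → Set) (link? : ∀ U P Q → Dec (Link U P Q))
               (link-unique : ∀ {U P Q P′ Q′} → Link U P Q → Link U P′ Q′ →
                              (P′ ≡ P ⊎ P′ ≡ Q) × (Q′ ≡ P ⊎ Q′ ≡ Q))
               (X : List A) where

    Respects : (A → A) → List B → Set
    Respects f Y = ∀ {U P Q} → U ∈ Y → P ∈ X → Q ∈ X → Link U P Q → f P ≡ f Q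

    private
      merge : A → A → (A → A) → A → A
      merge c d f x = if does (f x ≟ c) then d else f x

      merge-≡ : ∀ {c d} f {x} → f x ≡ c → merge c d f x ≡ d
      merge-≡ {c} f {x} eq with f x ≟ c
      ... | yes _ = refl
      ... | no ¬e = contradiction eq ¬e

      merge-≢ : ∀ {c d} f {x} → f x ≢ c → merge c d f x ≡ f x
      merge-≢ {c} f {x} neq with f x ≟ c
      ... | yes e = contradiction e neq
      ... | no _  = refl

      merge-cong : ∀ {c d} f {x y} → f x ≡ f y → merge c d f x ≡ merge c d f y
      merge-cong f eq rewrite eq = refl

      Separated : (A → A) → List A → Set
      Separated f = AllPairs (λ x y → f x ≢ f y)

      merge-separated : ∀ {c d} f {R} → All (λ r → f r ≢ c) R → Separated f R → Separated (merge c d f) R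
      merge-separated f [] [] = []
      merge-separated f {r ∷ R} (r≢ ∷ R≢) (r∉ ∷ sep) =
        All.map (λ (≢c , ≢r) eq → ≢r (trans (sym (merge-≢ f r≢)) (trans eq (merge-≢ f ≢c)))) (All.zip (R≢ , r∉))
        ∷ merge-separated f R≢ sep

      -- At most one entry of a separated list carries the label `c`, so the filter loses at most
      -- one.
      length-drop : ∀ c f {R} → Separated f R → length R ≤ suc (count (λ r → ¬? (f r ≟ c)) R)
      length-drop c f [] = z≤n
      length-drop c f {r ∷ R} (r∉ ∷ sep) with f r ≟ c
      ... | no _     = s≤s (length-drop c f sep)
      ... | yes refl = s≤s (≤-reflexive (cong length (sym (filter-all _ (All.map ≢-sym r∉)))))

    -- `R` lists representatives with pairwise different labels, starting from all of `X`. Each `U`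
    -- costs at most one of them: by `link-unique` one merge settles all links of `U`.
    labelling : ∀ Y → Unique X → ∃₂ λ f R → Respects f Y × All (_∈ X) R ×
                AllPairs (λ x y → f x ≢ f y) R × length X ≤ length R + length Y
    labelling [] uX = id , X , (λ ()) , tabulate id , uX , ≤-reflexive (sym (+-identityʳ _))
    labelling (U ∷ Y) uX with labelling Y uX
    ... | f , R , resp , R∈ , sep , X≤ with Any.any? (λ P → Any.any? (link? U P) X) X
    ...   | no none = f , R , resp′ , R∈ , sep , ≤-trans X≤ (+-monoʳ-≤ (length R) (n≤1+n _))
      where
      resp′ : Respects f (U ∷ Y)
      resp′ (here refl) P∈ Q∈ l = contradiction (lose P∈ (lose Q∈ l)) none
      resp′ (there U∈)          = resp U∈
    ...   | yes some with find some
    ...     | P , P∈ , some′ with find some′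
    ...       | Q , Q∈ , l =
      merge (f P) (f Q) f , filter ≢fP? R , resp′ , filter⁺ ≢fP? R∈ ,
      merge-separated f (all-filter ≢fP? R) (AllPairsₚ.filter⁺ ≢fP? sep) , bound
      where
      ≢fP? = λ r → ¬? (f r ≟ f P)
      to-fQ : ∀ {Z} → Z ≡ P ⊎ Z ≡ Q → merge (f P) (f Q) f Z ≡ f Q
      to-fQ (inj₁ refl) = merge-≡ f refl
      to-fQ (inj₂ refl) with f Q ≟ f P
      ... | yes _ = refl
      ... | no _  = refl
      resp′ : Respects (merge (f P) (f Q) f) (U ∷ Y)
      resp′ (here refl) P∈ Q∈ l′ =
        let P′≡ , Q′≡ = link-unique l l′ in trans (to-fQ P′≡) (sym (to-fQ Q′≡))
      resp′ (there U∈) P∈ Q∈ l′ = merge-cong f (resp U∈ P∈ Q∈ l′)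
      bound : length X ≤ count ≢fP? R + suc (length Y)
      bound = begin
        length X                               ≤⟨ X≤ ⟩
        length R + length Y                    ≤⟨ +-monoˡ-≤ (length Y) (length-drop (f P) f sep) ⟩
        suc (count ≢fP? R) + length Y          ≡⟨ +-suc (count ≢fP? R) (length Y) ⟨
        count ≢fP? R + suc (length Y)          ∎
        where open ℕₚ.≤-Reasoning

    -- Representatives with equal values of `t` would have equal labels, so `t` is injective on them
    -- and there are at most `length Ts`.
    length≤classes+links : ∀ {T : Set} {Y} (Ts : List T) (t : A → T) → Unique X → (∀ {P} → P ∈ X → t P ∈ Ts) →
      (∀ f → Respects f Y → ∀ {P Q} → P ∈ X → Q ∈ X → t P ≡ t Q → f P ≡ f Q) →
      length X ≤ length Ts + length Y
    length≤classes+links {Y = Y} Ts t uX t∈ const with labelling Y uX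
    ... | f , R , resp , R∈ , sep , X≤ = ≤-trans X≤ (+-monoˡ-≤ (length Y) R≤)
      where
      distinct : ∀ {R} → All (_∈ X) R → AllPairs (λ x y → f x ≢ f y) R → Unique (map t R)
      distinct [] [] = []
      distinct (r∈ ∷ R∈) (r∉ ∷ sep) =
        map⁺ (All.map (λ (x∈ , neq) eq → neq (const f resp r∈ x∈ eq)) (All.zip (R∈ , r∉)))
        ∷ distinct R∈ sep
      R≤ : length R ≤ length Ts
      R≤ = subst (_≤ length Ts) (length-map t R)
        (Unique-⊆⇒length≤ (distinct R∈ sep)
          λ x∈ → let _ , r∈ , eq = ∈-map⁻ t x∈ in subst (_∈ Ts) (sym eq) (t∈ (lookup R∈ r∈)))

-- Subsets of a given size, and vertex sets described by lists.

module Subsets where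
  open import Data.Nat using (_+_; _≤_)
  open Counting

  ∈-subsets : ∀ {n} (S : Subset n) → S ∈ subsets n
  ∈-subsets [] = here refl
  ∈-subsets (outside ∷ S) = ∈-++⁺ˡ (∈-map⁺ _ (∈-subsets S))
  ∈-subsets {suc n} (inside ∷ S) = ∈-++⁺ʳ (map (outside ∷_) (subsets n)) (∈-map⁺ _ (∈-subsets S))

  subsets-Unique : ∀ n → Unique (subsets n)
  subsets-Unique zero    = [] ∷ []
  subsets-Unique (suc n) =
    Uniqueₚ.++⁺ (Uniqueₚ.map⁺ Vecₚ.∷-injectiveʳ (subsets-Unique n))
                (Uniqueₚ.map⁺ Vecₚ.∷-injectiveʳ (subsets-Unique n))
                λ (o , i) → let _ , _ , p = ∈-map⁻ _ o ; _ , _ , q = ∈-map⁻ _ i in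
                  case-clash (trans (sym p) q)
    where
    case-clash : ∀ {S T : Subset n} → outside ∷ S ≢ inside ∷ T
    case-clash ()

  OfSize : ∀ {n} → ℕ → Subset n → Subset n → Set
  OfSize k N T = T ⊆ N × ∣ T ∣ ≡ k

  ofSize? : ∀ {n} k (N : Subset n) → Decidable (OfSize k N)
  ofSize? k N T = (T ⊆? N) ×-dec (∣ T ∣ ≟ⁿ k)

  nC0≡1 : ∀ n → n C 0 ≡ 1
  nC0≡1 n = trans (nCk≡nC[n∸k] {0} {n} z≤n) (nCn≡1 n)

  private
    count-≡ : ∀ {A : Set} {P Q : Pred A 0ℓ} (P? : Decidable P) (Q? : Decidable Q) →
              (∀ {x} → P x → Q x) → (∀ {x} → Q x → P x) → ∀ xs → count P? xs ≡ count Q? xs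
    count-≡ P? Q? f g xs = ≤-antisym (count-mono P? Q? f xs) (count-mono Q? P? g xs)

  -- Splitting by whether the first element is chosen turns the recursion on `N` into Pascal's rule.
  count-ofSize : ∀ {n} k (N : Subset n) → count (ofSize? k N) (subsets n) ≡ ∣ N ∣ C k
  count-ofSize zero    [] = refl
  count-ofSize (suc k) [] = refl
  count-ofSize {suc n} k (s ∷ N) =
    trans (count-++ P? (map (outside ∷_) (subsets n)) _)
          (trans (cong₂ _+_ (count-map (outside ∷_) P? (subsets n)) (count-map (inside ∷_) P? (subsets n)))
                 (split s k))
    where
    P? = ofSize? k (s ∷ N)
    outs : ∀ s k → count (ofSize? k (s ∷ N) ∘ (outside ∷_)) (subsets n) ≡ ∣ N ∣ C k
    outs s k = trans (count-≡ (ofSize? k (s ∷ N) ∘ (outside ∷_)) (ofSize? k N)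
                             (λ (⊆N , eq) → (λ x∈ → drop-there (⊆N (there x∈))) , eq)
                             (λ (⊆N , eq) → out⊆ ⊆N , eq) (subsets n))
                     (count-ofSize k N)
    split : ∀ s k → count (ofSize? k (s ∷ N) ∘ (outside ∷_)) (subsets n) +
                    count (ofSize? k (s ∷ N) ∘ (inside ∷_)) (subsets n) ≡ ∣ s ∷ N ∣ C k
    split outside k = trans (cong₂ _+_ (outs outside k)
        (count-none _ (λ (⊆N , _) → λ-clash (⊆N here)) (subsets n))) (+-identityʳ _)
      where
      λ-clash : ¬ (zero ∈ˢ outside ∷ N)
      λ-clash ()
    split inside zero = trans (cong₂ _+_ (outs inside 0) (count-none _ (λ ()) (subsets n)))
      (trans (+-identityʳ _) (trans (nC0≡1 ∣ N ∣) (sym (nC0≡1 (suc ∣ N ∣)))))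
    split inside (suc k) = trans (cong₂ _+_ (outs inside (suc k))
        (trans (count-≡ (ofSize? (suc k) (inside ∷ N) ∘ (inside ∷_)) (ofSize? k N)
                 (λ (⊆N , eq) → (λ x∈ → drop-there (⊆N (there x∈))) , suc-injective eq)
                 (λ (⊆N , eq) → in⊆in ⊆N , cong suc eq) (subsets n)) (count-ofSize k N)))
      (trans (+-comm _ (∣ N ∣ C k)) (nCk+nC[k+1]≡[n+1]C[k+1] ∣ N ∣ k))

  private
    from-true : ∀ {A : Set} (a? : Dec A) → does a? ≡ inside → A
    from-true (yes a) _ = a

  abstract
    ⟪_⟫ : ∀ {n} {P : Pred (Fin n) 0ℓ} → Decidable P → Subset n
    ⟪ P? ⟫ = Vec.tabulate (does ∘ P?)

    ∈⟪⟫⁺ : ∀ {n} {P : Pred (Fin n) 0ℓ} (P? : Decidable P) {x} → P x → x ∈ˢ ⟪ P? ⟫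
    ∈⟪⟫⁺ P? {x} p = Vecₚ.lookup⇒[]= x _ (trans (Vecₚ.lookup∘tabulate (does ∘ P?) x) (dec-true (P? x) p))

    ∈⟪⟫⁻ : ∀ {n} {P : Pred (Fin n) 0ℓ} (P? : Decidable P) {x} → x ∈ˢ ⟪ P? ⟫ → P x
    ∈⟪⟫⁻ P? {x} x∈ = from-true (P? x) (trans (sym (Vecₚ.lookup∘tabulate (does ∘ P?) x)) (Vecₚ.[]=⇒lookup x∈))

  _∈ˡ?_ : ∀ {n} (x : Fin n) xs → Dec (x ∈ xs)
  x ∈ˡ? xs = Any.any? (x Finₚ.≟_) xs

  ⟦_⟧ : ∀ {n} → List (Fin n) → Subset n
  ⟦ xs ⟧ = ⟪ _∈ˡ? xs ⟫

  ∈⟦⟧⁺ : ∀ {n} {x : Fin n} {xs} → x ∈ xs → x ∈ˢ ⟦ xs ⟧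
  ∈⟦⟧⁺ {xs = xs} = ∈⟪⟫⁺ (_∈ˡ? xs)

  ∈⟦⟧⁻ : ∀ {n} {x : Fin n} {xs} → x ∈ˢ ⟦ xs ⟧ → x ∈ xs
  ∈⟦⟧⁻ {xs = xs} = ∈⟪⟫⁻ (_∈ˡ? xs)

  infix 4 _≈_
  -- Unfolds to the first component of `Induces`.
  _≈_ : ∀ {n} → Subset n → List (Fin n) → Set
  S ≈ xs = ∀ v → v ∈ˢ S ⇔ v ∈ xs

  ⟦⟧-≈ : ∀ {n} (xs : List (Fin n)) → ⟦ xs ⟧ ≈ xs
  ⟦⟧-≈ xs v = mk⇔ ∈⟦⟧⁻ ∈⟦⟧⁺

  elems : ∀ {n} → Subset n → List (Fin n)
  elems []            = []
  elems (outside ∷ S) = map suc (elems S)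
  elems (inside ∷ S)  = zero ∷ map suc (elems S)

  length-elems : ∀ {n} (S : Subset n) → length (elems S) ≡ ∣ S ∣
  length-elems []            = refl
  length-elems (outside ∷ S) = trans (length-map suc (elems S)) (length-elems S)
  length-elems (inside ∷ S)  = cong suc (trans (length-map suc (elems S)) (length-elems S))

  ∈-elems⁺ : ∀ {n} {S : Subset n} {x} → x ∈ˢ S → x ∈ elems S
  ∈-elems⁺ {S = outside ∷ S} (there x∈) = ∈-map⁺ suc (∈-elems⁺ x∈)
  ∈-elems⁺ {S = inside ∷ S}  here       = here refl
  ∈-elems⁺ {S = inside ∷ S}  (there x∈) = there (∈-map⁺ suc (∈-elems⁺ x∈))

  ∈-elems⁻ : ∀ {n} (S : Subset n) {x} → x ∈ elems S → x ∈ˢ S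
  ∈-elems⁻ (outside ∷ S) x∈ with ∈-map⁻ suc x∈
  ... | _ , y∈ , refl = there (∈-elems⁻ S y∈)
  ∈-elems⁻ (inside ∷ S) (here refl) = here
  ∈-elems⁻ (inside ∷ S) (there x∈) with ∈-map⁻ suc x∈
  ... | _ , y∈ , refl = there (∈-elems⁻ S y∈)

  elems-Unique : ∀ {n} (S : Subset n) → Unique (elems S)
  elems-Unique []            = []
  elems-Unique (outside ∷ S) = Uniqueₚ.map⁺ Finₚ.suc-injective (elems-Unique S)
  elems-Unique (inside ∷ S)  =
    map⁺ (All.universal (λ _ ()) (elems S)) ∷ Uniqueₚ.map⁺ Finₚ.suc-injective (elems-Unique S)

  ∣≈∣ : ∀ {n} {S : Subset n} {xs} → S ≈ xs → Unique xs → ∣ S ∣ ≡ length xs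
  ∣≈∣ {S = S} {xs} S≈ u = trans (sym (length-elems S)) (≤-antisym
    (Unique-⊆⇒length≤ (elems-Unique S) λ x∈ → Equivalence.to (S≈ _) (∈-elems⁻ S x∈))
    (Unique-⊆⇒length≤ u λ x∈ → ∈-elems⁺ (Equivalence.from (S≈ _) x∈)))

  ≈-elems : ∀ {n} (S : Subset n) → S ≈ elems S
  ≈-elems S v = mk⇔ ∈-elems⁺ (∈-elems⁻ S)

  ≈⇒≡ : ∀ {n} {S : Subset n} {xs} → S ≈ xs → S ≡ ⟦ xs ⟧
  ≈⇒≡ {xs = xs} S≈ = ⊆-antisym (λ x∈ → ∈⟦⟧⁺ (Equivalence.to (S≈ _) x∈))
                                      (λ x∈ → Equivalence.from (S≈ _) (∈⟦⟧⁻ {xs = xs} x∈))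

-- Induced paths: splitting, reversing, gluing and shortening.

module InducedPaths {n : ℕ} (G : Graph n) where
  open Graph G

  ~⇒≢ : ∀ {x y} → x ~ y → x ≢ y
  ~⇒≢ x~y refl = ~-irr refl x~y

  NA : Fin n → Fin n → Set
  NA x y = x ≢ y × ¬ (x ~ y)

  NA-sym : ∀ {x y} → NA x y → NA y x
  NA-sym (x≢y , x≁y) = ≢-sym x≢y , λ y~x → x≁y (~-sym y~x)

  Anti : List (Fin n) → List (Fin n) → Set
  Anti xs ys = All (λ x → All (NA x) ys) xs

  Anti-sym : ∀ {xs ys} → Anti xs ys → Anti ys xs
  Anti-sym {ys = []}     _  = []
  Anti-sym {ys = y ∷ ys} as = All.map (λ { (na ∷ _) → NA-sym na }) as ∷ Anti-sym
      (All.map (λ { (_ ∷ nas) → nas }) as)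

  data IPath : List (Fin n) → Set where
    [_]  : ∀ x → IPath (x ∷ [])
    step : ∀ {x y ys} → x ~ y → All (NA x) ys → IPath (y ∷ ys) → IPath (x ∷ y ∷ ys)

  First Last : Fin n → List (Fin n) → Set
  First a []      = ⊥
  First a (x ∷ _) = a ≡ x
  Last b []           = ⊥
  Last b (x ∷ [])     = b ≡ x
  Last b (_ ∷ y ∷ ys) = Last b (y ∷ ys)

  Last-++⁺ : ∀ xs {y ys b} → Last b (y ∷ ys) → Last b (xs ++ y ∷ ys)
  Last-++⁺ []            l = l
  Last-++⁺ (_ ∷ [])      l = l
  Last-++⁺ (_ ∷ x ∷ xs)  l = Last-++⁺ (x ∷ xs) l

  Last-++⁻ : ∀ xs {y ys b} → Last b (xs ++ y ∷ ys) → Last b (y ∷ ys)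
  Last-++⁻ []            l = l
  Last-++⁻ (_ ∷ [])      l = l
  Last-++⁻ (_ ∷ x ∷ xs)  l = Last-++⁻ (x ∷ xs) l

  First-++ : ∀ xs {y ys zs a} → First a (xs ++ y ∷ ys) → First a (xs ++ y ∷ zs)
  First-++ []      f = f
  First-++ (_ ∷ _) f = f

  Last⇒∈ : ∀ {b} xs → Last b xs → b ∈ xs
  Last⇒∈ (x ∷ [])     refl = here refl
  Last⇒∈ (x ∷ y ∷ ys) l    = there (Last⇒∈ (y ∷ ys) l)

  First⇒∈ : ∀ {a} xs → First a xs → a ∈ xs
  First⇒∈ (x ∷ _) refl = here refl

  Last⇒snoc : ∀ {b} xs → Last b xs → ∃ λ ys → xs ≡ ys ++ b ∷ []
  Last⇒snoc (x ∷ [])     refl = [] , refl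
  Last⇒snoc (x ∷ y ∷ ys) l    = let zs , eq = Last⇒snoc (y ∷ ys) l in x ∷ zs , cong (x ∷_) eq

  First-reverse : ∀ {b} xs → Last b xs → First b (reverse xs)
  First-reverse xs l with Last⇒snoc xs l
  ... | ys , refl = subst (First _) (sym (reverse-++ ys (_ ∷ []))) refl

  Last-reverse : ∀ {a} xs → First a xs → Last a (reverse xs)
  Last-reverse (x ∷ xs) refl = subst (Last x) (sym (unfold-reverse x xs)) (Last-++⁺ (reverse xs) refl)

  IPath-head≢ : ∀ {x ys} → IPath (x ∷ ys) → All (x ≢_) ys
  IPath-head≢ [ _ ]            = []
  IPath-head≢ (step x~y nas _) = ~⇒≢ x~y ∷ All.map proj₁ nas

  IPath⇒Unique : ∀ {xs} → IPath xs → Unique xs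
  IPath⇒Unique [ _ ]              = [] ∷ []
  IPath⇒Unique p@(step _ _ p′)    = IPath-head≢ p ∷ IPath⇒Unique p′

  IPath-head∉ : ∀ {x ys} → IPath (x ∷ ys) → x ∉ ys
  IPath-head∉ π x∈ = lookup (IPath-head≢ π) x∈ refl

  Unique-++⇒∉ : ∀ xs {ys} {z : Fin n} → Unique (xs ++ ys) → z ∈ xs → z ∉ ys
  Unique-++⇒∉ (x ∷ xs) (x∉ ∷ _) (here refl) z∈ys = lookup (++⁻ʳ xs x∉) z∈ys refl
  Unique-++⇒∉ (x ∷ xs) (_ ∷ u)  (there z∈)       = Unique-++⇒∉ xs u z∈

  Unique-snoc-≢ : ∀ xs {y z : Fin n} → Unique (xs ++ y ∷ []) → z ∈ xs → z ≢ y
  Unique-snoc-≢ xs u z∈ refl = Unique-++⇒∉ xs u z∈ (here refl)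

  IPath-++⇒∉ : ∀ xs {ys z} → IPath (xs ++ ys) → z ∈ xs → z ∉ ys
  IPath-++⇒∉ xs π = Unique-++⇒∉ xs (IPath⇒Unique π)

  IPath-++⁻ʳ : ∀ xs {y ys} → IPath (xs ++ y ∷ ys) → IPath (y ∷ ys)
  IPath-++⁻ʳ []           p            = p
  IPath-++⁻ʳ (_ ∷ [])     (step _ _ p) = p
  IPath-++⁻ʳ (_ ∷ x ∷ xs) (step _ _ p) = IPath-++⁻ʳ (x ∷ xs) p

  IPath-++⁻ˡ : ∀ xs {y ys} → IPath (xs ++ y ∷ ys) → IPath (xs ++ y ∷ [])
  IPath-++⁻ˡ []           p                    = [ _ ]
  IPath-++⁻ˡ (_ ∷ [])     (step x~y _ p)       = step x~y [] [ _ ]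
  IPath-++⁻ˡ (_ ∷ x ∷ xs) {y} {ys} (step x~y nas p) =
    step x~y (++⁺ (++⁻ˡ xs nas) (All.head (++⁻ʳ xs nas) ∷ [])) (IPath-++⁻ˡ (x ∷ xs) p)

  IPath-Anti : ∀ xs {y ys} → IPath (xs ++ y ∷ ys) → Anti xs ys
  IPath-Anti []           p              = []
  IPath-Anti (_ ∷ [])     (step _ nas p) = nas ∷ []
  IPath-Anti (_ ∷ x ∷ xs) (step _ nas p) = All.tail (++⁻ʳ xs nas) ∷ IPath-Anti (x ∷ xs) p

  IPath-++⁺ : ∀ xs {y ys} → IPath (xs ++ y ∷ []) → IPath (y ∷ ys) → Anti xs ys → IPath (xs ++ y ∷ ys)
  IPath-++⁺ []           p                q as         = q
  IPath-++⁺ (_ ∷ [])     (step x~y _ p)   q (a ∷ [])   = step x~y a q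
  IPath-++⁺ (_ ∷ x ∷ xs) (step x~y nas p) q (a ∷ as)   =
    step x~y (++⁺ (++⁻ˡ xs nas) (All.head (++⁻ʳ xs nas) ∷ a)) (IPath-++⁺ (x ∷ xs) p q as)

  IPath-snoc : ∀ {xs b z} → IPath xs → Last b xs → b ~ z → All (λ x → x ≡ b ⊎ NA x z) xs → IPath (xs ++ z ∷ [])
  IPath-snoc [ _ ] refl b~z _ = step b~z [] [ _ ]
  IPath-snoc {x ∷ y ∷ ys} p@(step x~y nas p′) l b~z (x? ∷ xs?) =
    step x~y (++⁺ nas (na x? ∷ [])) (IPath-snoc p′ l b~z xs?)
    where
    na : x ≡ _ ⊎ NA x _ → NA x _
    na (inj₁ refl) = contradiction refl (lookup (IPath-head≢ p) (Last⇒∈ (y ∷ ys) l))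
    na (inj₂ na)   = na

  All-reverse : ∀ {P : Pred (Fin n) 0ℓ} {xs} → All P xs → All P (reverse xs)
  All-reverse ps = tabulate λ x∈ → lookup ps (Anyₚ.reverse⁻ x∈)

  IPath-reverse : ∀ {xs} → IPath xs → IPath (reverse xs)
  IPath-reverse [ x ] = [ x ]
  IPath-reverse {x ∷ y ∷ ys} (step x~y nas p) =
    subst IPath (sym (unfold-reverse x (y ∷ ys)))
      (IPath-snoc (IPath-reverse p) (Last-reverse (y ∷ ys) refl) (~-sym x~y)
        (All-reverse (inj₁ refl ∷ All.map (inj₂ ∘ NA-sym) nas)))

  Arc : Fin n → List (Fin n) → Fin n → Set
  Arc a p b = IPath (a ∷ p ++ b ∷ [])

  Arc-reverse : ∀ {a p b} → Arc a p b → Arc b (reverse p) a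
  Arc-reverse {a} {p} {b} arc = subst IPath eq (IPath-reverse arc)
    where
    eq : reverse (a ∷ p ++ b ∷ []) ≡ b ∷ reverse p ++ a ∷ []
    eq = trans (unfold-reverse a (p ++ b ∷ [])) (cong (_++ a ∷ []) (reverse-++ p (b ∷ [])))

  Arc-nonadjacent : ∀ {a p b x} → Arc a p b → x ∈ p → NA a b
  Arc-nonadjacent {p = _ ∷ p} (step _ nas _) _ = lookup nas (∈-++⁺ʳ p (here refl))

  Anti-reverse : ∀ {xs ys} → Anti xs ys → Anti xs (reverse ys)
  Anti-reverse = All.map All-reverse

  -- The path is entered at the last neighbour of `x`, which leaves no chord at `x`. If `x` itself
  -- lies on the path, the part before `x` is cut off instead.
  prepend : ∀ x {xs b} → IPath xs → Last b xs → Any (x ~_) xs →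
            ∃ λ ys → IPath (x ∷ ys) × Last b (x ∷ ys) × All (_∈ xs) ys
  prepend x {y ∷ ys} p l x~ with x Finₚ.≟ y
  ... | yes refl = ys , p , l , tabulate there
  prepend x {y ∷ []} [ _ ] l (here x~y) | no _ = y ∷ [] , step x~y [] [ _ ] , l , here refl ∷ []
  prepend x {y ∷ z ∷ zs} {b} p@(step _ _ p′) l x~ | no x≢y
    with Any.any? (x ~?_) (z ∷ zs) | Any.any? (x Finₚ.≟_) (z ∷ zs)
  ... | yes x~zs | _ = let ys , q , l′ , ys⊆ = prepend x p′ l x~zs in ys , q , l′ , All.map there ys⊆
  ... | no x≁zs | yes x∈zs = from x∈zs p′ l (tabulate there)
    where
    from : ∀ {ws} → x ∈ ws → IPath ws → Last b ws → All (_∈ y ∷ z ∷ zs) ws →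
           ∃ λ ys → IPath (x ∷ ys) × Last b (x ∷ ys) × All (_∈ y ∷ z ∷ zs) ys
    from (here refl) p l (_ ∷ ws⊆)            = _ , p , l , ws⊆
    from (there x∈) (step _ _ p) l (_ ∷ ws⊆)  = from x∈ p l ws⊆
  ... | no x≁zs | no x∉zs = y ∷ z ∷ zs , step (x~y x~) nas p , l , tabulate id
    where
    x~y : Any (x ~_) (y ∷ z ∷ zs) → x ~ y
    x~y (here x~y)   = x~y
    x~y (there x~zs) = contradiction x~zs x≁zs
    nas : All (NA x) (z ∷ zs)
    nas = tabulate λ w∈ → (λ eq → x∉zs (subst (_∈ z ∷ zs) (sym eq) w∈)) , λ x~w → x≁zs (lose w∈ x~w)

  -- The vertices of the first path are put before the second one by one, starting from `x`, with
  -- `prepend` taking a shortcut each time. Vertices may be skipped but none are added.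
  glue : ∀ xs {x ys a b} → IPath (xs ++ x ∷ []) → First a (xs ++ x ∷ []) → IPath ys → Last b ys → Any (x ~_) ys →
         ∃ λ zs → IPath (a ∷ zs) × Last b (a ∷ zs) × All (λ z → z ∈ xs ++ x ∷ [] ⊎ z ∈ ys) (a ∷ zs)
  glue [] {x} p refl q l x~ =
    let zs , r , l′ , zs⊆ = prepend x q l x~ in zs , r , l′ , inj₁ (here refl) ∷ All.map inj₂ zs⊆
  glue (h ∷ []) {x} {ys} p@(step h~x _ p′) refl q l x~ with glue [] p′ refl q l x~
  ... | zs , r , l′ , zs⊆ with prepend h r l′ (here h~x)
  ...   | ws , s , l″ , ws⊆ = ws , s , l″ , inj₁ (here refl) ∷
            All.map (λ z∈ → [ inj₁ ∘ there , inj₂ ]′ (lookup zs⊆ z∈)) ws⊆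
  glue (h ∷ h′ ∷ xs) p@(step h~h′ _ p′) refl q l x~ with glue (h′ ∷ xs) p′ refl q l x~
  ... | zs , r , l′ , zs⊆ with prepend h r l′ (here h~h′)
  ...   | ws , s , l″ , ws⊆ = ws , s , l″ , inj₁ (here refl) ∷
            All.map (λ z∈ → [ inj₁ ∘ there , inj₂ ]′ (lookup zs⊆ z∈)) ws⊆

  split-first : ∀ {P : Pred (Fin n) 0ℓ} → Decidable P → ∀ {xs} → Any P xs →
                ∃₂ λ as x → ∃ λ bs → xs ≡ as ++ x ∷ bs × All (λ y → ¬ P y) as × P x
  split-first P? {x ∷ xs} any with P? x | any
  ... | yes px | _         = [] , x , xs , refl , [] , px
  ... | no ¬px | here px   = contradiction px ¬px
  ... | no ¬px | there any′ =
    let as , y , bs , eq , ¬as , py = split-first P? any′ in x ∷ as , y , bs , cong (x ∷_) eq , ¬px ∷ ¬as , py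

  split-last : ∀ {P : Pred (Fin n) 0ℓ} → Decidable P → ∀ {xs} → Any P xs →
               ∃₂ λ as x → ∃ λ bs → xs ≡ as ++ x ∷ bs × P x × All (λ y → ¬ P y) bs
  split-last P? {x ∷ xs} any with Any.any? P? xs | any
  ... | yes any′ | _       =
    let as , y , bs , eq , py , ¬bs = split-last P? any′ in x ∷ as , y , bs , cong (x ∷_) eq , py , ¬bs
  ... | no none | here px  = [] , x , xs , refl , px , ¬Any⇒All¬ xs none
  ... | no none | there a  = contradiction a none

  Step : Pred (Fin n) 0ℓ → Fin n → Fin n → Set
  Step D x y = x ~ y × D y

  Walk : Pred (Fin n) 0ℓ → Fin n → Fin n → Set
  Walk D = Star (Step D)

  Conn : Pred (Fin n) 0ℓ → Set
  Conn D = ∀ {x y} → D x → D y → Walk D x y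

  shortcut : ∀ {x q r} → IPath (q ++ r ∷ []) → x ≢ r → Any (x ~_) (q ++ r ∷ []) →
             ∃ λ q′ → IPath (x ∷ q′ ++ r ∷ []) × All (_∈ q) q′
  shortcut {x} {q} {r} path x≢r x~ with prepend x {b = r} path (Last-++⁺ q refl) x~
  ... | ys , path′ , l , ys⊆ with Last⇒snoc (x ∷ ys) l
  ...   | []     , refl = contradiction refl x≢r
  ...   | _ ∷ q′ , refl = q′ , path′ , tabulate λ z∈ →
      in-q (∈-++⁻ q (lookup (++⁻ˡ q′ ys⊆) z∈)) (Unique-snoc-≢ q′ (AllPairs.tail (IPath⇒Unique path′)) z∈)
    where
    in-q : ∀ {z} → z ∈ q ⊎ z ∈ r ∷ [] → z ≢ r → z ∈ q
    in-q (inj₁ z∈)          _  = z∈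
    in-q (inj₂ (here refl)) ≢r = contradiction refl ≢r

  module _ {D T : Pred (Fin n) 0ℓ} (T? : Decidable T) where

    private
      approach-from : ∀ {d p} → D d → Walk D d p → T p →
                 ∃₂ λ q r → IPath (q ++ r ∷ []) × All D q × D r × All (λ x → ¬ T x) q × T r × d ∈ q ++ r ∷ []
      approach-from {d} Dd w Tp with T? d
      ... | yes Td = [] , d , [ d ] , [] , Dd , [] , Td , here refl
      approach-from {d} Dd ε Tp | no ¬Td = contradiction Tp ¬Td
      approach-from {d} Dd ((d~e , De) ◅ w) Tp | no ¬Td with approach-from De w Tp
      ... | q , r , path , Dq , Dr , ¬Tq , Tr , e∈ with shortcut {q = q} path (λ { refl → ¬Td Tr }) (lose e∈ d~e)
      ...   | q′ , path′ , q′⊆ =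
        d ∷ q′ , r , path′ , Dd ∷ All.map (lookup Dq) q′⊆ , Dr , ¬Td ∷ All.map (lookup ¬Tq) q′⊆ , Tr , here refl

    -- The walk is cut at its first vertex with `T` and shortened to an induced path from the back.
    -- Shortening only drops vertices, so none before `r` satisfies `T`. As `x` lies outside `D`, it
    -- differs from `r`.
    approach : ∀ {x d p} → ¬ D x → x ~ d → D d → Walk D d p → T p →
               ∃₂ λ q r → IPath (x ∷ q ++ r ∷ []) × All D q × D r × All (λ y → ¬ T y) q × T r
    approach ¬Dx x~d Dd w Tp with approach-from Dd w Tp
    ... | q , r , path , Dq , Dr , ¬Tq , Tr , d∈ with shortcut {q = q} path (λ { refl → ¬Dx Dr }) (lose d∈ x~d)
    ...   | q′ , path′ , q′⊆ = q′ , r , path′ , All.map (lookup Dq) q′⊆ , Dr , All.map (lookup ¬Tq) q′⊆ , Tr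

-- Recognising induced solids from their induced paths.

module Solids {n : ℕ} (G : Graph n) where
  open Graph G
  open InducedPaths G
  open Subsets

  Joined : Edges (Fin n) → Fin n → Fin n → Set
  Joined es u w = (u , w) ∈ es ⊎ (w , u) ∈ es

  -- The half of `Induces` that must be checked for every pair of vertices; the other half is
  -- `Adjacent`. It survives enlarging the edge list, so each path can be treated alone.
  -- Distinctness is included because the constructors of solids ask for `Unique`.
  Covered : Edges (Fin n) → Fin n → Fin n → Set
  Covered es u w = u ≢ w × (u ~ w → Joined es u w)

  Adjacent : Edges (Fin n) → Set
  Adjacent = All λ (u , w) → u ~ w

  Joined-sym : ∀ {es u w} → Joined es u w → Joined es w u
  Joined-sym = [ inj₂ , inj₁ ]′

  Covered-sym : ∀ {es u w} → Covered es u w → Covered es w u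
  Covered-sym (u≢w , c) = ≢-sym u≢w , λ w~u → Joined-sym (c (~-sym w~u))

  Covered-mono : ∀ {es fs u w} → (∀ {e} → e ∈ es → e ∈ fs) → Covered es u w → Covered fs u w
  Covered-mono ⊆ (u≢w , c) = u≢w , λ u~w → [ inj₁ ∘ ⊆ , inj₂ ∘ ⊆ ]′ (c u~w)

  NA⇒Covered : ∀ {es u w} → NA u w → Covered es u w
  NA⇒Covered (u≢w , u≁w) = u≢w , λ u~w → contradiction u~w u≁w

  edge⇒Covered : ∀ {es u w} → u ~ w → (u , w) ∈ es → Covered es u w
  edge⇒Covered u~w e = ~⇒≢ u~w , λ _ → inj₁ e

  Anti⇒Covered : ∀ {es xs ys} → Anti xs ys → All (λ x → All (Covered es x) ys) xs
  Anti⇒Covered = All.map (All.map NA⇒Covered)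

  private
    AllPairs-lookup : ∀ {R : Fin n → Fin n → Set} {xs u w} → AllPairs R xs → u ∈ xs → w ∈ xs →
                      u ≡ w ⊎ R u w ⊎ R w u
    AllPairs-lookup (r ∷ _)  (here refl) (here refl) = inj₁ refl
    AllPairs-lookup (r ∷ _)  (here refl) (there w∈)  = inj₂ (inj₁ (lookup r w∈))
    AllPairs-lookup (r ∷ _)  (there u∈)  (here refl) = inj₂ (inj₂ (lookup r u∈))
    AllPairs-lookup (_ ∷ rs) (there u∈)  (there w∈)  = AllPairs-lookup rs u∈ w∈

  induces : ∀ {S vs es} → S ≈ vs → Adjacent es → AllPairs (Covered es) vs → Induces G S vs es
  induces {S} {vs} {es} S≈ adj cov = S≈ , λ u w u∈ w∈ →
    mk⇔ (joined (Equivalence.to (S≈ u) u∈) (Equivalence.to (S≈ w) w∈))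
        [ lookup adj , (λ e → ~-sym (lookup adj e)) ]′
    where
    joined : ∀ {u w} → u ∈ vs → w ∈ vs → u ~ w → Joined es u w
    joined u∈ w∈ u~w with AllPairs-lookup cov u∈ w∈
    ... | inj₁ refl             = contradiction u~w (~-irr refl)
    ... | inj₂ (inj₁ (_ , c))   = c u~w
    ... | inj₂ (inj₂ (_ , c))   = Joined-sym (c (~-sym u~w))

  -- Quantifying over every `S` with `S ≈ vs` makes the order of the list irrelevant, so that
  -- vertices can be permuted into the order of each constructor.
  SolidOn : List (Fin n) → Set
  SolidOn vs = ∀ {S} → S ≈ vs → InducedSolid G S

  SolidOn-↭ : ∀ {vs ws} → vs ↭ ws → SolidOn vs → SolidOn ws
  SolidOn-↭ vs↭ws solid S≈ = solid λ v →
    mk⇔ (↭ₚ.∈-resp-↭ (↭-sym vs↭ws) ∘ Equivalence.to (S≈ v)) (Equivalence.from (S≈ v) ∘ ↭ₚ.∈-resp-↭ vs↭ws)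

  path-++ : ∀ a p {b q c} → path {Fin n} a (p ++ b ∷ q) c ≡ path a p b ++ path b q c
  path-++ a []      = refl
  path-++ a (x ∷ p) = cong ((a , x) ∷_) (path-++ x p)

  path-Adjacent : ∀ {a} p {b} → Arc a p b → Adjacent (path a p b)
  path-Adjacent []      (step a~b _ _)   = a~b ∷ []
  path-Adjacent (x ∷ p) (step a~x _ arc) = a~x ∷ path-Adjacent p arc

  path-Covered : ∀ {a} p {b} → Arc a p b → AllPairs (Covered (path a p b)) (a ∷ p ++ b ∷ [])
  path-Covered []      (step a~b _ _)     = (edge⇒Covered a~b (here refl) ∷ []) ∷ [] ∷ []
  path-Covered (x ∷ p) (step a~x nas arc) =
    (edge⇒Covered a~x (here refl) ∷ All.map NA⇒Covered nas) ∷
    AllPairs.map (Covered-mono there) (path-Covered p arc)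

  -- The pairs on an arc, grouped as they occur when the ends of the arc stand near the front of a
  -- solid's vertex list and its interior stands at the back.
  record ArcParts (es : Edges (Fin n)) (a : Fin n) (p : List (Fin n)) (b : Fin n) : Set where
    field
      ends     : Covered es a b
      first    : All (Covered es a) p
      last     : All (Covered es b) p
      interior : AllPairs (Covered es) p

  arcParts : ∀ {es a p b} → (∀ {e} → e ∈ path a p b → e ∈ es) → Arc a p b → ArcParts es a p b
  arcParts {es} {a} {p} {b} ⊆es arc with AllPairs.map (Covered-mono ⊆es) (path-Covered p arc)
  ... | ab ∷ pb = record
    { ends     = All.head (++⁻ʳ p ab)
    ; first    = ++⁻ˡ p ab
    ; last     = lasts p pb
    ; interior = interior p pb
    }
    where
    lasts : ∀ p → AllPairs (Covered es) (p ++ b ∷ []) → All (Covered es b) p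
    lasts []      _        = []
    lasts (x ∷ p) (c ∷ cs) = Covered-sym (All.head (++⁻ʳ p c)) ∷ lasts p cs
    interior : ∀ p → AllPairs (Covered es) (p ++ b ∷ []) → AllPairs (Covered es) p
    interior []      _        = []
    interior (x ∷ p) (c ∷ cs) = ++⁻ˡ p c ∷ interior p cs

  private
    Covered⇒Unique : ∀ {es vs} → AllPairs (Covered es) vs → Unique vs
    Covered⇒Unique = AllPairs.map proj₁

    ++³ : ∀ {es : Edges (Fin n)} {p₁ p₂ p₃ : List (Fin n)} →
          AllPairs (Covered es) p₁ → AllPairs (Covered es) p₂ → AllPairs (Covered es) p₃ →
          Anti p₁ p₂ → Anti p₁ p₃ → Anti p₂ p₃ → AllPairs (Covered es) (p₁ ++ p₂ ++ p₃)
    ++³ c₁ c₂ c₃ a₁₂ a₁₃ a₂₃ =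
      AllPairsₚ.++⁺ c₁ (AllPairsₚ.++⁺ c₂ c₃ (Anti⇒Covered a₂₃))
        (All.map (λ (x , y) → ++⁺ x y) (All.zip (Anti⇒Covered a₁₂ , Anti⇒Covered a₁₃)))

    all³ : ∀ {P : Pred (Fin n) 0ℓ} {p₁ p₂ p₃} → All P p₁ → All P p₂ → All P p₃ → All P (p₁ ++ p₂ ++ p₃)
    all³ a b c = ++⁺ a (++⁺ b c)

    in-middle : ∀ {A : Set} (xs : List A) {ys zs} {e : A} → e ∈ ys → e ∈ xs ++ ys ++ zs
    in-middle xs e∈ = ∈-++⁺ʳ xs (∈-++⁺ˡ e∈)

  trihedron-SolidOn : ∀ {a b p₁ p₂ p₃} → Arc a p₁ b → Arc a p₂ b → Arc a p₃ b →
    1 ≤ⁿ length p₁ → 1 ≤ⁿ length p₂ → 1 ≤ⁿ length p₃ → Anti p₁ p₂ → Anti p₁ p₃ → Anti p₂ p₃ →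
    SolidOn (a ∷ b ∷ p₁ ++ p₂ ++ p₃)
  trihedron-SolidOn {a} {b} {p₁} {p₂} {p₃} arc₁ arc₂ arc₃ l₁ l₂ l₃ a₁₂ a₁₃ a₂₃ S≈ =
    _ , es , inj₂ (inj₁ (trihedron a b p₁ p₂ p₃ (Covered⇒Unique cov) l₁ l₂ l₃)) ,
    induces S≈ (++⁺ (path-Adjacent p₁ arc₁) (++⁺ (path-Adjacent p₂ arc₂) (path-Adjacent p₃ arc₃))) cov
    where
    es = path a p₁ b ++ path a p₂ b ++ path a p₃ b
    open ArcParts
    A₁ : ArcParts es a p₁ b
    A₁ = arcParts ∈-++⁺ˡ arc₁
    A₂ : ArcParts es a p₂ b
    A₂ = arcParts (in-middle (path a p₁ b)) arc₂
    A₃ : ArcParts es a p₃ b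
    A₃ = arcParts (∈-++⁺ʳ (path a p₁ b) ∘ ∈-++⁺ʳ (path a p₂ b)) arc₃
    cov : AllPairs (Covered es) (a ∷ b ∷ p₁ ++ p₂ ++ p₃)
    cov = (ends A₁ ∷ all³ (first A₁) (first A₂) (first A₃)) ∷ all³ (last A₁) (last A₂) (last A₃) ∷
          ++³ (interior A₁) (interior A₂) (interior A₃) a₁₂ a₁₃ a₂₃

  -- The required nonadjacencies between two legs. The pair `x`, `y` is left open, since an edge of
  -- the triangle may join it.
  Legs : (x : Fin n) (p : List (Fin n)) (y : Fin n) (q : List (Fin n)) → Set
  Legs x p y q = Anti (x ∷ p) q × All (NA y) p

  private
    triangle-Adjacent : ∀ {x y z} → x ~ y → y ~ z → z ~ x → Adjacent (triangle x y z)
    triangle-Adjacent a b c = a ∷ b ∷ c ∷ []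

  stamp-SolidOn : ∀ {x₁ x₂ x₃ x p₁ p₂ p₃} → x₁ ~ x₂ → x₂ ~ x₃ → x₃ ~ x₁ →
    Arc x₁ p₁ x → Arc x₂ p₂ x → Arc x₃ p₃ x →
    Legs x₁ p₁ x₂ p₂ → Legs x₁ p₁ x₃ p₃ → Legs x₂ p₂ x₃ p₃ →
    SolidOn (x₁ ∷ x₂ ∷ x₃ ∷ x ∷ p₁ ++ p₂ ++ p₃)
  stamp-SolidOn {x₁} {x₂} {x₃} {x} {p₁} {p₂} {p₃} e₁₂ e₂₃ e₃₁ arc₁ arc₂ arc₃
                (x₁p₂ ∷ a₁₂ , x₂p₁) (x₁p₃ ∷ a₁₃ , x₃p₁) (x₂p₃ ∷ a₂₃ , x₃p₂) S≈ =
    _ , es , inj₂ (inj₂ (inj₁ (stamp x₁ x₂ x₃ x p₁ p₂ p₃ (Covered⇒Unique cov)))) ,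
    induces S≈ (++⁺ (triangle-Adjacent e₁₂ e₂₃ e₃₁) (++⁺ (path-Adjacent p₁ arc₁)
                 (++⁺ (path-Adjacent p₂ arc₂) (path-Adjacent p₃ arc₃)))) cov
    where
    t  = triangle x₁ x₂ x₃
    es = t ++ path x₁ p₁ x ++ path x₂ p₂ x ++ path x₃ p₃ x
    open ArcParts
    A₁ : ArcParts es x₁ p₁ x
    A₁ = arcParts (in-middle t) arc₁
    A₂ : ArcParts es x₂ p₂ x
    A₂ = arcParts (∈-++⁺ʳ t ∘ in-middle (path x₁ p₁ x)) arc₂
    A₃ : ArcParts es x₃ p₃ x
    A₃ = arcParts (∈-++⁺ʳ t ∘ ∈-++⁺ʳ (path x₁ p₁ x) ∘ ∈-++⁺ʳ (path x₂ p₂ x)) arc₃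
    na : ∀ {u p} → All (NA u) p → All (Covered es u) p
    na = All.map NA⇒Covered
    cov : AllPairs (Covered es) (x₁ ∷ x₂ ∷ x₃ ∷ x ∷ p₁ ++ p₂ ++ p₃)
    cov = (edge⇒Covered e₁₂ (here refl) ∷ Covered-sym (edge⇒Covered e₃₁ (there (there (here refl)))) ∷
           ends A₁ ∷ all³ (first A₁) (na x₁p₂) (na x₁p₃))
        ∷ (edge⇒Covered e₂₃ (there (here refl)) ∷ ends A₂ ∷ all³ (na x₂p₁) (first A₂) (na x₂p₃))
        ∷ (ends A₃ ∷ all³ (na x₃p₁) (na x₃p₂) (first A₃))
        ∷ all³ (last A₁) (last A₂) (last A₃)
        ∷ ++³ (interior A₁) (interior A₂) (interior A₃) a₁₂ a₁₃ a₂₃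

  -- All pairs between two rungs except `x`, `x′` and `y`, `y′`, which the two triangles may join.
  Rungs : (x : Fin n) (p : List (Fin n)) (y : Fin n) (x′ : Fin n) (p′ : List (Fin n)) (y′ : Fin n) → Set
  Rungs x p y x′ p′ y′ = Anti (x ∷ y ∷ p) p′ × All (NA x′) p × All (NA y′) p × NA x y′ × NA x′ y

  prism-SolidOn : ∀ {x₁ x₂ x₃ y₁ y₂ y₃ p₁ p₂ p₃} → x₁ ~ x₂ → x₂ ~ x₃ → x₃ ~ x₁ → y₁ ~ y₂ → y₂ ~ y₃ → y₃ ~ y₁ →
    Arc x₁ p₁ y₁ → Arc x₂ p₂ y₂ → Arc x₃ p₃ y₃ →
    Rungs x₁ p₁ y₁ x₂ p₂ y₂ → Rungs x₁ p₁ y₁ x₃ p₃ y₃ → Rungs x₂ p₂ y₂ x₃ p₃ y₃ →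
    SolidOn (x₁ ∷ x₂ ∷ x₃ ∷ y₁ ∷ y₂ ∷ y₃ ∷ p₁ ++ p₂ ++ p₃)
  prism-SolidOn {x₁} {x₂} {x₃} {y₁} {y₂} {y₃} {p₁} {p₂} {p₃} e₁₂ e₂₃ e₃₁ f₁₂ f₂₃ f₃₁ arc₁ arc₂ arc₃
                (x₁p₂ ∷ y₁p₂ ∷ a₁₂ , x₂p₁ , y₂p₁ , x₁y₂ , x₂y₁)
                (x₁p₃ ∷ y₁p₃ ∷ a₁₃ , x₃p₁ , y₃p₁ , x₁y₃ , x₃y₁)
                (x₂p₃ ∷ y₂p₃ ∷ a₂₃ , x₃p₂ , y₃p₂ , x₂y₃ , x₃y₂) S≈ =
    _ , es , inj₂ (inj₂ (inj₂ (prism x₁ x₂ x₃ y₁ y₂ y₃ p₁ p₂ p₃ (Covered⇒Unique cov)))) ,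
    induces S≈ (++⁺ (triangle-Adjacent e₁₂ e₂₃ e₃₁) (++⁺ (triangle-Adjacent f₁₂ f₂₃ f₃₁)
      (++⁺ (path-Adjacent p₁ arc₁) (++⁺ (path-Adjacent p₂ arc₂) (path-Adjacent p₃ arc₃))))) cov
    where
    t  = triangle x₁ x₂ x₃
    t′ = triangle y₁ y₂ y₃
    es = t ++ t′ ++ path x₁ p₁ y₁ ++ path x₂ p₂ y₂ ++ path x₃ p₃ y₃
    open ArcParts
    A₁ : ArcParts es x₁ p₁ y₁
    A₁ = arcParts (∈-++⁺ʳ t ∘ in-middle t′) arc₁
    A₂ : ArcParts es x₂ p₂ y₂
    A₂ = arcParts (∈-++⁺ʳ t ∘ ∈-++⁺ʳ t′ ∘ in-middle (path x₁ p₁ y₁)) arc₂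
    A₃ : ArcParts es x₃ p₃ y₃
    A₃ = arcParts (∈-++⁺ʳ t ∘ ∈-++⁺ʳ t′ ∘ ∈-++⁺ʳ (path x₁ p₁ y₁) ∘ ∈-++⁺ʳ (path x₂ p₂ y₂)) arc₃
    na : ∀ {u p} → All (NA u) p → All (Covered es u) p
    na = All.map NA⇒Covered
    cov : AllPairs (Covered es) (x₁ ∷ x₂ ∷ x₃ ∷ y₁ ∷ y₂ ∷ y₃ ∷ p₁ ++ p₂ ++ p₃)
    cov = (edge⇒Covered e₁₂ (here refl) ∷ Covered-sym (edge⇒Covered e₃₁ (there (there (here refl)))) ∷
           ends A₁ ∷ NA⇒Covered x₁y₂ ∷ NA⇒Covered x₁y₃ ∷ all³ (first A₁) (na x₁p₂) (na x₁p₃))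
        ∷ (edge⇒Covered e₂₃ (there (here refl)) ∷
           NA⇒Covered x₂y₁ ∷ ends A₂ ∷ NA⇒Covered x₂y₃ ∷ all³ (na x₂p₁) (first A₂) (na x₂p₃))
        ∷ (NA⇒Covered x₃y₁ ∷ NA⇒Covered x₃y₂ ∷ ends A₃ ∷ all³ (na x₃p₁) (na x₃p₂) (first A₃))
        ∷ (edge⇒Covered f₁₂ (∈-++⁺ʳ t (here refl)) ∷
           Covered-sym (edge⇒Covered f₃₁ (∈-++⁺ʳ t (there (there (here refl))))) ∷
           all³ (last A₁) (na y₁p₂) (na y₁p₃))
        ∷ (edge⇒Covered f₂₃ (∈-++⁺ʳ t (there (here refl))) ∷ all³ (na y₂p₁) (last A₂) (na y₂p₃))
        ∷ all³ (na y₃p₁) (na y₃p₂) (last A₃)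
        ∷ ++³ (interior A₁) (interior A₂) (interior A₃) a₁₂ a₁₃ a₂₃

  -- An induced cycle cut open at `v`: `a` and `b` are the neighbours of `v` on it. The list `p` is
  -- empty for a triangle.
  Rim : Fin n → Fin n → List (Fin n) → Fin n → Set
  Rim v a p b = Arc a p b × v ~ a × v ~ b × All (NA v) p

  module _ {v a : Fin n} {p : List (Fin n)} {b : Fin n} (rim : Rim v a p b) where
    private
      arc = proj₁ rim
      v~a = proj₁ (proj₂ rim)
      v~b = proj₁ (proj₂ (proj₂ rim))
      v≁p = proj₂ (proj₂ (proj₂ rim))
      cs : List (Fin n)
      cs = v ∷ a ∷ p ++ b ∷ []
      es : Edges (Fin n)
      es = path v (a ∷ p ++ b ∷ []) v

      es≡ : es ≡ (v , a) ∷ path a p b ++ (b , v) ∷ []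
      es≡ = cong ((v , a) ∷_) (path-++ a p)

    Rim-Adjacent : Adjacent es
    Rim-Adjacent = subst Adjacent (sym es≡) (v~a ∷ ++⁺ (path-Adjacent p arc) (~-sym v~b ∷ []))

    Rim-Covered : AllPairs (Covered es) cs
    Rim-Covered =
      (edge⇒Covered v~a (here refl) ∷ ++⁺ (All.map NA⇒Covered v≁p)
        (Covered-sym (edge⇒Covered (~-sym v~b)
          (subst ((b , v) ∈_) (sym es≡) (there (∈-++⁺ʳ (path a p b) (here refl))))) ∷ []))
      ∷ AllPairs.map (Covered-mono λ {e} e∈ → subst (e ∈_) (sym es≡) (there (∈-++⁺ˡ e∈))) (path-Covered p arc)

    Rim-Cycle : Cycle cs es
    Rim-Cycle = cycle v _ (Covered⇒Unique Rim-Covered)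
                  (s≤s (s≤s (subst (1 ≤ⁿ_) (sym (length-++ p)) (m≤n+m 1 (length p)))))

    Rim-InducedCycle : ∀ {S} → S ≈ cs → InducedCycle G S
    Rim-InducedCycle S≈ = cs , es , Rim-Cycle , induces S≈ Rim-Adjacent Rim-Covered

    -- The vertices `x`, `y`, `z` only witness that there are three spokes. The spokes themselves go
    -- to all neighbours of `w` on the cycle, as an induced subgraph requires.
    pyramid-SolidOn : ∀ {w x y z} → w ∉ cs → x ∈ cs → y ∈ cs → z ∈ cs → w ~ x → w ~ y → w ~ z →
                      x ≢ y → x ≢ z → y ≢ z → SolidOn (w ∷ cs)
    pyramid-SolidOn {w} {x} {y} {z} w∉ x∈ y∈ z∈ w~x w~y w~z x≢y x≢z y≢z S≈ =
      w ∷ cs , es ++ map (w ,_) ns ,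
      inj₁ (pyramid w ns Rim-Cycle (¬Any⇒All¬ cs w∉)
             (Uniqueₚ.filter⁺ (w ~?_) (Covered⇒Unique Rim-Covered))
             (tabulate (proj₁ ∘ ∈-filter⁻ (w ~?_))) 3≤ns) ,
      induces S≈ (++⁺ Rim-Adjacent (map⁺ (all-filter (w ~?_) cs)))
        (tabulate w-covered ∷ AllPairs.map (Covered-mono ∈-++⁺ˡ) Rim-Covered)
      where
      ns = filter (w ~?_) cs
      3≤ns : 3 ≤ⁿ length ns
      3≤ns = Counting.Unique-⊆⇒length≤ ((x≢y ∷ x≢z ∷ []) ∷ (y≢z ∷ []) ∷ [] ∷ [])
        λ { (here refl) → ∈-filter⁺ (w ~?_) x∈ w~x ; (there (here refl)) → ∈-filter⁺ (w ~?_) y∈ w~y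
          ; (there (there (here refl))) → ∈-filter⁺ (w ~?_) z∈ w~z }
      w-covered : ∀ {u} → u ∈ cs → Covered (es ++ map (w ,_) ns) w u
      w-covered u∈ = (λ { refl → w∉ u∈ }) ,
        λ w~u → inj₁ (∈-++⁺ʳ es (∈-map⁺ (w ,_) (∈-filter⁺ (w ~?_) u∈ w~u)))

-- Opening an induced cycle at a given vertex.

module Cycles {n : ℕ} (G : Graph n) where
  open Graph G
  open InducedPaths G
  open Subsets
  open Solids G

  path-∈ : ∀ {a : Fin n} p {b u w} → (u , w) ∈ path a p b → u ∈ a ∷ p × w ∈ p ++ b ∷ []
  path-∈ []      (here refl) = here refl , here refl
  path-∈ (x ∷ p) (here refl) = here refl , here refl
  path-∈ (x ∷ p) (there e∈)  = let u∈ , w∈ = path-∈ p e∈ in there u∈ , there w∈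

  Exact : List (Fin n) → Edges (Fin n) → Set
  Exact vs es = ∀ {u w} → u ∈ vs → w ∈ vs → (u ~ w → Joined es u w) × (Joined es u w → u ~ w)

  -- By uniqueness only the first edge of the path involves `a`; so `a` has no chord, and removing
  -- it leaves an exact path.
  Exact-Arc : ∀ {a} p {b} → Unique (a ∷ p ++ b ∷ []) → Exact (a ∷ p ++ b ∷ []) (path a p b) → Arc a p b
  Exact-Arc []      u ex = step (proj₂ (ex (here refl) (there (here refl))) (inj₁ (here refl))) [] [ _ ]
  Exact-Arc {a} (x ∷ p) {b} (a∉ ∷ x∉ ∷ u) ex =
    step (proj₂ (ex (here refl) (there (here refl))) (inj₁ (here refl)))
         (tabulate λ z∈ → (lookup a∉ (there z∈)) ,
            λ a~z → not-joined z∈ (proj₁ (ex (here refl) (there (there z∈))) a~z))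
         (Exact-Arc p (x∉ ∷ u) λ u∈ w∈ →
           (λ u~w → shrink u∈ w∈ (proj₁ (ex (there u∈) (there w∈)) u~w)) ,
           (λ j → proj₂ (ex (there u∈) (there w∈)) ([ inj₁ ∘ there , inj₂ ∘ there ]′ j)))
    where
    not-a : ∀ {z} → z ∈ x ∷ p ++ b ∷ [] → z ≢ a
    not-a z∈ refl = lookup a∉ z∈ refl
    not-joined : ∀ {z} → z ∈ p ++ b ∷ [] → ¬ Joined (path a (x ∷ p) b) a z
    not-joined z∈ (inj₁ (here refl)) = lookup x∉ z∈ refl
    not-joined z∈ (inj₁ (there e∈))  = not-a (∈-++⁺ˡ (proj₁ (path-∈ p e∈))) refl
    not-joined z∈ (inj₂ (here refl)) = not-a (there z∈) refl
    not-joined z∈ (inj₂ (there e∈))  = not-a (there (proj₂ (path-∈ p e∈))) refl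
    shrink : ∀ {u w} → u ∈ x ∷ p ++ b ∷ [] → w ∈ x ∷ p ++ b ∷ [] →
             Joined (path a (x ∷ p) b) u w → Joined (path x p b) u w
    shrink u∈ w∈ (inj₁ (here refl)) = contradiction refl (not-a u∈)
    shrink u∈ w∈ (inj₁ (there e∈))  = inj₁ e∈
    shrink u∈ w∈ (inj₂ (here refl)) = contradiction refl (not-a w∈)
    shrink u∈ w∈ (inj₂ (there e∈))  = inj₂ e∈

  Exact-Rim : ∀ v c → Unique (v ∷ c) → 3 ≤ⁿ length (v ∷ c) → Exact (v ∷ c) (path v c v) →
              ∃₂ λ a p → ∃ λ b → Rim v a p b × c ≡ a ∷ p ++ b ∷ []
  Exact-Rim v []      _ (s≤s ()) _
  Exact-Rim v (a ∷ c) u l ex with initLast c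
  Exact-Rim v (a ∷ _) u (s≤s (s≤s ())) ex | []
  Exact-Rim v (a ∷ _) u l ex | p ∷ʳ′ b = a , p , b , (arc , v~a , v~b , tabulate v≁) , refl
    where
    v∉ : ∀ {z} → z ∈ a ∷ p ++ b ∷ [] → z ≢ v
    v∉ z∈ refl = lookup (AllPairs.head u) z∈ refl
    decompose : ∀ {e} → e ∈ path v (a ∷ p ++ b ∷ []) v → e ≡ (v , a) ⊎ e ∈ path a p b ⊎ e ≡ (b , v)
    decompose (here refl) = inj₁ refl
    decompose (there e∈) with ∈-++⁻ (path a p b) (subst (_ ∈_) (path-++ a p) e∈)
    ... | inj₁ e∈         = inj₂ (inj₁ e∈)
    ... | inj₂ (here eq)  = inj₂ (inj₂ eq)
    compose : ∀ {e} → e ∈ path a p b ++ (b , v) ∷ [] → e ∈ path v (a ∷ p ++ b ∷ []) v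
    compose {e} e∈ = there (subst (e ∈_) (sym (path-++ a p)) e∈)
    b∈ : b ∈ a ∷ p ++ b ∷ []
    b∈ = there (∈-++⁺ʳ p (here refl))
    v~a = proj₂ (ex (here refl) (there (here refl))) (inj₁ (here refl))
    v~b = proj₂ (ex (here refl) (there b∈)) (inj₂ (compose (∈-++⁺ʳ (path a p b) (here refl))))
    v≁ : ∀ {z} → z ∈ p → NA v z
    v≁ {z} z∈ = ≢-sym (v∉ z∈′) , λ v~z → absurd (proj₁ (ex (here refl) (there z∈′)) v~z)
      where
      z∈′ : z ∈ a ∷ p ++ b ∷ []
      z∈′ = there (∈-++⁺ˡ z∈)
      z≢a : z ≢ a
      z≢a refl = lookup (AllPairs.head (AllPairs.tail u)) (∈-++⁺ˡ z∈) refl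
      z≢b : z ≢ b
      z≢b = Unique-snoc-≢ p (AllPairs.tail (AllPairs.tail u)) z∈
      absurd : ¬ Joined (path v (a ∷ p ++ b ∷ []) v) v z
      absurd (inj₁ e∈) with decompose e∈
      ... | inj₁ refl        = z≢a refl
      ... | inj₂ (inj₁ e∈)   = v∉ (∈-++⁺ˡ (proj₁ (path-∈ p e∈))) refl
      ... | inj₂ (inj₂ refl) = v∉ b∈ refl
      absurd (inj₂ e∈) with decompose e∈
      ... | inj₁ refl        = v∉ z∈′ refl
      ... | inj₂ (inj₁ e∈)   = v∉ (there (proj₂ (path-∈ p e∈))) refl
      ... | inj₂ (inj₂ refl) = z≢b refl
    arc : Arc a p b
    arc = Exact-Arc p (AllPairs.tail u) λ u∈ w∈ →
      (λ u~w → [ shrink u∈ w∈ , Joined-sym ∘ shrink w∈ u∈ ]′ (proj₁ (ex (there u∈) (there w∈)) u~w)) ,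
      λ j → proj₂ (ex (there u∈) (there w∈)) ([ inj₁ ∘ compose ∘ ∈-++⁺ˡ , inj₂ ∘ compose ∘ ∈-++⁺ˡ ]′ j)
      where
      shrink : ∀ {u w} → u ∈ a ∷ p ++ b ∷ [] → w ∈ a ∷ p ++ b ∷ [] →
               (u , w) ∈ path v (a ∷ p ++ b ∷ []) v → Joined (path a p b) u w
      shrink u∈ w∈ e∈ with decompose e∈
      ... | inj₁ refl        = contradiction refl (v∉ u∈)
      ... | inj₂ (inj₁ e∈)   = inj₁ e∈
      ... | inj₂ (inj₂ refl) = contradiction refl (v∉ w∈)

  Cycle-Exact : ∀ {S vs es} → Induces G S vs es → Exact vs es
  Cycle-Exact (S≈ , ind) u∈ w∈ =
    let e = ind _ _ (Equivalence.from (S≈ _) u∈) (Equivalence.from (S≈ _) w∈)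
    in Equivalence.to e , Equivalence.from e

  Exact-↭ : ∀ {vs ws es fs} → vs ↭ ws → es ↭ fs → Exact vs es → Exact ws fs
  Exact-↭ σ τ ex u∈ w∈ =
    let to , from = ex (↭ₚ.∈-resp-↭ (↭-sym σ) u∈) (↭ₚ.∈-resp-↭ (↭-sym σ) w∈)
    in (λ u~w → [ inj₁ ∘ ↭ₚ.∈-resp-↭ τ , inj₂ ∘ ↭ₚ.∈-resp-↭ τ ]′ (to u~w)) ,
       (λ j → from ([ inj₁ ∘ ↭ₚ.∈-resp-↭ (↭-sym τ) , inj₂ ∘ ↭ₚ.∈-resp-↭ (↭-sym τ) ]′ j))

  ≈-↭ : ∀ {S : Subset n} {vs ws} → vs ↭ ws → S ≈ vs → S ≈ ws
  ≈-↭ σ S≈ v = mk⇔ (↭ₚ.∈-resp-↭ σ ∘ Equivalence.to (S≈ v)) (Equivalence.from (S≈ v) ∘ ↭ₚ.∈-resp-↭ (↭-sym σ))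

  Unique-↭ : ∀ {vs ws : List (Fin n)} → vs ↭ ws → Unique vs → Unique ws
  Unique-↭ refl        u                           = u
  Unique-↭ (prep x σ)  (x∉ ∷ u)                    = ↭ₚ.All-resp-↭ σ x∉ ∷ Unique-↭ σ u
  Unique-↭ (swap x y σ) ((x≢y ∷ x∉) ∷ y∉ ∷ u)      =
    (≢-sym x≢y ∷ ↭ₚ.All-resp-↭ σ y∉) ∷ ↭ₚ.All-resp-↭ σ x∉ ∷ Unique-↭ σ u
  Unique-↭ (_↭_.trans σ τ) u                           = Unique-↭ τ (Unique-↭ σ u)

  -- The cycle may be listed from another vertex `x`. Rotating it to start at `v` permutes both the
  -- vertex list and the edge list, under which exactness is invariant.
  InducedCycle⇒Rim : ∀ {S v} → InducedCycle G S → v ∈ˢ S → ∃₂ λ a p → ∃ λ b → Rim v a p b × S ≈ v ∷ a ∷ p ++ b ∷ []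
  InducedCycle⇒Rim {S} {v} (_ , _ , cycle x c u l , ind@(S≈ , _)) v∈ with Equivalence.to (S≈ v) v∈
  ... | here refl with Exact-Rim v c u l (Cycle-Exact ind)
  ...   | a , p , b , rim , refl = a , p , b , rim , S≈
  InducedCycle⇒Rim {S} {v} (_ , _ , cycle x c u l , ind@(S≈ , _)) v∈ | there v∈c with ∈-∃++ v∈c
  ... | p , q , refl with Exact-Rim v (q ++ x ∷ p) (Unique-↭ σ u) (subst (3 ≤ⁿ_) (↭ₚ.↭-length σ) l)
                            (Exact-↭ σ τ (Cycle-Exact ind))
    where
    σ : x ∷ p ++ v ∷ q ↭ v ∷ q ++ x ∷ p
    σ = ↭ₚ.++-comm (x ∷ p) (v ∷ q)
    τ : path x (p ++ v ∷ q) x ↭ path v (q ++ x ∷ p) v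
    τ = subst₂ _↭_ (sym (path-++ x p)) (sym (path-++ v q)) (↭ₚ.++-comm (path x p v) (path v q x))
  ...   | a , p′ , b , rim , eq = a , p′ , b , rim ,
            ≈-↭ (subst (λ c → x ∷ p ++ v ∷ q ↭ v ∷ c) eq (↭ₚ.++-comm (x ∷ p) (v ∷ q))) S≈

-- Three paths that start at `v` and two of its neighbours and end together.

module Junctions {n : ℕ} (G : Graph n) where
  open Graph G
  open InducedPaths G
  open Solids G
  open import Algebra.Solver.CommutativeMonoid (↭ₚ.++-commutativeMonoid {A = Fin n}) using (solve; _⊜_; _⊕_)

  Arc-cons : ∀ {x y} p {z} → x ~ y → All (NA x) p → NA x z → Arc y p z → Arc x (y ∷ p) z
  Arc-cons p x~y x≁p x≁z arc = step x~y (++⁺ x≁p (x≁z ∷ [])) arc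

  -- If `y ~ z`, this is a stamp with triangle `v`, `y`, `z` and apex `q`. Otherwise it is a
  -- trihedron with ends `v` and `q`, and then `V` must be nonempty for its first path to have
  -- length at least 2.
  point-SolidOn : ∀ {q v y z V Y Z} → Arc v V q → Arc y Y q → Arc z Z q → v ~ y → v ~ z →
    Legs v V y Y → Legs v V z Z → Legs y Y z Z → y ~ z ⊎ NA y z × 1 ≤ⁿ length V →
    SolidOn (q ∷ v ∷ y ∷ z ∷ V ++ Y ++ Z)
  point-SolidOn {q} {v} {y} {z} {V} {Y} {Z} arcV arcY arcZ v~y v~z lvy lvz lyz (inj₁ y~z) =
    SolidOn-↭ (solve 5 (λ q v y z E → (v ⊕ y ⊕ z ⊕ q ⊕ E) ⊜ (q ⊕ v ⊕ y ⊕ z ⊕ E)) ↭-refl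
                 (q ∷ []) (v ∷ []) (y ∷ []) (z ∷ []) (V ++ Y ++ Z))
      (stamp-SolidOn v~y y~z (~-sym v~z) arcV arcY arcZ lvy lvz lyz)
  point-SolidOn {q} {v} {y} {z} {V} {Y} {Z} arcV arcY arcZ v~y v~z
                (v≁Y ∷ VY , y≁V) (v≁Z ∷ VZ , z≁V) (y≁Z ∷ YZ , z≁Y) (inj₂ (y≁z , 1≤V)) =
    SolidOn-↭ (solve 7 (λ q v y z V Y Z → (v ⊕ q ⊕ V ⊕ (y ⊕ Y) ⊕ (z ⊕ Z)) ⊜ (q ⊕ v ⊕ y ⊕ z ⊕ V ⊕ Y ⊕ Z)) ↭-refl
                 (q ∷ []) (v ∷ []) (y ∷ []) (z ∷ []) V Y Z)
      (trihedron-SolidOn arcV (Arc-cons Y v~y v≁Y v≁q arcY) (Arc-cons Z v~z v≁Z v≁q arcZ) 1≤V (s≤s z≤n) (s≤s z≤n)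
        (Anti-sym (y≁V ∷ Anti-sym VY)) (Anti-sym (z≁V ∷ Anti-sym VZ))
        ((y≁z ∷ y≁Z) ∷ Anti-sym (z≁Y ∷ Anti-sym YZ)))
    where
    v≁q : NA v q
    v≁q = nonadjacent V 1≤V arcV
      where
      nonadjacent : ∀ V → 1 ≤ⁿ length V → Arc v V q → NA v q
      nonadjacent (_ ∷ _) _ arc = Arc-nonadjacent arc (here refl)

  -- If `y ~ z`, this is a prism. Otherwise it is a stamp with triangle `q₁`, `q₂`, `q₃` and apex
  -- `v`, whose legs are the paths reversed.
  triangle-SolidOn : ∀ {q₁ q₂ q₃ v y z V Y Z} → Arc v V q₁ → Arc y Y q₂ → Arc z Z q₃ → v ~ y → v ~ z →
    q₁ ~ q₂ → q₂ ~ q₃ → q₃ ~ q₁ → Rungs v V q₁ y Y q₂ → Rungs v V q₁ z Z q₃ → Rungs y Y q₂ z Z q₃ →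
    y ~ z ⊎ NA y z → SolidOn (v ∷ y ∷ z ∷ q₁ ∷ q₂ ∷ q₃ ∷ V ++ Y ++ Z)
  triangle-SolidOn arcV arcY arcZ v~y v~z e₁₂ e₂₃ e₃₁ rvy rvz ryz (inj₁ y~z) =
    prism-SolidOn v~y y~z (~-sym v~z) e₁₂ e₂₃ e₃₁ arcV arcY arcZ rvy rvz ryz
  triangle-SolidOn {q₁} {q₂} {q₃} {v} {y} {z} {V} {Y} {Z} arcV arcY arcZ v~y v~z e₁₂ e₂₃ e₃₁
    (v≁Y ∷ q₁≁Y ∷ VY , y≁V , q₂≁V , v≁q₂ , y≁q₁)
    (v≁Z ∷ q₁≁Z ∷ VZ , z≁V , q₃≁V , v≁q₃ , z≁q₁)
    (y≁Z ∷ q₂≁Z ∷ YZ , z≁Y , q₃≁Y , y≁q₃ , z≁q₂) (inj₂ y≁z) =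
    SolidOn-↭ (↭-trans (prep q₁ (prep q₂ (prep q₃ (prep v (↭ₚ.++⁺ (↭ₚ.↭-reverse V)
                 (↭ₚ.++⁺ (↭ₚ.↭-reverse (y ∷ Y)) (↭ₚ.↭-reverse (z ∷ Z))))))))
                (solve 9 (λ q₁ q₂ q₃ v y z V Y Z → (q₁ ⊕ q₂ ⊕ q₃ ⊕ v ⊕ V ⊕ (y ⊕ Y) ⊕ (z ⊕ Z)) ⊜
                                                    (v ⊕ y ⊕ z ⊕ q₁ ⊕ q₂ ⊕ q₃ ⊕ V ⊕ Y ⊕ Z)) ↭-refl
                   (q₁ ∷ []) (q₂ ∷ []) (q₃ ∷ []) (v ∷ []) (y ∷ []) (z ∷ []) V Y Z))
      (stamp-SolidOn e₁₂ e₂₃ e₃₁ (Arc-reverse {p = V} arcV)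
        (Arc-reverse {p = y ∷ Y} (Arc-cons Y v~y v≁Y v≁q₂ arcY))
            (Arc-reverse {p = z ∷ Z} (Arc-cons Z v~z v≁Z v≁q₃ arcZ))
        (legs ((NA-sym y≁q₁ ∷ q₁≁Y) ∷ Anti-sym (y≁V ∷ Anti-sym VY)) q₂≁V)
        (legs ((NA-sym z≁q₁ ∷ q₁≁Z) ∷ Anti-sym (z≁V ∷ Anti-sym VZ)) q₃≁V)
        (legs ((NA-sym z≁q₂ ∷ q₂≁Z) ∷ (y≁z ∷ y≁Z) ∷ Anti-sym (z≁Y ∷ Anti-sym YZ)) (NA-sym y≁q₃ ∷ q₃≁Y)))
    where
    legs : ∀ {x p y q} → Anti (x ∷ p) q → All (NA y) p → Legs x (reverse p) y (reverse q)
    legs (x≁q ∷ pq) y≁p = All-reverse x≁q ∷ All-reverse (Anti-reverse pq) , All-reverse y≁p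

-- Three arcs with common ends, two of them possibly joined by edges near the ends.

module Thetas {n : ℕ} (G : Graph n) where
  open Graph G
  open InducedPaths G
  open Solids G
  open Junctions G
  open import Algebra.Solver.CommutativeMonoid (↭ₚ.++-commutativeMonoid {A = Fin n}) using (solve; _⊜_; _⊕_)

  -- An edge between the arcs S and R, if it is not between their first or
  -- between their last vertices, would give a third path across S ∪ R.
  NoCrossing : List (Fin n) → List (Fin n) → Set
  NoCrossing S R = ∀ S₁ {s S₂} R₁ {r R₂} → S ≡ S₁ ++ s ∷ S₂ → R ≡ R₁ ++ r ∷ R₂ → s ~ r →
                   (S₁ ≡ [] ⊎ R₂ ≡ []) × (S₂ ≡ [] ⊎ R₁ ≡ [])

  Disjoint : List (Fin n) → List (Fin n) → Set
  Disjoint S R = All (λ s → All (s ≢_) R) S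

  private
    ≢[] : ∀ (xs : List (Fin n)) {y ys} → xs ++ y ∷ ys ≢ []
    ≢[] [] ()
    ≢[] (_ ∷ _) ()

    tail-≢[] : ∀ (xs : List (Fin n)) {y x z ys} → y ∷ ys ++ z ∷ [] ≡ xs ++ x ∷ [] → xs ≢ []
    tail-≢[] [] {ys = ys} eq _ = ≢[] ys (∷-injectiveʳ eq)

  module _ {s : Fin n} {S : List (Fin n)} {s′ r : Fin n} {R : List (Fin n)} {r′ : Fin n} where
    private
      Sᵗ Rᵗ : List (Fin n)
      Sᵗ = s ∷ S ++ s′ ∷ []
      Rᵗ = r ∷ R ++ r′ ∷ []

    -- Both lists have at least two entries, so `S₁` and `S₂` are not both empty, nor are `R₁` and
    -- `R₂`. Of the four combinations only the first pair and the last pair survive.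
    NoCrossing⇒ends : NoCrossing Sᵗ Rᵗ → ∀ {x y} → x ∈ Sᵗ → y ∈ Rᵗ → x ~ y →
                      (x ≡ s × y ≡ r) ⊎ (x ≡ s′ × y ≡ r′)
    NoCrossing⇒ends nc x∈ y∈ x~y with ∈-∃++ x∈ | ∈-∃++ y∈
    ... | S₁ , S₂ , eqS | R₁ , R₂ , eqR with nc S₁ R₁ eqS eqR x~y
    ...   | inj₁ refl , inj₁ refl = contradiction refl (tail-≢[] [] eqS)
    ...   | inj₁ refl , inj₂ refl = inj₁ (sym (∷-injectiveˡ eqS) , sym (∷-injectiveˡ eqR))
    ...   | inj₂ refl , inj₁ refl =
      inj₂ (sym (∷ʳ-injectiveʳ (s ∷ S) S₁ eqS) , sym (∷ʳ-injectiveʳ (r ∷ R) R₁ eqR))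
    ...   | inj₂ refl , inj₂ refl = contradiction refl (tail-≢[] [] eqR)

  module _ {f l : Fin n} {O : List (Fin n)} {s : Fin n} {S : List (Fin n)} {s′ r : Fin n} {R : List (Fin n)}
      {r′ : Fin n} where
    private
      Sᵗ Rᵗ : List (Fin n)
      Sᵗ = s ∷ S ++ s′ ∷ []
      Rᵗ = r ∷ R ++ r′ ∷ []

    -- Only `s r` and `s′ r′` can be edges between the two arcs. If `s′` and `r′` are nonadjacent,
    -- the three arcs meet in the point `l`; otherwise they end in the triangle `l`, `s′`, `r′`. The
    -- junction lemmas decide the rest by whether `s ~ r`.
    theta-SolidOn : Arc f Sᵗ l → Arc f Rᵗ l → Arc f O l → 1 ≤ⁿ length O → Anti Sᵗ O → Anti Rᵗ O → Disjoint Sᵗ Rᵗ →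
                    NoCrossing Sᵗ Rᵗ → SolidOn (f ∷ l ∷ Sᵗ ++ Rᵗ ++ O)
    theta-SolidOn (step f~s f≁S πS) (step f~r f≁R πR) arcO 1≤O SO RO dis nc = choose (s′ ~? r′)
      where
      ∉tail : ∀ {u} S {s′} → IPath (u ∷ (S ++ s′ ∷ []) ++ l ∷ []) → ∀ {x} → x ∈ S ++ s′ ∷ [] → x ≢ u
      ∉tail S π x∈ refl = lookup (IPath-head≢ π) (∈-++⁺ˡ x∈) refl
      reassoc : ∀ {u} S {s′} → IPath (u ∷ (S ++ s′ ∷ []) ++ l ∷ []) → IPath ((u ∷ S) ++ s′ ∷ l ∷ [])
      reassoc {u} S {s′} = subst (λ L → IPath (u ∷ L)) (++-assoc S (s′ ∷ []) (l ∷ []))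
      arc : ∀ {u} S {s′} → IPath (u ∷ (S ++ s′ ∷ []) ++ l ∷ []) → Arc u S s′
      arc {u} S π = IPath-++⁻ˡ (u ∷ S) (reassoc S π)
      last-edge : ∀ {u} S {s′} → IPath (u ∷ (S ++ s′ ∷ []) ++ l ∷ []) → s′ ~ l
      last-edge {u} S π with IPath-++⁻ʳ (u ∷ S) (reassoc S π)
      ... | step e _ _ = e
      ∉last : ∀ {u} S {s′} → IPath (u ∷ (S ++ s′ ∷ []) ++ l ∷ []) → ∀ {x} → x ∈ S → x ≢ s′
      ∉last S π x∈ = Unique-snoc-≢ S (AllPairs.tail (IPath⇒Unique (arc S π))) x∈
      l≁ : ∀ {u} S {s′} → IPath (u ∷ (S ++ s′ ∷ []) ++ l ∷ []) → All (NA l) (u ∷ S)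
      l≁ {u} S π = All.map (λ { (na ∷ []) → NA-sym na }) (IPath-Anti (u ∷ S) (reassoc S π))
      s′∈ : ∀ {s} S {s′} → s′ ∈ s ∷ S ++ s′ ∷ []
      s′∈ S = there (∈-++⁺ʳ S (here refl))
      s≢s′ = ≢-sym (∉tail S πS (∈-++⁺ʳ S (here refl)))
      r≢r′ = ≢-sym (∉tail R πR (∈-++⁺ʳ R (here refl)))
      na : ∀ {x y} → x ∈ Sᵗ → y ∈ Rᵗ → x ≢ s ⊎ y ≢ r → x ≢ s′ ⊎ y ≢ r′ ⊎ ¬ s′ ~ r′ → NA x y
      na x∈ y∈ ¬first ¬last = lookup (lookup dis x∈) y∈ , λ x~y → case NoCrossing⇒ends nc x∈ y∈ x~y of λ where
        (inj₁ (x≡s , y≡r))     → [ (λ x≢s → x≢s x≡s) , (λ y≢r → y≢r y≡r) ]′ ¬first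
        (inj₂ (refl , refl))   → [ (λ x≢s′ → x≢s′ refl) , [ (λ y≢r′ → y≢r′ refl) , (λ s′≁r′ → s′≁r′ x~y) ]′ ]′ ¬last
      f≁ : ∀ S {s′} → All (NA f) ((S ++ s′ ∷ []) ++ l ∷ []) → All (NA f) (S ++ s′ ∷ [])
      f≁ S = ++⁻ˡ (S ++ _ ∷ [])
      s?r : s ~ r ⊎ NA s r
      s?r with s ~? r
      ... | yes s~r = inj₁ s~r
      ... | no s≁r  = inj₂ (lookup (lookup dis (here refl)) (here refl) , s≁r)

      choose : Dec (s′ ~ r′) → SolidOn (f ∷ l ∷ Sᵗ ++ Rᵗ ++ O)
      choose (no s′≁r′) = SolidOn-↭
        (solve 7 (λ f s r l O S R → (l ⊕ f ⊕ s ⊕ r ⊕ O ⊕ S ⊕ R) ⊜ (f ⊕ l ⊕ (s ⊕ S) ⊕ (r ⊕ R) ⊕ O)) ↭-refl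
          (f ∷ []) (s ∷ []) (r ∷ []) (l ∷ []) O (S ++ s′ ∷ []) (R ++ r′ ∷ []))
        (point-SolidOn arcO πS πR f~s f~r
          ((f≁ S f≁S ∷ Anti-sym (All.tail SO)) , All.head SO) ((f≁ R f≁R ∷ Anti-sym (All.tail RO)) , All.head RO)
          (tabulate (λ x∈ → tabulate λ y∈ → na x∈ (there y∈) (inj₂ (∉tail R πR y∈)) none) ,
           tabulate λ x∈ → NA-sym (na (there x∈) (here refl) (inj₁ (∉tail S πS x∈)) none))
          (Data.Sum.map₂ (_, 1≤O) s?r))
        where
        none : ∀ {P Q : Set} → P ⊎ Q ⊎ ¬ s′ ~ r′
        none = inj₂ (inj₂ s′≁r′)
      choose (yes s′~r′) = SolidOn-↭
        (solve 9 (λ f s r l s′ r′ O S R → (f ⊕ s ⊕ r ⊕ l ⊕ s′ ⊕ r′ ⊕ O ⊕ S ⊕ R) ⊜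
                                          (f ⊕ l ⊕ (s ⊕ S ⊕ s′) ⊕ (r ⊕ R ⊕ r′) ⊕ O)) ↭-refl
          (f ∷ []) (s ∷ []) (r ∷ []) (l ∷ []) (s′ ∷ []) (r′ ∷ []) O S R)
        (triangle-SolidOn arcO (arc S πS) (arc R πR) f~s f~r (~-sym (last-edge S πS)) s′~r′ (last-edge R πR)
          (outer S (f≁ S f≁S) (l≁ S πS) SO) (outer R (f≁ R f≁R) (l≁ R πR) RO)
          (tabulate (λ x∈ → tabulate λ y∈ → inner-R (weaken x∈) y∈) ,
           tabulate (λ x∈ → NA-sym (na (in-S x∈) (here refl) (inj₁ (s∉ x∈)) (inj₁ (∉last S πS x∈)))) ,
           tabulate (λ x∈ → NA-sym (na (in-S x∈) (s′∈ R) (inj₁ (s∉ x∈)) (inj₁ (∉last S πS x∈)))) ,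
           na (here refl) (s′∈ R) (inj₂ (≢-sym r≢r′)) (inj₁ s≢s′) ,
           NA-sym (na (s′∈ S) (here refl) (inj₁ (≢-sym s≢s′)) (inj₂ (inj₁ r≢r′))))
          s?r)
        where
        in-S : ∀ {x} → x ∈ S → x ∈ Sᵗ
        in-S x∈ = there (∈-++⁺ˡ x∈)
        s∉ : ∀ {x} → x ∈ S → x ≢ s
        s∉ x∈ = ∉tail S πS (∈-++⁺ˡ x∈)
        weaken : ∀ {x} → x ∈ s ∷ s′ ∷ S → x ∈ Sᵗ
        weaken (here eq)          = here eq
        weaken (there (here refl)) = s′∈ S
        weaken (there (there x∈)) = in-S x∈
        inner-R : ∀ {x y} → x ∈ Sᵗ → y ∈ R → NA x y
        inner-R x∈ y∈ = na x∈ (there (∈-++⁺ˡ y∈)) (inj₂ (∉tail R πR (∈-++⁺ˡ y∈))) (inj₂ (inj₁ (∉last R πR y∈)))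
        outer : ∀ {s} S {s′} → All (NA f) (S ++ s′ ∷ []) → All (NA l) (s ∷ S) → Anti (s ∷ S ++ s′ ∷ []) O →
            Rungs f O l s S s′
        outer S f≁S (l≁s ∷ l≁S) (s≁O ∷ SO) =
          (++⁻ˡ S f≁S ∷ l≁S ∷ Anti-sym (++⁻ˡ S SO)) , s≁O , All.head (++⁻ʳ S SO) ,
          All.head (++⁻ʳ S f≁S) , NA-sym l≁s

-- Induced paths with prescribed ends.

module Routes {n : ℕ} (G : Graph n) where
  open Graph G
  open InducedPaths G
  open Subsets

  IPath-link : ∀ xs {y z zs} → IPath (xs ++ y ∷ []) → y ~ z → IPath (z ∷ zs) → Anti xs (z ∷ zs) → All (NA y) zs →
               IPath (xs ++ y ∷ z ∷ zs)
  IPath-link xs p y~z q as nas = IPath-++⁺ xs p (step y~z nas q) as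

  crossing : ∀ {P : Pred (Fin n) 0ℓ} (P? : Decidable P) {a b L} → IPath L → First a L → Last b L → P a → ¬ P b →
             ∃₂ λ u w → u ∈ L × w ∈ L × P u × ¬ P w × u ~ w
  crossing P? [ x ] refl refl Pa ¬Pb = contradiction Pa ¬Pb
  crossing P? (step {y = y} a~y _ p) refl l Pa ¬Pb with P? y
  ... | no ¬Py  = _ , _ , here refl , there (here refl) , Pa , ¬Py , a~y
  ... | yes Py with crossing P? p refl l Py ¬Pb
  ...   | u , w , u∈ , w∈ , rest = u , w , there u∈ , there w∈ , rest

  -- On the induced path `x ∷ L` the start has only one neighbour, so a path confined to these
  -- vertices has to follow it step by step.
  IPath-⊆⇒≡ : ∀ {x L M b} → IPath (x ∷ L) → IPath (x ∷ M) → Last b (x ∷ L) → Last b (x ∷ M) →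
              All (_∈ x ∷ L) M → L ≡ M
  IPath-⊆⇒≡ {L = []}    {[]}    _ _ _ _ _ = refl
  IPath-⊆⇒≡ {L = []}    {m ∷ M} _ q refl lM _ = contradiction refl (lookup (IPath-head≢ q) (Last⇒∈ (m ∷ M) lM))
  IPath-⊆⇒≡ {L = l ∷ L} {[]}    p _ lL refl _ = contradiction refl (lookup (IPath-head≢ p) (Last⇒∈ (l ∷ L) lL))
  IPath-⊆⇒≡ {L = l ∷ L} {m ∷ M} p@(step x~l nas p′) q@(step x~m _ q′) lL lM (m∈ ∷ M⊆) with m∈
  ... | here refl          = contradiction refl (~⇒≢ x~m)
  ... | there (there m∈L)  = contradiction x~m (proj₂ (lookup nas m∈L))
  ... | there (here refl)  = cong (l ∷_) (IPath-⊆⇒≡ p′ q′ lL lM (tabulate λ z∈ →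
                               tail (lookup M⊆ z∈) (lookup (All.tail (IPath-head≢ q)) z∈)))
    where
    tail : ∀ {x z xs} → z ∈ x ∷ xs → x ≢ z → z ∈ xs
    tail (here refl) x≢z = contradiction refl x≢z
    tail (there z∈)  _   = z∈

  -- The neighbour in `xs` is the vertex just before `z`.
  predecessor : ∀ {q} xs {r z} → IPath (xs ++ r ∷ []) → First q (xs ++ r ∷ []) → z ∈ xs ++ r ∷ [] →
                z ≡ q ⊎ Any (z ~_) xs
  predecessor []           _                refl (here refl) = inj₁ refl
  predecessor (x ∷ [])     _                refl (here refl) = inj₁ refl
  predecessor (x ∷ [])     (step x~r _ _)   refl (there (here refl)) = inj₂ (here (~-sym x~r))
  predecessor (x ∷ y ∷ xs) _                refl (here refl) = inj₁ refl
  predecessor (x ∷ y ∷ xs) (step x~y _ p)   refl (there z∈) with predecessor (y ∷ xs) p refl z∈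
  ... | inj₁ refl = inj₂ (here (~-sym x~y))
  ... | inj₂ any  = inj₂ (there any)

  neighbours : Fin n → Subset n
  neighbours v = ⟪ v ~?_ ⟫

-- Cycles and solids through `v`, and the links between cycles.

module At {n : ℕ} (G : Graph n) (v : Fin n) (W : Subset n) where
  open Graph G
  open Subsets
  open Routes G

  -- For a solid through `v` the size of the trace is the degree of `v` in it, which keeps the two
  -- families of counted solids apart.
  trace : Subset n → Subset n
  trace S = S ∩ neighbours v

  CycleAt SolidAt : Subset n → Set
  CycleAt S = InducedCycle G S × v ∈ˢ S × S ⊆ W
  SolidAt S = InducedSolid G S × v ∈ˢ S × S ⊆ W

  -- Abstract, since unfolding the search for an induced solid is infeasible.
  abstract
    cycleAt? : Decidable CycleAt
    cycleAt? S = inducedCycle? G S ×-dec (v ∈ˢ? S) ×-dec (S ⊆? W)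

    solidAt? : Decidable SolidAt
    solidAt? S = inducedSolid? G S ×-dec (v ∈ˢ? S) ×-dec (S ⊆? W)

  trace-≈ : ∀ {S xs} → (∀ {x} → x ∈ xs → x ∈ˢ S × v ~ x) → (∀ {x} → x ∈ˢ S → v ~ x → x ∈ xs) → trace S ≈ xs
  trace-≈ {S} to from x = mk⇔
    (λ x∈ → let x∈S , x∈N = x∈p∩q⁻ S (neighbours v) x∈ in from x∈S (∈⟪⟫⁻ (v ~?_) x∈N))
    (λ x∈ → let x∈S , v~x = to x∈ in x∈p∩q⁺ (x∈S , ∈⟪⟫⁺ (v ~?_) v~x))

  ∈-trace⁻ : ∀ {S x} → x ∈ˢ trace S → x ∈ˢ S × v ~ x
  ∈-trace⁻ {S} x∈ = let x∈S , x∈N = x∈p∩q⁻ S (neighbours v) x∈ in x∈S , ∈⟪⟫⁻ (v ~?_) x∈N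

  ∈-trace⁺ : ∀ {S x} → x ∈ˢ S → v ~ x → x ∈ˢ trace S
  ∈-trace⁺ x∈S v~x = x∈p∩q⁺ (x∈S , ∈⟪⟫⁺ (v ~?_) v~x)

  cycles : List (Subset n)
  cycles = filter cycleAt? (subsets n)

  TracedSolid : ℕ → Subset n → Set
  TracedSolid k U = SolidAt U × ∣ trace U ∣ ≡ k

  tracedSolid? : ∀ k → Decidable (TracedSolid k)
  tracedSolid? k U = solidAt? U ×-dec (∣ trace U ∣ ≟ⁿ k)

  solids₂ : List (Subset n)
  solids₂ = filter (tracedSolid? 2) (subsets n)

  -- The last clause determines the pair up to order, so that one solid links at most one pair of
  -- cycles.
  Link : Subset n → Subset n → Subset n → Set
  Link U P Q = CycleAt P × CycleAt Q × P ⊆ U × Q ⊆ U × All (λ Z → Z ⊆ U → Z ≡ P ⊎ Z ≡ Q) cycles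

  _≟ˢ_ : DecidableEquality (Subset n)
  _≟ˢ_ = Vecₚ.≡-dec Data.Bool._≟_

  link? : ∀ U P Q → Dec (Link U P Q)
  link? U P Q = cycleAt? P ×-dec cycleAt? Q ×-dec (P ⊆? U) ×-dec (Q ⊆? U) ×-dec
                All.all? (λ Z → (Z ⊆? U) →-dec ((Z ≟ˢ P) ⊎-dec (Z ≟ˢ Q))) cycles

  link-unique : ∀ {U P Q P′ Q′} → Link U P Q → Link U P′ Q′ → (P′ ≡ P ⊎ P′ ≡ Q) × (Q′ ≡ P ⊎ Q′ ≡ Q)
  link-unique (_ , _ , _ , _ , only) (cP′ , cQ′ , P′⊆ , Q′⊆ , _) =
    lookup only (∈-filter⁺ cycleAt? (∈-subsets _) cP′) P′⊆ ,
    lookup only (∈-filter⁺ cycleAt? (∈-subsets _) cQ′) Q′⊆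

  open Counting.Links _≟ˢ_ Link link? link-unique cycles public
    using (Respects) renaming (length≤classes+links to cycles≤classes+links)

-- Paths between two fixed neighbours of `v`, and forks formed by two of them.

module Between {n : ℕ} (G : Graph n) {v : Fin n} {W : Subset n} (v∈W : v ∈ˢ W) {a b : Fin n}
  (v~a : Graph._~_ G v a) (v~b : Graph._~_ G v b) (a≢b : a ≢ b) where
  open Graph G
  open InducedPaths G
  open Subsets
  open Solids G
  open Cycles G
  open Thetas G
  open Routes G
  open At G v W

  Ok : Fin n → Set
  Ok x = x ∈ˢ W × (x ≡ a ⊎ x ≡ b ⊎ NA v x)

  Ok⇒≢v : ∀ {x} → Ok x → v ≢ x
  Ok⇒≢v (_ , inj₁ refl)               = ~⇒≢ v~a
  Ok⇒≢v (_ , inj₂ (inj₁ refl))        = ~⇒≢ v~b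
  Ok⇒≢v (_ , inj₂ (inj₂ (v≢x , _)))   = v≢x

  -- Routes are the induced cycles in `W` through `a`, `v`, `b`, with `v` removed and oriented from
  -- `a` to `b`.
  record Route (L : List (Fin n)) : Set where
    constructor route
    field
      ipath : IPath L
      start : First a L
      end   : Last b L
      ok    : All Ok L
  open Route

  Route⇒Rim : ∀ {L} → Route L → ∃ λ p → Rim v a p b × L ≡ a ∷ p ++ b ∷ []
  Route⇒Rim {x ∷ L} (route π refl e oks) with Last⇒snoc (x ∷ L) e
  ... | []    , refl = contradiction refl a≢b
  ... | _ ∷ p , refl = p , (π , v~a , v~b , tabulate v≁p) , refl
    where
    v≁p : ∀ {z} → z ∈ p → NA v z
    v≁p z∈ with proj₂ (lookup oks (there (∈-++⁺ˡ z∈)))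
    ... | inj₁ refl        = contradiction (∈-++⁺ˡ z∈) (IPath-head∉ π)
    ... | inj₂ (inj₁ refl) = contradiction refl
            (Unique-snoc-≢ p (AllPairs.tail (IPath⇒Unique π)) z∈)
    ... | inj₂ (inj₂ na)   = na

  Route⇒CycleAt : ∀ {L} → Route L → CycleAt ⟦ v ∷ L ⟧
  Route⇒CycleAt {L} r with Route⇒Rim r
  ... | p , rim , refl = Rim-InducedCycle rim (⟦⟧-≈ _) , ∈⟦⟧⁺ {xs = v ∷ L} (here refl) , ⊆W
    where
    ⊆W : ⟦ v ∷ L ⟧ ⊆ W
    ⊆W x∈ with ∈⟦⟧⁻ {xs = v ∷ L} x∈
    ... | here refl = v∈W
    ... | there x∈  = proj₁ (lookup (ok r) x∈)

  Route-reverse : ∀ {L} → IPath L → First b L → Last a L → All Ok L → Route (reverse L)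
  Route-reverse {L} π s e oks = route (IPath-reverse π) (First-reverse L e) (Last-reverse L s) (All-reverse oks)

  CycleAt⇒Route : ∀ {Z} → CycleAt Z → (∀ {x} → x ∈ˢ Z → v ~ x → x ≡ a ⊎ x ≡ b) → ∃ λ L → Route L × Z ≡ ⟦ v ∷ L ⟧
  CycleAt⇒Route {Z} (cyc , v∈ , Z⊆W) only with InducedCycle⇒Rim cyc v∈
  ... | a′ , p , b′ , rim@(arc , v~a′ , v~b′ , v≁p) , Z≈ =
    orient (only (∈Z (here refl)) v~a′) (only (∈Z (there (∈-++⁺ʳ p (here refl)))) v~b′)
    where
    L = a′ ∷ p ++ b′ ∷ []
    ∈Z : ∀ {x} → x ∈ L → x ∈ˢ Z
    ∈Z x∈ = Equivalence.from (Z≈ _) (there x∈)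
    a′≢b′ : a′ ≢ b′
    a′≢b′ = lookup (IPath-head≢ arc) (∈-++⁺ʳ p (here refl))
    oks : a′ ≡ a ⊎ a′ ≡ b → b′ ≡ a ⊎ b′ ≡ b → All Ok L
    oks a′≡ b′≡ = tabulate λ {x} x∈ → Z⊆W (∈Z x∈) , end-or-far a′≡ b′≡ x∈
      where
      ends : ∀ {x} → x ≡ a ⊎ x ≡ b → x ≡ a ⊎ x ≡ b ⊎ NA v x
      ends (inj₁ eq) = inj₁ eq
      ends (inj₂ eq) = inj₂ (inj₁ eq)
      end-or-far : ∀ {x} → a′ ≡ a ⊎ a′ ≡ b → b′ ≡ a ⊎ b′ ≡ b → x ∈ L → x ≡ a ⊎ x ≡ b ⊎ NA v x
      end-or-far a′≡ b′≡ (here refl) = ends a′≡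
      end-or-far a′≡ b′≡ (there x∈) with ∈-++⁻ p x∈
      ... | inj₁ x∈p         = inj₂ (inj₂ (lookup v≁p x∈p))
      ... | inj₂ (here refl) = ends b′≡
    orient : a′ ≡ a ⊎ a′ ≡ b → b′ ≡ a ⊎ b′ ≡ b → ∃ λ L → Route L × Z ≡ ⟦ v ∷ L ⟧
    orient (inj₁ refl) (inj₁ refl) = contradiction refl a′≢b′
    orient (inj₂ refl) (inj₂ refl) = contradiction refl a′≢b′
    orient a′≡@(inj₁ refl) b′≡@(inj₂ refl) =
      L , route arc refl (Last-++⁺ (a′ ∷ p) refl) (oks a′≡ b′≡) , ≈⇒≡ Z≈
    -- Here the cycle was opened in the direction from `b` to `a`.
    orient a′≡@(inj₂ refl) b′≡@(inj₁ refl) =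
      reverse L , Route-reverse arc refl (Last-++⁺ (a′ ∷ p) refl) (oks a′≡ b′≡) ,
      ≈⇒≡ λ x → mk⇔ (to ∘ Equivalence.to (Z≈ x)) (Equivalence.from (Z≈ x) ∘ from)
      where
      to : ∀ {x} → x ∈ v ∷ L → x ∈ v ∷ reverse L
      to (here eq)  = here eq
      to (there x∈) = there (Anyₚ.reverse⁺ x∈)
      from : ∀ {x} → x ∈ v ∷ reverse L → x ∈ v ∷ L
      from (here eq)  = here eq
      from (there x∈) = there (Anyₚ.reverse⁻ x∈)

  distinct-sets : ∀ {L M z} → z ∈ M → z ∉ L → Route M → ⟦ v ∷ L ⟧ ≢ ⟦ v ∷ M ⟧
  distinct-sets {L} {M} z∈ z∉ r eq with ∈⟦⟧⁻ {xs = v ∷ L} (subst (_ ∈ˢ_) (sym eq) (∈⟦⟧⁺ {xs = v ∷ M} (there z∈)))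
  ... | here refl = Ok⇒≢v (lookup (ok r) z∈) refl
  ... | there z∈L = z∉ z∈L

  -- The route has to leave `P` somewhere, and the hypothesis on edges leaving `P` forces it to do
  -- so into `y`. The alternative `a ≡ y` serves the case that nothing precedes `y`.
  separator∈ : ∀ {y L} {P : Pred (Fin n) 0ℓ} (P? : Decidable P) → Route L → P a ⊎ a ≡ y → ¬ P b →
               (∀ {u w} → u ∈ L → w ∈ L → P u → ¬ P w → u ~ w → w ≡ y) → y ∈ L
  separator∈ P? r (inj₂ refl) _ _ = First⇒∈ _ (start r)
  separator∈ P? r (inj₁ Pa) ¬Pb cross with crossing P? (ipath r) (start r) (end r) Pa ¬Pb
  ... | u , w , u∈ , w∈ , Pu , ¬Pw , u~w = subst (_∈ _) (cross u∈ w∈ Pu ¬Pw u~w) w∈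

  -- The routes part at `c` and meet again at `d`. Edges between `S` and `R` are allowed; they
  -- decide which solid arises.
  record Fork (A : List (Fin n)) (c : Fin n) (S R : List (Fin n)) (d : Fin n) (B : List (Fin n)) : Set where
    field
      routeS   : Route (A ++ c ∷ S ++ d ∷ B)
      routeR   : Route (A ++ c ∷ R ++ d ∷ B)
      disjoint : Disjoint S R

    R∌P : ∀ {z} → z ∈ R → z ∉ A ++ c ∷ S ++ d ∷ B
    R∌P {z} z∈R z∈P with ∈-++⁻ A z∈P
    ... | inj₁ z∈A = IPath-++⇒∉ A (ipath routeR) z∈A (there (∈-++⁺ˡ z∈R))
    ... | inj₂ (here refl) = IPath-head∉ (IPath-++⁻ʳ A (ipath routeR)) (∈-++⁺ˡ z∈R)
    ... | inj₂ (there z∈) with ∈-++⁻ S z∈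
    ...   | inj₁ z∈S = lookup (lookup disjoint z∈S) z∈R refl
    ...   | inj₂ z∈B = IPath-++⇒∉ (A ++ c ∷ R)
                         (subst IPath (sym (++-assoc A (c ∷ R) (d ∷ B))) (ipath routeR)) (∈-++⁺ʳ A (there z∈R)) z∈B

  Fork-sym : ∀ {A c S R d B} → Fork A c S R d B → Fork A c R S d B
  Fork-sym {S = S} {R} fork = record
    { routeS = Fork.routeR fork ; routeR = Fork.routeS fork
    ; disjoint = tabulate λ r∈ → tabulate λ s∈ eq →
        lookup (lookup (Fork.disjoint fork) s∈) r∈ (sym eq) }

  module _ {A : List (Fin n)} {c : Fin n} {S R : List (Fin n)} {d : Fin n} {B : List (Fin n)}
      (fork : Fork A c S R d B) where
    open Fork fork
    private
      P Q U : List (Fin n)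
      P = A ++ c ∷ S ++ d ∷ B
      Q = A ++ c ∷ R ++ d ∷ B
      U = P ++ R

    Q⊆U : ∀ {z} → z ∈ Q → z ∈ U
    Q⊆U z∈ with ∈-++⁻ A z∈
    ... | inj₁ z∈A = ∈-++⁺ˡ (∈-++⁺ˡ z∈A)
    ... | inj₂ (here refl) = ∈-++⁺ˡ (∈-++⁺ʳ A (here refl))
    ... | inj₂ (there z∈) with ∈-++⁻ R z∈
    ...   | inj₁ z∈R = ∈-++⁺ʳ P z∈R
    ...   | inj₂ z∈B = ∈-++⁺ˡ (∈-++⁺ʳ A (there (∈-++⁺ʳ S z∈B)))

    -- One follows the second route up to `r`, crosses to `s` and continues on the first route.
    -- Gluing only drops vertices, so `S₁` and `R₂` remain avoided.
    cross-route : ∀ S₁ {s S₂} R₁ {r R₂} → S ≡ S₁ ++ s ∷ S₂ → R ≡ R₁ ++ r ∷ R₂ → s ~ r →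
      ∃ λ L → Route L × All (_∈ U) L × (∀ {z} → z ∈ S₁ → z ∉ L) × (∀ {z} → z ∈ R₂ → z ∉ L)
    cross-route S₁ {s} {S₂} R₁ {r} {R₂} refl refl s~r
      with glue (A ++ c ∷ R₁) {r} {s ∷ S₂ ++ d ∷ B} {a} {b}
             (IPath-++⁻ˡ (A ++ c ∷ R₁) (subst IPath eqQ (ipath routeR)))
             (First-++ (A ++ c ∷ R₁) (subst (First a) eqQ (start routeR)))
             (IPath-++⁻ʳ (A ++ c ∷ S₁) (subst IPath eqP (ipath routeS)))
             (Last-++⁻ (A ++ c ∷ S₁) (subst (Last b) eqP (end routeS))) (here (~-sym s~r))
      where
      eqP : A ++ c ∷ (S₁ ++ s ∷ S₂) ++ d ∷ B ≡ (A ++ c ∷ S₁) ++ s ∷ S₂ ++ d ∷ B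
      eqP = trans (cong (λ L → A ++ c ∷ L) (++-assoc S₁ (s ∷ S₂) (d ∷ B))) (sym (++-assoc A (c ∷ S₁) _))
      eqQ : A ++ c ∷ (R₁ ++ r ∷ R₂) ++ d ∷ B ≡ (A ++ c ∷ R₁) ++ r ∷ R₂ ++ d ∷ B
      eqQ = trans (cong (λ L → A ++ c ∷ L) (++-assoc R₁ (r ∷ R₂) (d ∷ B))) (sym (++-assoc A (c ∷ R₁) _))
    ... | zs , π , l , zs⊆ = a ∷ zs , route π refl l (All.map (lookup okU) zs⊆U) , zs⊆U , avoid₁ , avoid₂
      where
      okU : All Ok U
      okU = ++⁺ (ok routeS) (++⁻ˡ R (All.tail (++⁻ʳ A (ok routeR))))
      in-U : ∀ {z} → z ∈ (A ++ c ∷ R₁) ++ r ∷ [] ⊎ z ∈ s ∷ S₂ ++ d ∷ B → z ∈ U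
      in-U (inj₂ z∈) = ∈-++⁺ˡ (∈-++⁺ʳ A (there (subst (_ ∈_) (sym (++-assoc S₁ (s ∷ S₂) (d ∷ B))) (∈-++⁺ʳ S₁ z∈))))
      in-U (inj₁ z∈) with ∈-++⁻ (A ++ c ∷ R₁) z∈
      ... | inj₂ (here refl) = ∈-++⁺ʳ P (∈-++⁺ʳ R₁ (here refl))
      ... | inj₁ z∈ with ∈-++⁻ A z∈
      ...   | inj₁ z∈A = ∈-++⁺ˡ (∈-++⁺ˡ z∈A)
      ...   | inj₂ (here refl) = ∈-++⁺ˡ (∈-++⁺ʳ A (here refl))
      ...   | inj₂ (there z∈R) = ∈-++⁺ʳ P (∈-++⁺ˡ z∈R)
      zs⊆U : All (_∈ U) (a ∷ zs)
      zs⊆U = All.map in-U zs⊆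
      avoid₁ : ∀ {z} → z ∈ S₁ → z ∉ a ∷ zs
      avoid₁ {z} z∈S₁ z∈ with lookup zs⊆ z∈
      ... | inj₂ z∈S₂ = Unique-++⇒∉ S₁ (subst Unique (++-assoc S₁ (s ∷ S₂) (d ∷ B))
              (AllPairs.tail (IPath⇒Unique (IPath-++⁻ʳ A (ipath routeS))))) z∈S₁ z∈S₂
      ... | inj₁ z∈Q = Fork.R∌P (Fork-sym fork) (∈-++⁺ˡ z∈S₁) (in-Q (∈-++⁻ (A ++ c ∷ R₁) z∈Q))
        where
        in-Q : z ∈ A ++ c ∷ R₁ ⊎ z ∈ r ∷ [] → z ∈ Q
        in-Q (inj₂ (here refl)) = ∈-++⁺ʳ A (there (∈-++⁺ˡ (∈-++⁺ʳ R₁ (here refl))))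
        in-Q (inj₁ z∈) with ∈-++⁻ A z∈
        ... | inj₁ z∈A         = ∈-++⁺ˡ z∈A
        ... | inj₂ (here refl) = ∈-++⁺ʳ A (here refl)
        ... | inj₂ (there z∈R) = ∈-++⁺ʳ A (there (∈-++⁺ˡ (∈-++⁺ˡ z∈R)))
      avoid₂ : ∀ {z} → z ∈ R₂ → z ∉ a ∷ zs
      avoid₂ {z} z∈R₂ z∈ with lookup zs⊆ z∈
      ... | inj₂ z∈P = R∌P (∈-++⁺ʳ R₁ (there z∈R₂))
              (∈-++⁺ʳ A (there (subst (z ∈_) (sym (++-assoc S₁ (s ∷ S₂) (d ∷ B))) (∈-++⁺ʳ S₁ z∈P))))
      ... | inj₁ z∈Q = IPath-++⇒∉ ((A ++ c ∷ R₁) ++ r ∷ []) (subst IPath eqQ (ipath routeR)) z∈Q (∈-++⁺ˡ z∈R₂)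
        where
        eqQ : A ++ c ∷ (R₁ ++ r ∷ R₂) ++ d ∷ B ≡ ((A ++ c ∷ R₁) ++ r ∷ []) ++ R₂ ++ d ∷ B
        eqQ = trans (cong (λ L → A ++ c ∷ L) (++-assoc R₁ (r ∷ R₂) (d ∷ B)))
                (trans (sym (++-assoc A (c ∷ R₁) _)) (sym (++-assoc (A ++ c ∷ R₁) (r ∷ []) _)))

    -- Every route inside the fork passes through A, c, d and B, because
    -- each of their vertices separates a from b there.
    routes-⊇ : ∀ {L} → Route L → All (_∈ U) L → All (_∈ L) R → L ≡ Q
    routes-⊇ {L} r L⊆ R⊆ = same L Q r routeR (tabulate Q∈L)
      where
      same : ∀ L M → Route L → Route M → All (_∈ L) M → L ≡ M
      same (_ ∷ L) (_ ∷ M) (route π refl e _) (route ρ refl f _) (_ ∷ M⊆) = cong (a ∷_) (IPath-⊆⇒≡ π ρ e f M⊆)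

      before : ∀ {y} → y ∈ A ++ c ∷ [] → y ∈ L
      before {y} y∈ with ∈-∃++ y∈
      -- `A₁` is the part before `y`. Since both routes are induced, every edge of the fork that
      -- leaves `A₁` ends in `y`.
      ... | A₁ , A₂ , eq = separator∈ (_∈ˡ? A₁) r (a-side A₁ (subst (First a) (eqs S) (start routeS)))
        (λ b∈ → IPath-++⇒∉ A₁ (subst IPath (eqs S) (ipath routeS)) b∈
                  (Last⇒∈ _ (Last-++⁻ A₁ (subst (Last b) (eqs S) (end routeS))))) cross
        where
        eqs : ∀ S → A ++ c ∷ S ++ d ∷ B ≡ A₁ ++ y ∷ A₂ ++ S ++ d ∷ B
        eqs S = trans (sym (++-assoc A (c ∷ []) _)) (trans (cong (_++ S ++ d ∷ B) eq) (++-assoc A₁ (y ∷ A₂) _))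
        a-side : ∀ A₁ {ys} → First a (A₁ ++ y ∷ ys) → a ∈ A₁ ⊎ a ≡ y
        a-side []      a≡y  = inj₂ a≡y
        a-side (_ ∷ _) refl = inj₁ (here refl)
        far : ∀ {S u w} → Route (A ++ c ∷ S ++ d ∷ B) → u ∈ A₁ → w ∈ A₂ ++ S ++ d ∷ B → ¬ u ~ w
        far {S} ρ u∈ w∈ = proj₂ (lookup (lookup (IPath-Anti A₁ (subst IPath (eqs S) (ipath ρ))) u∈) w∈)
        cross : ∀ {u w} → u ∈ L → w ∈ L → u ∈ A₁ → w ∉ A₁ → u ~ w → w ≡ y
        cross {w = w} _ w∈L u∈ w∉ u~w with ∈-++⁻ P (lookup L⊆ w∈L)
        ... | inj₂ w∈R = contradiction u~w (far routeR u∈ (∈-++⁺ʳ A₂ (∈-++⁺ˡ w∈R)))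
        ... | inj₁ w∈P with ∈-++⁻ A₁ (subst (w ∈_) (eqs S) w∈P)
        ...   | inj₁ w∈A₁       = contradiction w∈A₁ w∉
        ...   | inj₂ (here w≡y) = w≡y
        ...   | inj₂ (there w∈) = contradiction u~w (far routeS u∈ w∈)

      after : ∀ {y} → y ∈ d ∷ B → y ∈ L
      after {y} y∈ with ∈-∃++ y∈
      -- The symmetric argument at the other end: the predicate is the complement of `y ∷ B₂`, which
      -- can be entered only at `y`.
      ... | B₁ , B₂ , eq = separator∈ (λ z → ¬? (z ∈ˡ? (y ∷ B₂))) r (inj₁ a∉) (λ b∉ → b∉ b∈) cross
        where
        eqs : ∀ S → A ++ c ∷ S ++ d ∷ B ≡ (A ++ c ∷ S ++ B₁) ++ y ∷ B₂
        eqs S = trans (cong (λ M → A ++ c ∷ S ++ M) eq) (trans (cong (λ M → A ++ c ∷ M) (sym (++-assoc S B₁ _)))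
                  (sym (++-assoc A (c ∷ S ++ B₁) _)))
        b∈ : b ∈ y ∷ B₂
        b∈ = Last⇒∈ (y ∷ B₂) (Last-++⁻ (A ++ c ∷ S ++ B₁) (subst (Last b) (eqs S) (end routeS)))
        a∉ : a ∉ y ∷ B₂
        a∉ a∈ = IPath-++⇒∉ (A ++ c ∷ []) (subst IPath (sym (++-assoc A (c ∷ []) _)) (ipath routeS))
                  (First⇒∈ _ (First-++ A {ys = S ++ d ∷ B} (start routeS)))
                      (∈-++⁺ʳ S (subst (a ∈_) (sym eq) (∈-++⁺ʳ B₁ a∈)))
        far : ∀ {S u w} → Route (A ++ c ∷ S ++ d ∷ B) → u ∈ A ++ c ∷ S ++ B₁ → w ∈ B₂ → ¬ u ~ w
        far {S} ρ u∈ w∈ = proj₂ (lookup (lookup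
            (IPath-Anti (A ++ c ∷ S ++ B₁) (subst IPath (eqs S) (ipath ρ))) u∈) w∈)
        cross : ∀ {u w} → u ∈ L → w ∈ L → u ∉ y ∷ B₂ → ¬ w ∉ y ∷ B₂ → u ~ w → w ≡ y
        cross {u} {w} u∈L _ u∉ ¬w∉ u~w with w ∈ˡ? (y ∷ B₂)
        ... | no w∉            = contradiction w∉ ¬w∉
        ... | yes (here w≡y)   = w≡y
        ... | yes (there w∈B₂) with ∈-++⁻ P (lookup L⊆ u∈L)
        ...   | inj₂ u∈R = contradiction u~w (far routeR (∈-++⁺ʳ A (there (∈-++⁺ˡ u∈R))) w∈B₂)
        ...   | inj₁ u∈P with ∈-++⁻ (A ++ c ∷ S ++ B₁) (subst (u ∈_) (eqs S) u∈P)
        ...     | inj₁ u∈ = contradiction u~w (far routeS u∈ w∈B₂)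
        ...     | inj₂ u∈ = contradiction u∈ u∉

      Q∈L : ∀ {z} → z ∈ Q → z ∈ L
      Q∈L z∈ with ∈-++⁻ A z∈
      ... | inj₁ z∈A         = before (∈-++⁺ˡ z∈A)
      ... | inj₂ (here refl) = before (∈-++⁺ʳ A (here refl))
      ... | inj₂ (there z∈) with ∈-++⁻ R z∈
      ...   | inj₁ z∈R = lookup R⊆ z∈R
      ...   | inj₂ z∈B = after z∈B

-- Cycles with the same two neighbours of `v` receive the same label.

module Exchange {n : ℕ} (G : Graph n) {v : Fin n} {W : Subset n} (v∈W : v ∈ˢ W) {a b : Fin n}
  (v~a : Graph._~_ G v a) (v~b : Graph._~_ G v b) (a≢b : a ≢ b) where
  open Graph G
  open InducedPaths G
  open Subsets
  open Solids G
  open Thetas G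
  open Routes G
  open import Algebra.Solver.CommutativeMonoid (↭ₚ.++-commutativeMonoid {A = Fin n}) using (solve; _⊜_; _⊕_)
  open At G v W
  open Between G v∈W v~a v~b a≢b
  open Route

  data Shape : List (Fin n) → Set where
    single : ∀ x → Shape (x ∷ [])
    long   : ∀ x xs y → Shape (x ∷ xs ++ y ∷ [])

  shape : ∀ x xs → Shape (x ∷ xs)
  shape x xs with initLast xs
  ... | []       = single x
  ... | ys ∷ʳ′ y = long x ys y

  private
    cons-first : ∀ {M} → IPath M → First a M → All (λ x → x ≡ a ⊎ NA v x) M → IPath (v ∷ M)
    cons-first {_ ∷ M} π refl (_ ∷ nas) = step v~a (tabulate na) π
      where
      na : ∀ {x} → x ∈ M → NA v x
      na x∈ with lookup nas x∈
      ... | inj₁ refl = contradiction x∈ (IPath-head∉ π)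
      ... | inj₂ na   = na

  module _ {A : List (Fin n)} {c s : Fin n} {S : List (Fin n)} {d : Fin n} {B : List (Fin n)}
      (r : Route (A ++ c ∷ (s ∷ S) ++ d ∷ B)) where
    private
      π  = ipath r
      π′ : IPath ((A ++ c ∷ []) ++ (s ∷ S) ++ d ∷ B)
      π′ = subst IPath (sym (++-assoc A (c ∷ []) _)) π
      π″ : IPath ((A ++ c ∷ s ∷ S) ++ d ∷ B)
      π″ = subst IPath (sym (++-assoc A (c ∷ s ∷ S) _)) π

      a∈ : a ∈ A ++ c ∷ []
      a∈ = First⇒∈ _ (First-++ A {ys = (s ∷ S) ++ d ∷ B} (start r))

      b∈ : b ∈ d ∷ B
      b∈ = Last⇒∈ _ (Last-++⁻ (A ++ c ∷ s ∷ S) (subst (Last b) (sym (++-assoc A (c ∷ s ∷ S) _)) (end r)))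

      ≢a : ∀ {x} → x ∈ (s ∷ S) ++ d ∷ B → x ≢ a
      ≢a x∈ refl = IPath-++⇒∉ (A ++ c ∷ []) π′ a∈ x∈

      ≢b : ∀ {x} → x ∈ A ++ c ∷ s ∷ S → x ≢ b
      ≢b x∈ refl = IPath-++⇒∉ (A ++ c ∷ s ∷ S) π″ x∈ b∈

      ok′ : ∀ {x} → x ∈ A ++ c ∷ (s ∷ S) ++ d ∷ B → x ≡ a ⊎ x ≡ b ⊎ NA v x
      ok′ x∈ = proj₂ (lookup (ok r) x∈)

    inner-arc : Arc c (s ∷ S) d
    inner-arc = IPath-++⁻ˡ (c ∷ s ∷ S) (IPath-++⁻ʳ A π)

    -- The cycle without its inner arc: from `d` on to `b`, through `v`, and from `a` on to `c`.
    -- There is no chord at `v`, because `v` sees only `b` on the one part and only `a` on the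
    -- other.
    outer-arc : Arc d (B ++ v ∷ A) c
    outer-arc = subst (λ L → IPath (d ∷ L)) (sym (++-assoc B (v ∷ A) (c ∷ [])))
      (IPath-++⁺ (d ∷ B) {v}
        (IPath-snoc (IPath-++⁻ʳ (A ++ c ∷ s ∷ S) π″)
          (Last-++⁻ (A ++ c ∷ s ∷ S) (subst (Last b) (sym (++-assoc A (c ∷ s ∷ S) _)) (end r)))
          (~-sym v~b) (tabulate near-b))
        (cons-first (IPath-++⁻ˡ A π) (First-++ A {ys = (s ∷ S) ++ d ∷ B} (start r)) (tabulate near-a))
        (Anti-sym (All.map (++⁻ʳ S) (IPath-Anti (A ++ c ∷ []) π′))))
      where
      near-b : ∀ {x} → x ∈ d ∷ B → x ≡ b ⊎ NA x v
      near-b x∈ with ok′ (∈-++⁺ʳ A (there (∈-++⁺ʳ (s ∷ S) x∈)))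
      ... | inj₁ x≡a        = contradiction x≡a (≢a (∈-++⁺ʳ (s ∷ S) x∈))
      ... | inj₂ (inj₁ x≡b) = inj₁ x≡b
      ... | inj₂ (inj₂ na)  = inj₂ (NA-sym na)
      near-a : ∀ {x} → x ∈ A ++ c ∷ [] → x ≡ a ⊎ NA v x
      near-a {x} x∈ with ok′ (subst (x ∈_) (++-assoc A (c ∷ []) _) (∈-++⁺ˡ x∈))
      ... | inj₁ x≡a        = inj₁ x≡a
      ... | inj₂ (inj₁ x≡b) = contradiction x≡b
              (≢b (subst (x ∈_) (++-assoc A (c ∷ []) (s ∷ S)) (∈-++⁺ˡ x∈)))
      ... | inj₂ (inj₂ na)  = inj₂ na

    inner-outer : Anti (s ∷ S) (B ++ v ∷ A)
    inner-outer = tabulate λ x∈ → ++⁺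
      (lookup (IPath-Anti (A ++ c ∷ s ∷ S) π″) (∈-++⁺ʳ A (there x∈)))
      (NA-sym (far x∈ (ok′ (∈-++⁺ʳ A (there (∈-++⁺ˡ x∈))))) ∷
       lookup (Anti-sym (IPath-Anti A π)) (∈-++⁺ˡ x∈))
      where
      far : ∀ {x} → x ∈ s ∷ S → x ≡ a ⊎ x ≡ b ⊎ NA v x → NA v x
      far x∈ (inj₁ x≡a)        = contradiction x≡a (≢a (∈-++⁺ˡ x∈))
      far x∈ (inj₂ (inj₁ x≡b)) = contradiction x≡b (≢b (∈-++⁺ʳ A (there x∈)))
      far x∈ (inj₂ (inj₂ na))  = na

  private
    -- When one side of the fork is a single vertex `r` that sees the other side, `r` is the centre
    -- of a pyramid over the other cycle, with spokes to `c`, `d` and a vertex of `S`.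
    hub : ∀ {A c s S d B r} → Route (A ++ c ∷ (s ∷ S) ++ d ∷ B) → Arc c (r ∷ []) d → r ∉ A ++ c ∷ (s ∷ S) ++ d ∷ B →
          r ≢ v → Any (r ~_) (s ∷ S) → SolidOn (r ∷ v ∷ A ++ c ∷ (s ∷ S) ++ d ∷ B)
    hub {A} {c} {s} {S} {d} {B} {r} ρ (step c~r _ (step r~d _ _)) r∉ r≢v r~S with Route⇒Rim ρ | find r~S
    ... | p , rim , eq | x , x∈ , r~x =
      subst (λ P → SolidOn (r ∷ v ∷ P)) (sym eq)
        (pyramid-SolidOn rim r∉′ (in-rim c∈) (in-rim x∈P) (in-rim d∈) (~-sym c~r) r~x r~d
          (lookup (IPath-head≢ arc) (∈-++⁺ˡ x∈)) (lookup (IPath-head≢ arc) (∈-++⁺ʳ (s ∷ S) (here refl)))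
          (Unique-snoc-≢ (s ∷ S) (AllPairs.tail (IPath⇒Unique arc)) x∈))
      where
      arc = inner-arc {A} ρ
      P : List (Fin n)
      P = A ++ c ∷ (s ∷ S) ++ d ∷ B
      in-rim : ∀ {x} → x ∈ P → x ∈ v ∷ a ∷ p ++ b ∷ []
      in-rim x∈ = there (subst (_ ∈_) eq x∈)
      c∈ : c ∈ P
      c∈ = ∈-++⁺ʳ A (here refl)
      x∈P : x ∈ P
      x∈P = ∈-++⁺ʳ A (there (∈-++⁺ˡ x∈))
      d∈ : d ∈ P
      d∈ = ∈-++⁺ʳ A (there (∈-++⁺ʳ (s ∷ S) (here refl)))
      r∉′ : r ∉ v ∷ a ∷ p ++ b ∷ []
      r∉′ (here r≡v) = r≢v r≡v
      r∉′ (there r∈) = r∉ (subst (_ ∈_) (sym eq) r∈)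

    1≤outer : ∀ A B → 1 ≤ⁿ length (reverse (B ++ v ∷ A))
    1≤outer A B = subst (1 ≤ⁿ_) (sym (trans (length-reverse (B ++ v ∷ A))
                    (trans (length-++ B) (+-suc (length B) _)))) (s≤s z≤n)

    rearrange : ∀ A c d B S R → c ∷ d ∷ S ++ R ++ reverse (B ++ v ∷ A) ↭ v ∷ (A ++ c ∷ S ++ d ∷ B) ++ R
    rearrange A c d B S R = ↭-trans (prep c (prep d (↭ₚ.++⁺ˡ S (↭ₚ.++⁺ˡ R (↭ₚ.↭-reverse (B ++ v ∷ A))))))
      (solve 7 (λ c d S R B v A → (c ⊕ d ⊕ S ⊕ R ⊕ B ⊕ v ⊕ A) ⊜ (v ⊕ (A ⊕ c ⊕ S ⊕ d ⊕ B) ⊕ R)) ↭-refl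
        (c ∷ []) (d ∷ []) S R B (v ∷ []) A)

  -- The arcs `S`, `R` and the outer arc join `c` and `d`. Without edges between `S` and `R` they
  -- form a trihedron. With such an edge, a one-vertex side gives a pyramid, and two longer sides
  -- fall under `theta-SolidOn`.
  fork-SolidOn : ∀ {A c s S r R d B} → Fork A c (s ∷ S) (r ∷ R) d B → NoCrossing (s ∷ S) (r ∷ R) →
                 SolidOn (v ∷ (A ++ c ∷ (s ∷ S) ++ d ∷ B) ++ r ∷ R)
  fork-SolidOn {A} {c} {s} {S} {r} {R} {d} {B} fork nc
    with Any.any? (λ x → Any.any? (x ~?_) (r ∷ R)) (s ∷ S) | shape s S | shape r R
  ... | no none | _ | _ =
    SolidOn-↭ (rearrange A c d B (s ∷ S) (r ∷ R))
        (trihedron-SolidOn arcS arcR arcO (s≤s z≤n) (s≤s z≤n) (1≤outer A B)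
      (tabulate λ x∈ → tabulate λ y∈ →
        lookup (lookup disjoint x∈) y∈ , λ x~y → none (lose x∈ (lose y∈ x~y)))
      (Anti-reverse (inner-outer {A} routeS)) (Anti-reverse (inner-outer {A} routeR)))
    where
    open Fork fork
    arcS = inner-arc {A} routeS
    arcR = inner-arc {A} routeR
    arcO = Arc-reverse {p = B ++ v ∷ A} (outer-arc {A} routeS)
  ... | yes edge | long s S s′ | long r R r′ =
    SolidOn-↭ (rearrange A c d B (s ∷ S ++ s′ ∷ []) (r ∷ R ++ r′ ∷ [])) (theta-SolidOn arcS arcR arcO (1≤outer A B)
      (Anti-reverse (inner-outer {A} routeS)) (Anti-reverse (inner-outer {A} routeR)) disjoint nc)
    where
    open Fork fork
    arcS = inner-arc {A} routeS
    arcR = inner-arc {A} routeR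
    arcO = Arc-reverse {p = B ++ v ∷ A} (outer-arc {A} routeS)
  ... | yes edge | _ | single r =
    SolidOn-↭ (↭ₚ.++-comm (r ∷ []) (v ∷ A ++ c ∷ (s ∷ S) ++ d ∷ B))
      (hub {A} {S = S} routeS (inner-arc {A} {S = []} routeR) (R∌P (here refl))
          (≢-sym (Ok⇒≢v (lookup (ok routeR) (∈-++⁺ʳ A (there (here refl))))))
        (Any.map (λ { (here x~r) → ~-sym x~r }) edge))
    where open Fork fork
  ... | yes edge | single s | _ =
    SolidOn-↭ (solve 6 (λ s v A c R dB → (s ⊕ v ⊕ A ⊕ c ⊕ R ⊕ dB) ⊜ (v ⊕ (A ⊕ c ⊕ s ⊕ dB) ⊕ R)) ↭-refl
                 (s ∷ []) (v ∷ []) A (c ∷ []) (r ∷ R) (d ∷ B))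
      (hub {A} {S = R} routeR (inner-arc {A} {S = []} routeS) (Fork.R∌P (Fork-sym fork) (here refl))
        (≢-sym (Ok⇒≢v (lookup (ok routeS) (∈-++⁺ʳ A (there (here refl)))))) (adj edge))
    where
    open Fork fork
    adj : ∀ {P : Pred (Fin n) 0ℓ} → Any P (s ∷ []) → P s
    adj (here p) = p

  module _ {f : Subset n → Subset n} (resp : Respects f solids₂) where
    private
      g : List (Fin n) → Subset n
      g L = f ⟦ v ∷ L ⟧

    module _ {A : List (Fin n)} {c s : Fin n} {S : List (Fin n)} {r : Fin n} {R : List (Fin n)} {d : Fin n}
        {B : List (Fin n)} (fork : Fork A c (s ∷ S) (r ∷ R) d B) where
      open Fork fork
      private
        P Q U : List (Fin n)
        P = A ++ c ∷ (s ∷ S) ++ d ∷ B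
        Q = A ++ c ∷ (r ∷ R) ++ d ∷ B
        U = P ++ r ∷ R

        okU : All Ok U
        okU = ++⁺ (ok routeS) (++⁻ˡ (r ∷ R) (All.tail (++⁻ʳ A (ok routeR))))

        cycle∈ : ∀ {L} → Route L → ⟦ v ∷ L ⟧ ∈ cycles
        cycle∈ ρ = ∈-filter⁺ cycleAt? (∈-subsets _) (Route⇒CycleAt ρ)

        v∷-⊆ : ∀ {L} → (∀ {x} → x ∈ L → x ∈ U) → ⟦ v ∷ L ⟧ ⊆ ⟦ v ∷ U ⟧
        v∷-⊆ {L} L⊆ x∈ with ∈⟦⟧⁻ {xs = v ∷ L} x∈
        ... | here refl = ∈⟦⟧⁺ {xs = v ∷ U} (here refl)
        ... | there x∈  = ∈⟦⟧⁺ {xs = v ∷ U} (there (L⊆ x∈))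

        ends-only : ∀ {x} → x ∈ˢ ⟦ v ∷ U ⟧ → v ~ x → x ≡ a ⊎ x ≡ b
        ends-only x∈ v~x with ∈⟦⟧⁻ {xs = v ∷ U} x∈
        ... | here refl = contradiction v~x (~-irr refl)
        ... | there x∈U with proj₂ (lookup okU x∈U)
        ...   | inj₁ eq              = inj₁ eq
        ...   | inj₂ (inj₁ eq)       = inj₂ eq
        ...   | inj₂ (inj₂ (_ , ≁))  = contradiction v~x ≁

        trace-size : ∣ trace ⟦ v ∷ U ⟧ ∣ ≡ 2
        trace-size = ∣≈∣ (trace-≈
            (λ { (here refl)         → ∈⟦⟧⁺ {xs = v ∷ U} (there (∈-++⁺ˡ (First⇒∈ P (start routeS)))) , v~a
               ; (there (here refl)) → ∈⟦⟧⁺ {xs = v ∷ U} (there (∈-++⁺ˡ (Last⇒∈ P (end routeS)))) , v~b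
               ; (there (there ())) })
            (λ x∈ v~x → [ here , (λ eq → there (here eq)) ]′ (ends-only x∈ v~x)))
          ((a≢b ∷ []) ∷ [] ∷ [])

        third? : Dec (Any (λ Z → Z ⊆ ⟦ v ∷ U ⟧ × Z ≢ ⟦ v ∷ P ⟧ × Z ≢ ⟦ v ∷ Q ⟧) cycles)
        third? = Any.any? (λ Z → (Z ⊆? ⟦ v ∷ U ⟧) ×-dec ¬? (Z ≟ˢ ⟦ v ∷ P ⟧) ×-dec ¬? (Z ≟ˢ ⟦ v ∷ Q ⟧)) cycles

      -- A third cycle in the union has a route `L` that, by `routes-⊇`, misses some vertex of `R`
      -- and some vertex of `S`. The former is missed by `P` too and the latter by `Q`, so `smaller`
      -- gives `g L ≡ g P` and `g L ≡ g Q`. Without a third cycle the union is a solid linking `P`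
      -- and `Q`.
      exchange : (∀ {z L M} → z ∈ U → Route L → Route M → All (_∈ U) L → All (_∈ U) M → z ∉ L → z ∉ M → g L ≡ g M) →
                 g P ≡ g Q
      exchange smaller with third?
      ... | yes third with find third
      ...   | Z , Z∈ , Z⊆ , Z≢P , Z≢Q
        with CycleAt⇒Route (proj₂ (∈-filter⁻ cycleAt? {xs = subsets n} Z∈)) (λ x∈ → ends-only (Z⊆ x∈))
      ...     | L , ρ , refl = trans (sym (via-R (All.all? (_∈ˡ? L) (r ∷ R)))) (via-S (All.all? (_∈ˡ? L) (s ∷ S)))
        where
        L⊆U : All (_∈ U) L
        L⊆U = tabulate λ x∈ → not-v (∈⟦⟧⁻ {xs = v ∷ U} (Z⊆ (∈⟦⟧⁺ {xs = v ∷ L} (there x∈))))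
                                    (≢-sym (Ok⇒≢v (lookup (ok ρ) x∈)))
          where
          not-v : ∀ {x} → x ∈ v ∷ U → x ≢ v → x ∈ U
          not-v (here eq)  x≢v = contradiction eq x≢v
          not-v (there x∈) _   = x∈
        U-sym : ∀ {x} → x ∈ U → x ∈ Q ++ s ∷ S
        U-sym x∈ with ∈-++⁻ P x∈
        ... | inj₁ x∈P = Q⊆U (Fork-sym fork) x∈P
        ... | inj₂ x∈R = ∈-++⁺ˡ (∈-++⁺ʳ A (there (∈-++⁺ˡ x∈R)))
        via-R : Dec (All (_∈ L) (r ∷ R)) → g L ≡ g P
        via-R (yes R⊆) = contradiction (cong (λ M → ⟦ v ∷ M ⟧) (routes-⊇ fork ρ L⊆U R⊆)) Z≢Q
        via-R (no R⊈) with find (¬All⇒Any¬ (_∈ˡ? L) (r ∷ R) R⊈)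
        ... | z , z∈ , z∉ = smaller (∈-++⁺ʳ P z∈) ρ routeS L⊆U (tabulate ∈-++⁺ˡ) z∉ (R∌P z∈)
        via-S : Dec (All (_∈ L) (s ∷ S)) → g L ≡ g Q
        via-S (yes S⊆) = contradiction (cong (λ M → ⟦ v ∷ M ⟧)
                           (routes-⊇ (Fork-sym fork) ρ (All.map U-sym L⊆U) S⊆)) Z≢P
        via-S (no S⊈) with find (¬All⇒Any¬ (_∈ˡ? L) (s ∷ S) S⊈)
        ... | z , z∈ , z∉ = smaller (∈-++⁺ˡ (∈-++⁺ʳ A (there (∈-++⁺ˡ z∈)))) ρ routeR L⊆U (tabulate (Q⊆U fork))
                              z∉ (Fork.R∌P (Fork-sym fork) z∈)
      exchange smaller | no none =
        resp (∈-filter⁺ (tracedSolid? 2) (∈-subsets ⟦ v ∷ U ⟧)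
            ((fork-SolidOn fork nc (⟦⟧-≈ _) , ∈⟦⟧⁺ {xs = v ∷ U} (here refl) , U⊆W) , trace-size))
             (cycle∈ routeS) (cycle∈ routeR)
             (Route⇒CycleAt routeS , Route⇒CycleAt routeR , v∷-⊆ {P} ∈-++⁺ˡ , v∷-⊆ {Q} (Q⊆U fork) , tabulate only)
        where
        U⊆W : ⟦ v ∷ U ⟧ ⊆ W
        U⊆W x∈ with ∈⟦⟧⁻ {xs = v ∷ U} x∈
        ... | here refl = v∈W
        ... | there x∈  = proj₁ (lookup okU x∈)
        only : ∀ {Z} → Z ∈ cycles → Z ⊆ ⟦ v ∷ U ⟧ → Z ≡ ⟦ v ∷ P ⟧ ⊎ Z ≡ ⟦ v ∷ Q ⟧
        only {Z} Z∈ Z⊆ with Z ≟ˢ ⟦ v ∷ P ⟧ | Z ≟ˢ ⟦ v ∷ Q ⟧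
        ... | yes eq | _      = inj₁ eq
        ... | no _   | yes eq = inj₂ eq
        ... | no ≢P  | no ≢Q  = contradiction (lose Z∈ ((λ {x} → Z⊆ {x}) , ≢P , ≢Q)) none
        no-third : ∀ {L x y} → Route L → All (_∈ U) L → x ∈ s ∷ S → x ∉ L → y ∈ r ∷ R → y ∉ L → ⊥
        no-third {L} ρ L⊆ x∈ x∉ y∈ y∉ = none (lose (cycle∈ ρ)
          (v∷-⊆ {L} (lookup L⊆) , distinct-sets (∈-++⁺ʳ A (there (∈-++⁺ˡ x∈))) x∉ routeS ,
           distinct-sets (∈-++⁺ʳ A (there (∈-++⁺ˡ y∈))) y∉ routeR))
        nc : NoCrossing (s ∷ S) (r ∷ R)
        -- An edge `x y` can be crossed in either direction. One direction avoids `S₁` and `R₂`, the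
        -- other `S₂` and `R₁`; if both avoided parts were nonempty, a third cycle would result.
        nc S₁ {x} {S₂} R₁ {y} {R₂} eqS eqR x~y = first S₁ R₂ eqS eqR , second S₂ R₁ eqS eqR
          where
          first : ∀ S₁ R₂ → s ∷ S ≡ S₁ ++ x ∷ S₂ → r ∷ R ≡ R₁ ++ y ∷ R₂ → S₁ ≡ [] ⊎ R₂ ≡ []
          first []       R₂       _   _   = inj₁ refl
          first (_ ∷ _)  []       _   _   = inj₂ refl
          first S₁@(z ∷ _) R₂@(w ∷ _) eqS eqR with cross-route fork S₁ R₁ eqS eqR x~y
          ... | L , ρ , L⊆ , S₁∉ , R₂∉ = ⊥-elim (no-third ρ L⊆
                  (subst (z ∈_) (sym eqS) (here refl)) (S₁∉ (here refl))
                  (subst (w ∈_) (sym eqR) (∈-++⁺ʳ R₁ (there (here refl)))) (R₂∉ (here refl)))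
          second : ∀ S₂ R₁ → s ∷ S ≡ S₁ ++ x ∷ S₂ → r ∷ R ≡ R₁ ++ y ∷ R₂ → S₂ ≡ [] ⊎ R₁ ≡ []
          second []       R₁       _   _   = inj₁ refl
          second (_ ∷ _)  []       _   _   = inj₂ refl
          second S₂@(z ∷ _) R₁@(w ∷ _) eqS eqR with cross-route (Fork-sym fork) R₁ S₁ eqR eqS (~-sym x~y)
          ... | L , ρ , L⊆ , R₁∉ , S₂∉ = ⊥-elim (no-third ρ (All.map U-sym L⊆)
                  (subst (z ∈_) (sym eqS) (∈-++⁺ʳ S₁ (there (here refl)))) (S₂∉ (here refl))
                  (subst (w ∈_) (sym eqR) (here refl)) (R₁∉ (here refl)))
            where
            U-sym : ∀ {x} → x ∈ Q ++ s ∷ S → x ∈ U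
            U-sym x∈ with ∈-++⁻ Q x∈
            ... | inj₁ x∈Q = Q⊆U fork x∈Q
            ... | inj₂ x∈S = ∈-++⁺ˡ (∈-++⁺ʳ A (there (∈-++⁺ˡ x∈S)))

    -- The induction hypothesis for the sets obtained from `V` by removing one vertex `z`, with the
    -- removal expressed by both routes avoiding `z`.
    Smaller : Subset n → Set
    Smaller V = ∀ {z L M} → z ∈ˢ V → Route L → Route M → All (_∈ˢ V) L → All (_∈ˢ V) M → z ∉ L → z ∉ M → g L ≡ g M

    snoc-≡ : ∀ A c (P′ : List (Fin n)) → A ++ c ∷ P′ ≡ (A ++ c ∷ []) ++ P′
    snoc-≡ A c P′ = sym (++-assoc A (c ∷ []) P′)

    reach-end : ∀ {c q Q″} → IPath (c ∷ q ∷ Q″) → Last b (q ∷ Q″) → q ≢ b → Any (_~ b) (q ∷ Q″)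
    reach-end {Q″ = []}    _ e q≢b = contradiction (sym e) q≢b
    reach-end {q = q} {y ∷ ys} (step _ _ (step q~y nas π)) e q≢b with y Finₚ.≟ b
    ... | yes refl = here q~y
    ... | no y≢b   = there (reach-end (step q~y nas π) e y≢b)

    -- Replace L by the route that follows M from the vertex c where they
    -- diverge up to the first vertex r adjacent to the rest of L; it has a
    -- longer common prefix with M.
    converge : ∀ V → Smaller V → ∀ A c P′ Q′ {L M} → L ≡ A ++ c ∷ P′ → M ≡ A ++ c ∷ Q′ → Route L → Route M →
               All (_∈ˢ V) L → All (_∈ˢ V) M → g L ≡ g M
    converge V ih A c []       []       refl refl ρ σ L⊆ M⊆ = refl
    converge V ih A c []       (q ∷ Q″) refl refl ρ σ L⊆ M⊆ =
      contradiction refl (lookup (IPath-head≢ (IPath-++⁻ʳ A (ipath σ)))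
        (subst (_∈ q ∷ Q″) (Last-++⁻ A (end ρ))
            (Last⇒∈ _ (Last-++⁻ (A ++ c ∷ []) (subst (Last b) (snoc-≡ A c _) (end σ))))))
    converge V ih A c (p ∷ P″) []       refl refl ρ σ L⊆ M⊆ =
      contradiction refl (lookup (IPath-head≢ (IPath-++⁻ʳ A (ipath ρ)))
        (subst (_∈ p ∷ P″) (Last-++⁻ A (end σ))
            (Last⇒∈ _ (Last-++⁻ (A ++ c ∷ []) (subst (Last b) (snoc-≡ A c _) (end ρ))))))
    converge V ih A c (p ∷ P″) (q ∷ Q″) refl refl ρ σ L⊆ M⊆ with p Finₚ.≟ q
    ... | yes refl = converge V ih (A ++ c ∷ []) p P″ Q″ (snoc-≡ A c _) (snoc-≡ A c _) ρ σ L⊆ M⊆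
    ... | no p≢q with IPath-++⁻ʳ A (ipath ρ) | IPath-++⁻ʳ A (ipath σ)
    ...   | πc@(step c~p c≁P″ πp) | σc@(step c~q c≁Q″ σq)
      with split-first (λ x → Any.any? (x ~?_) P″) some-attached
      where
      endL : Last b (p ∷ P″)
      endL = Last-++⁻ (A ++ c ∷ []) (subst (Last b) (snoc-≡ A c _) (end ρ))
      endM : Last b (q ∷ Q″)
      endM = Last-++⁻ (A ++ c ∷ []) (subst (Last b) (snoc-≡ A c _) (end σ))
      -- If `b` were `p`, it would be a neighbour of `c`. On the other route `b` would then be `q`,
      -- against `p ≢ q`, or lie in `Q″`, which gives a chord at `c`.
      b∈P″ : b ∈ P″
      b∈P″ with Last⇒∈ (p ∷ P″) endL
      ... | there b∈  = b∈
      ... | here refl with Last⇒∈ (q ∷ Q″) endM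
      ...   | here b≡q = contradiction b≡q p≢q
      ...   | there b∈ = contradiction c~p (proj₂ (lookup c≁Q″ b∈))
      q≢b : q ≢ b
      q≢b refl = proj₂ (lookup c≁P″ b∈P″) c~q
      some-attached : Any (λ x → Any (x ~_) P″) (q ∷ Q″)
      -- The vertex just before `b` on the second route sees `b`, which lies in `P″`.
      some-attached = Any.map (lose b∈P″) (reach-end σc endM q≢b)
    ...     | R₁ , r , R₂ , eqR , R₁≁ , r~P″ with split-last (r ~?_) r~P″
    -- With `r` the first vertex that sees `P″` and `d` the last neighbour of `r` there, the path
    -- `N` through `r` and `d` has no chord. It forms a fork with the first route and shares with
    -- the second one a prefix reaching at least to `q`.
    ...       | S₁ , d , B , refl , r~d , r≁B = trans g₁ (g₂ R₁ eqR refl)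
      where
      N : List (Fin n)
      N = A ++ c ∷ (R₁ ++ r ∷ []) ++ d ∷ B

      eqM : A ++ c ∷ q ∷ Q″ ≡ (A ++ c ∷ R₁) ++ r ∷ R₂
      eqM = trans (cong (λ L → A ++ c ∷ L) eqR) (sym (++-assoc A (c ∷ R₁) (r ∷ R₂)))

      eqN : (A ++ c ∷ R₁) ++ r ∷ d ∷ B ≡ N
      eqN = trans (++-assoc A (c ∷ R₁) _) (cong (λ L → A ++ c ∷ L) (sym (++-assoc R₁ (r ∷ []) _)))

      R⊆M : ∀ {z} → z ∈ R₁ ++ r ∷ [] → z ∈ q ∷ Q″
      R⊆M {z} z∈ = subst (z ∈_) (trans (++-assoc R₁ (r ∷ []) R₂) (sym eqR)) (∈-++⁺ˡ z∈)

      pathR : IPath (R₁ ++ r ∷ [])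
      pathR = IPath-++⁻ˡ R₁ (subst IPath eqR σq)

      firstR : First q (R₁ ++ r ∷ [])
      firstR = First-++ R₁ {zs = []} (subst (First q) eqR refl)

      -- A vertex of this part other than `q` has its predecessor in `R₁`; if it lay on `P″`, that
      -- predecessor would see `P″` before `r` does. And `q` is a neighbour of `c`, which sees
      -- nothing on `P″`.
      R∌P″ : ∀ {z} → z ∈ R₁ ++ r ∷ [] → z ∉ S₁ ++ d ∷ B
      R∌P″ z∈R z∈P with predecessor R₁ pathR firstR z∈R
      ... | inj₁ refl = proj₂ (lookup c≁P″ z∈P) c~q
      ... | inj₂ z~R₁ with find z~R₁
      ...   | y , y∈ , z~y = lookup R₁≁ y∈ (lose z∈P (~-sym z~y))

      R∌p : ∀ {z} → z ∈ R₁ ++ r ∷ [] → z ≢ p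
      R∌p z∈R refl with R⊆M z∈R
      ... | here p≡q = p≢q p≡q
      ... | there p∈ = proj₂ (lookup c≁Q″ p∈) c~p

      anti : Anti (A ++ c ∷ R₁) (d ∷ B)
      anti = ++⁺ (All.map drop-S₁ (++⁻ˡ A A≁)) (drop-S₁ (All.head (++⁻ʳ A A≁)) ∷ tabulate R₁≁B)
        where
        A≁ : Anti (A ++ c ∷ []) (S₁ ++ d ∷ B)
        A≁ = IPath-Anti (A ++ c ∷ []) (subst IPath (snoc-≡ A c _) (ipath ρ))
        drop-S₁ : ∀ {x} → All (NA x) (S₁ ++ d ∷ B) → All (NA x) (d ∷ B)
        drop-S₁ = ++⁻ʳ S₁
        R₁≁B : ∀ {x} → x ∈ R₁ → All (NA x) (d ∷ B)
        R₁≁B x∈ = tabulate λ y∈ → (λ { refl → R∌P″ (∈-++⁺ˡ x∈) (∈-++⁺ʳ S₁ y∈) }) ,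
                    λ x~y → lookup R₁≁ x∈ (lose (∈-++⁺ʳ S₁ y∈) x~y)

      pathN : IPath N
      pathN = subst IPath eqN (IPath-link (A ++ c ∷ R₁)
        (IPath-++⁻ˡ (A ++ c ∷ R₁) (subst IPath eqM (ipath σ))) r~d (IPath-++⁻ʳ (p ∷ S₁) πp) anti
        (tabulate λ y∈ → (λ { refl → R∌P″ (∈-++⁺ʳ R₁ (here refl)) (∈-++⁺ʳ S₁ (there y∈)) }) , lookup r≁B y∈))

      allN : ∀ {P : Pred (Fin n) 0ℓ} → All P (A ++ c ∷ p ∷ S₁ ++ d ∷ B) → All P (A ++ c ∷ q ∷ Q″) → All P N
      allN PL PM with ++⁻ʳ A PL
      ... | Pc ∷ _ ∷ PP = ++⁺ (++⁻ˡ A PL) (Pc ∷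
              ++⁺ (tabulate λ z∈ → lookup (All.tail (++⁻ʳ A PM)) (R⊆M z∈)) (++⁻ʳ S₁ PP))

      τ : Route N
      τ = route pathN (First-++ A (start ρ))
            (subst (Last b) eqN (Last-++⁺ (A ++ c ∷ R₁) {r} {d ∷ B} (Last-++⁻ (A ++ c ∷ p ∷ S₁)
              (subst (Last b) (sym (++-assoc A (c ∷ p ∷ S₁) _)) (end ρ)))))
            (allN (ok ρ) (ok σ))

      N⊆ : All (_∈ˢ V) N
      N⊆ = allN L⊆ M⊆

      fork : Fork A c (p ∷ S₁) (R₁ ++ r ∷ []) d B
      fork = record { routeS = ρ ; routeR = τ ; disjoint = tabulate λ s∈ → tabulate λ r∈ eq →
          R∌S r∈ (subst (_∈ p ∷ S₁) eq s∈) }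
        where
        R∌S : ∀ {z} → z ∈ R₁ ++ r ∷ [] → z ∉ p ∷ S₁
        R∌S z∈ (here z≡p)  = R∌p z∈ z≡p
        R∌S z∈ (there z∈S) = R∌P″ z∈ (∈-++⁺ˡ z∈S)

      -- The case split only shows that `R₁ ++ r ∷ []` is a cons, the form required by `exchange`.
      nonempty : ∀ R₁ {r} → Fork A c (p ∷ S₁) (R₁ ++ r ∷ []) d B → All (_∈ˢ V) (R₁ ++ r ∷ []) →
                 g (A ++ c ∷ p ∷ S₁ ++ d ∷ B) ≡ g (A ++ c ∷ (R₁ ++ r ∷ []) ++ d ∷ B)
      nonempty [] fork R⊆ = exchange fork λ z∈ ρ₁ ρ₂ L₁⊆ L₂⊆ →
        ih (lookup (++⁺ L⊆ R⊆) z∈) ρ₁ ρ₂ (All.map (lookup (++⁺ L⊆ R⊆)) L₁⊆) (All.map (lookup (++⁺ L⊆ R⊆)) L₂⊆)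
      nonempty (_ ∷ _) fork R⊆ = exchange fork λ z∈ ρ₁ ρ₂ L₁⊆ L₂⊆ →
        ih (lookup (++⁺ L⊆ R⊆) z∈) ρ₁ ρ₂ (All.map (lookup (++⁺ L⊆ R⊆)) L₁⊆) (All.map (lookup (++⁺ L⊆ R⊆)) L₂⊆)

      g₁ : g (A ++ c ∷ p ∷ S₁ ++ d ∷ B) ≡ g N
      g₁ = nonempty R₁ fork (++⁻ˡ (R₁ ++ r ∷ []) (All.tail (++⁻ʳ A N⊆)))

      -- With the variable `R₁′` the equation of lists can be matched. `N` and the second route now
      -- agree through `q`, and the recursion runs on the shorter remainder `Q″`.
      g₂ : ∀ R₁′ → q ∷ Q″ ≡ R₁′ ++ r ∷ R₂ → R₁′ ≡ R₁ → g N ≡ g (A ++ c ∷ q ∷ Q″)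
      g₂ []       refl refl = converge V ih (A ++ c ∷ []) q (d ∷ B) Q″ (snoc-≡ A c _) (snoc-≡ A c _) τ σ N⊆ M⊆
      g₂ (_ ∷ R′) refl refl = converge V ih (A ++ c ∷ []) q ((R′ ++ r ∷ []) ++ d ∷ B) Q″ (snoc-≡ A c _)
          (snoc-≡ A c _) τ σ N⊆ M⊆

    -- Two routes that both avoid a vertex `z` of `V` live in `V` without `z`; this supplies
    -- `Smaller` by induction on a bound `m` for the size.
    routes-agree : ∀ m V → ∣ V ∣ ≤ⁿ m → ∀ {L M} → Route L → Route M → All (_∈ˢ V) L → All (_∈ˢ V) M → g L ≡ g M
    routes-agree m V ∣V∣≤m {_ ∷ P′} {_ ∷ Q′} ρ@(route _ refl _ _) σ@(route _ refl _ _) L⊆ M⊆ =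
        converge V (smaller m ∣V∣≤m) [] a P′ Q′ refl refl ρ σ L⊆ M⊆
      where
      smaller : ∀ m → ∣ V ∣ ≤ⁿ m → Smaller V
      smaller zero    ≤m z∈ = contradiction (≤-trans (x∈p⇒∣p-x∣<∣p∣ z∈) ≤m) λ ()
      smaller (suc m) ≤m {z} z∈ ρ₁ ρ₂ L₁⊆ L₂⊆ z∉₁ z∉₂ =
        routes-agree m (V ∖ z) (s≤s⁻¹ (≤-trans (x∈p⇒∣p-x∣<∣p∣ z∈) ≤m)) ρ₁ ρ₂
          (without L₁⊆ z∉₁) (without L₂⊆ z∉₂)
        where
        without : ∀ {L} → All (_∈ˢ V) L → z ∉ L → All (_∈ˢ V ∖ z) L
        without L⊆ z∉ = tabulate λ x∈ → x∈p∧x≢y⇒x∈p-y (lookup L⊆ x∈) λ { refl → z∉ x∈ }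

-- An upper bound for the number of cycles through `v`.

module CycleBound {n : ℕ} (G : Graph n) {v : Fin n} {W : Subset n} (v∈W : v ∈ˢ W) where
  open Graph G
  open InducedPaths G
  open Subsets
  open Cycles G
  open At G v W

  record Through (Z : Subset n) : Set where
    field
      {a b} : Fin n
      v~a   : v ~ a
      v~b   : v ~ b
      a≢b   : a ≢ b
      a∈    : a ∈ˢ Z
      b∈    : b ∈ˢ Z
      only  : ∀ {x} → x ∈ˢ Z → v ~ x → x ≡ a ⊎ x ≡ b

  through : ∀ {Z} → CycleAt Z → Through Z
  through {Z} (cyc , v∈ , _) with InducedCycle⇒Rim cyc v∈
  ... | a , p , b , (arc , v~a , v~b , v≁p) , Z≈ = record
    { v~a = v~a ; v~b = v~b
    ; a≢b = lookup (IPath-head≢ arc) (∈-++⁺ʳ p (here refl))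
    ; a∈ = Equivalence.from (Z≈ a) (there (here refl))
    ; b∈ = Equivalence.from (Z≈ b) (there (there (∈-++⁺ʳ p (here refl))))
    ; only = λ x∈ → only (Equivalence.to (Z≈ _) x∈) }
    where
    only : ∀ {x} → x ∈ v ∷ a ∷ p ++ b ∷ [] → v ~ x → x ≡ a ⊎ x ≡ b
    only (here refl)         v~x = contradiction v~x (~-irr refl)
    only (there (here refl)) v~x = inj₁ refl
    only (there (there x∈))  v~x with ∈-++⁻ p x∈
    ... | inj₁ x∈p         = contradiction v~x (proj₂ (lookup v≁p x∈p))
    ... | inj₂ (here refl) = inj₂ refl

  cycle⁻ : ∀ {Z} → Z ∈ cycles → CycleAt Z
  cycle⁻ Z∈ = proj₂ (∈-filter⁻ cycleAt? {xs = subsets n} Z∈)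

  -- Equal traces mean that `v` has the same two neighbours on both cycles, so both become routes
  -- between the same `a` and `b`.
  same-label : ∀ {P Q} f → Respects f solids₂ → CycleAt P → CycleAt Q → trace P ≡ trace Q → f P ≡ f Q
  same-label {P} {Q} f resp cP cQ eq = agree (CycleAt⇒Route cP only) (CycleAt⇒Route cQ only-Q)
    where
    open Through (through cP)
    open Between G v∈W v~a v~b a≢b
    open Exchange G v∈W v~a v~b a≢b using (routes-agree)
    only-Q : ∀ {x} → x ∈ˢ Q → v ~ x → x ≡ a ⊎ x ≡ b
    only-Q {x} x∈ v~x = only (proj₁ (∈-trace⁻ {P} (subst (x ∈ˢ_) (sym eq) (∈-trace⁺ {Q} x∈ v~x)))) v~x
    agree : ∀ {P Q} → (∃ λ L → Route L × P ≡ ⟦ v ∷ L ⟧) → (∃ λ L → Route L × Q ≡ ⟦ v ∷ L ⟧) → f P ≡ f Q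
    agree (L , ρ , refl) (M , σ , refl) =
      routes-agree resp n ⊤ (∣p∣≤n ⊤) ρ σ (tabulate λ _ → ∈⊤) (tabulate λ _ → ∈⊤)

  trace-ofSize : ∀ {P} → CycleAt P → OfSize 2 (trace W) (trace P)
  trace-ofSize {P} cP@(_ , _ , P⊆W) =
    (λ x∈ → let x∈P , v~x = ∈-trace⁻ {P} x∈ in ∈-trace⁺ {W} (P⊆W x∈P) v~x) ,
    ∣≈∣ (trace-≈ to (λ x∈ v~x → [ here , (λ eq → there (here eq)) ]′ (only x∈ v~x))) ((a≢b ∷ []) ∷ [] ∷ [])
    where
    open Through (through cP)
    to : ∀ {x} → x ∈ a ∷ b ∷ [] → x ∈ˢ P × v ~ x
    to (here refl)         = a∈ , v~a
    to (there (here refl)) = b∈ , v~b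

  -- The classes are the possible traces, namely the two-element sets of neighbours of `v` in `W`.
  cycles-bound : length cycles ≤ⁿ (∣ trace W ∣ C 2) +ⁿ length solids₂
  cycles-bound = subst (λ k → length cycles ≤ⁿ k +ⁿ length solids₂) (count-ofSize 2 (trace W))
    (cycles≤classes+links {Y = solids₂} (filter (ofSize? 2 (trace W)) (subsets n)) trace
      (Uniqueₚ.filter⁺ cycleAt? (subsets-Unique n))
      (λ P∈ → ∈-filter⁺ (ofSize? 2 (trace W)) (∈-subsets _) (trace-ofSize (cycle⁻ P∈)))
      (λ f resp P∈ Q∈ eq → same-label f resp (cycle⁻ P∈) (cycle⁻ Q∈) eq))

-- Solids in which three prescribed vertices are the neighbours of `v`.

module Triples {n : ℕ} (G : Graph n) {v : Fin n} {D : Pred (Fin n) 0ℓ}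
  (v≁D : ∀ {d} → D d → InducedPaths.NA G v d) (conn : InducedPaths.Conn G D) where
  open Graph G
  open InducedPaths G
  open Subsets
  open Solids G
  open Junctions G
  open Routes G using (IPath-link; predecessor)
  open import Algebra.Solver.CommutativeMonoid (↭ₚ.++-commutativeMonoid {A = Fin n}) using (solve; _⊜_; _⊕_)

  Attached : Fin n → List (Fin n) → Set
  Attached x ys = Any (x ~_) ys

  attached? : ∀ x ys → Dec (Attached x ys)
  attached? x = Any.any? (x ~?_)

  unattached : ∀ {x ys} → ¬ Attached x ys → x ∉ ys → All (NA x) ys
  unattached x≁ x∉ = tabulate λ y∈ → (λ { refl → x∉ y∈ }) , λ x~y → x≁ (lose y∈ x~y)

  -- Since `v` has no neighbours in `D`, its neighbours in such a solid all lie in `xs`.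
  SolidAround : List (Fin n) → Set
  SolidAround xs = ∃ λ S → InducedSolid G S × All (_∈ˢ S) (v ∷ xs) × (∀ {u} → u ∈ˢ S → u ∈ v ∷ xs ⊎ D u)

  SolidAround-↭ : ∀ {xs ys} → xs ↭ ys → SolidAround xs → SolidAround ys
  SolidAround-↭ σ (S , solid , ∈S , ⊆) = S , solid , ↭ₚ.All-resp-↭ (prep v σ) ∈S ,
    λ u∈ → [ inj₁ ∘ ↭ₚ.∈-resp-↭ (prep v σ) , inj₂ ]′ (⊆ u∈)

  solidAround : ∀ {vs xs} E → SolidOn vs → vs ↭ (v ∷ xs) ++ E → All D E → SolidAround xs
  solidAround {vs} {xs} E solid σ DE = ⟦ vs ⟧ , solid (⟦⟧-≈ vs) ,
    tabulate (λ x∈ → ∈⟦⟧⁺ {xs = vs} (↭ₚ.∈-resp-↭ (↭-sym σ) (∈-++⁺ˡ x∈))) ,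
    λ u∈ → [ inj₁ , inj₂ ∘ lookup DE ]′ (∈-++⁻ (v ∷ xs) (↭ₚ.∈-resp-↭ σ (∈⟦⟧⁻ {xs = vs} u∈)))

  ∉D : ∀ {x} → v ~ x → ¬ D x
  ∉D v~x Dx = proj₂ (v≁D Dx) v~x

  ∉Ds : ∀ {x xs} → v ~ x → All D xs → x ∉ xs
  ∉Ds v~x Dxs x∈ = ∉D v~x (lookup Dxs x∈)

  v≁ : ∀ {xs} → All D xs → All (NA v) xs
  v≁ = All.map v≁D

  -- The path `y`, `X`, `z` closes to a cycle through `v`, on which `w` sees `v` and some `x`. A
  -- third neighbour of `w` on it yields a pyramid. Otherwise `v` and `x` are the ends of a
  -- trihedron, with `w` as the interior of one path.
  hub : ∀ {y z w X} → v ~ y → v ~ z → v ~ w → w ≢ y → w ≢ z → Arc y X z → All D X → Attached w X →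
        SolidAround (y ∷ z ∷ w ∷ [])
  hub {y} {z} {w} {X} v~y v~z v~w w≢y w≢z arc DX w~X with split-first (w ~?_) w~X
  ... | X₁ , x , X₂ , refl , w≁X₁ , w~x = go (w ~? y) (w ~? z) (attached? w X₂)
    where
    x∈ : x ∈ X₁ ++ x ∷ X₂
    x∈ = ∈-++⁺ʳ X₁ (here refl)
    rim : List (Fin n)
    rim = v ∷ y ∷ (X₁ ++ x ∷ X₂) ++ z ∷ []
    w∉ : w ∉ rim
    w∉ (here w≡v)         = ~⇒≢ v~w (sym w≡v)
    w∉ (there (here w≡y)) = w≢y w≡y
    w∉ (there (there w∈)) with ∈-++⁻ (X₁ ++ x ∷ X₂) w∈
    ... | inj₁ w∈X        = ∉Ds v~w DX w∈X
    ... | inj₂ (here w≡z) = w≢z w≡z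
    spoked : ∀ {u} → u ∈ y ∷ (X₁ ++ x ∷ X₂) ++ z ∷ [] → w ~ u → x ≢ u → SolidAround (y ∷ z ∷ w ∷ [])
    spoked u∈ w~u x≢u = solidAround (X₁ ++ x ∷ X₂)
      (pyramid-SolidOn (arc , v~y , v~z , v≁ DX) w∉ (here refl) (there (there (∈-++⁺ˡ x∈))) (there u∈)
        (~-sym v~w) w~x w~u (proj₁ (v≁D (lookup DX x∈))) (λ { refl → v∉ u∈ }) x≢u)
      (solve 5 (λ v y z w X → (w ⊕ v ⊕ y ⊕ X ⊕ z) ⊜ ((v ⊕ y ⊕ z ⊕ w) ⊕ X)) ↭-refl (v ∷ []) (y ∷ []) (z ∷ [])
          (w ∷ []) (X₁ ++ x ∷ X₂))
      DX
      where
      v∉ : v ∉ y ∷ (X₁ ++ x ∷ X₂) ++ z ∷ []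
      v∉ (here v≡y) = ~⇒≢ v~y v≡y
      v∉ (there v∈) with ∈-++⁻ (X₁ ++ x ∷ X₂) v∈
      ... | inj₁ v∈X        = proj₁ (v≁D (lookup DX v∈X)) refl
      ... | inj₂ (here v≡z) = ~⇒≢ v~z v≡z
    arc₂ : Arc x X₂ z
    arc₂ = IPath-++⁻ʳ (y ∷ X₁) (subst (λ L → IPath (y ∷ L)) (++-assoc X₁ (x ∷ X₂) (z ∷ [])) arc)
    arc₁ : Arc y X₁ x
    arc₁ = IPath-++⁻ˡ (y ∷ X₁) (subst (λ L → IPath (y ∷ L)) (++-assoc X₁ (x ∷ X₂) (z ∷ [])) arc)
    anti : Anti (y ∷ X₁) (X₂ ++ z ∷ [])
    anti = IPath-Anti (y ∷ X₁) (subst (λ L → IPath (y ∷ L)) (++-assoc X₁ (x ∷ X₂) (z ∷ [])) arc)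
    DX₁ = ++⁻ˡ X₁ DX
    Dx  = All.head (++⁻ʳ X₁ DX)
    DX₂ = All.tail (++⁻ʳ X₁ DX)
    go : Dec (w ~ y) → Dec (w ~ z) → Dec (Attached w X₂) → SolidAround (y ∷ z ∷ w ∷ [])
    go (yes w~y) _ _ = spoked (here refl) w~y λ { refl → ∉D v~y Dx }
    go _ (yes w~z) _ = spoked (there (∈-++⁺ʳ (X₁ ++ x ∷ X₂) (here refl))) w~z λ { refl → ∉D v~z Dx }
    go _ _ (yes w~X₂) with find w~X₂
    ... | u , u∈ , w~u = spoked (there (∈-++⁺ˡ (∈-++⁺ʳ X₁ (there u∈)))) w~u
            (lookup (IPath-head≢ arc₂) (∈-++⁺ˡ u∈))
    go (no w≁y) (no w≁z) (no w≁X₂) = solidAround (X₁ ++ x ∷ reverse X₂)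
      (trihedron-SolidOn (Arc-cons [] v~w [] (v≁D Dx) (step w~x [] [ x ]))
        (Arc-cons X₁ v~y (v≁ DX₁) (v≁D Dx) arc₁)
        (Arc-cons (reverse X₂) v~z (All-reverse (v≁ DX₂)) (v≁D Dx) (Arc-reverse {p = X₂} arc₂))
        (s≤s z≤n) (s≤s z≤n) (s≤s z≤n)
        (((w≢y , w≁y) ∷ unattached (All¬⇒¬Any w≁X₁) (∉Ds v~w DX₁)) ∷ [])
        (((w≢z , w≁z) ∷ All-reverse (unattached w≁X₂ (∉Ds v~w DX₂))) ∷ [])
        (All.map (λ {u} nas → All.head (++⁻ʳ X₂ nas) ∷ All-reverse (++⁻ˡ X₂ nas)) anti))
      (solve 7 (λ v x w y X₁ z X₂ → (v ⊕ x ⊕ w ⊕ (y ⊕ X₁) ⊕ (z ⊕ X₂)) ⊜ ((v ⊕ y ⊕ z ⊕ w) ⊕ (X₁ ⊕ x ⊕ X₂))) ↭-refl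
        (v ∷ []) (x ∷ []) (w ∷ []) (y ∷ []) X₁ (z ∷ []) (reverse X₂))
      (++⁺ DX₁ (Dx ∷ All-reverse DX₂))

  -- L ++ t ∷ [] is a path from v of which only t has neighbours on X, and X is
  -- a path from y to z; the first and last neighbours of t on X are used.
  junction : ∀ {y z w X L L′ t} → v ~ y → v ~ z → IPath (y ∷ X) → IPath (X ++ z ∷ []) → All D X →
    IPath (v ∷ L ++ t ∷ []) → L ++ t ∷ [] ≡ w ∷ L′ → All D L′ → Anti L X → All (NA y) (L ++ t ∷ []) →
        All (NA z) (L ++ t ∷ []) →
    t ∉ X → Attached t X → y ~ z ⊎ NA y z × 1 ≤ⁿ length L → SolidAround (y ∷ z ∷ w ∷ [])
  junction {y} {z} {w} {X} {L} {L′} {t} v~y v~z yX Xz DX vLt eqL DL′ LX y≁Lt z≁Lt t∉X t~X y?z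
    with split-first (t ~?_) t~X
  ... | X₁ , x , X₂ , refl , t≁′X₁ , t~x = go (attached? t X₂)
    where
    y≁L = ++⁻ˡ L y≁Lt
    z≁L = ++⁻ˡ L z≁Lt
    y≁t = All.head (++⁻ʳ L y≁Lt)
    z≁t = All.head (++⁻ʳ L z≁Lt)
    DX₁ = ++⁻ˡ X₁ DX
    Dx  = All.head (++⁻ʳ X₁ DX)
    DX₂ = All.tail (++⁻ʳ X₁ DX)
    t≁X₁ : All (NA t) X₁
    t≁X₁ = unattached (All¬⇒¬Any t≁′X₁) (t∉X ∘ ∈-++⁺ˡ)
    L≁x : All (λ u → NA u x) L
    L≁x = All.map (λ nas → All.head (++⁻ʳ X₁ nas)) LX
    LX₁ : Anti L X₁
    LX₁ = All.map (++⁻ˡ X₁) LX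
    LX₂ : Anti L X₂
    LX₂ = All.map (λ nas → All.tail (++⁻ʳ X₁ nas)) LX
    Xz′ : IPath (X₁ ++ x ∷ X₂ ++ z ∷ [])
    Xz′ = subst IPath (++-assoc X₁ (x ∷ X₂) (z ∷ [])) Xz
    arcY : Arc y X₁ x
    arcY = IPath-++⁻ˡ (y ∷ X₁) yX
    arcZ : Arc x X₂ z
    arcZ = IPath-++⁻ʳ X₁ Xz′
    yX₁≁X₂ : Anti (y ∷ X₁) X₂
    yX₁≁X₂ = IPath-Anti (y ∷ X₁) yX
    z≁X₁ : All (NA z) X₁
    z≁X₁ = All.map (λ nas → NA-sym (All.head (++⁻ʳ X₂ nas))) (IPath-Anti X₁ Xz′)
    finish : ∀ {vs} E → SolidOn vs → vs ↭ v ∷ y ∷ z ∷ (L ++ t ∷ []) ++ E → All D E → SolidAround (y ∷ z ∷ w ∷ [])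
    finish E solid σ DE = solidAround (L′ ++ E) solid
      (subst (λ Lt → _ ↭ v ∷ y ∷ z ∷ Lt ++ E) eqL σ) (++⁺ DL′ DE)
    y?z′ : ∀ {V : List (Fin n)} → (1 ≤ⁿ length L → 1 ≤ⁿ length V) → y ~ z ⊎ NA y z × 1 ≤ⁿ length V
    y?z′ f = Data.Sum.map₂ (Data.Product.map₂ f) y?z

    go : Dec (Attached t X₂) → SolidAround (y ∷ z ∷ w ∷ [])
    -- The only neighbour of `t` on `X` is `x`, and there the three paths meet.
    go (no t≁′X₂) = finish (X₁ ++ x ∷ reverse X₂)
      (point-SolidOn {V = L ++ t ∷ []}
        (IPath-snoc vLt (Last-++⁺ (v ∷ L) refl) t~x (inj₂ (v≁D Dx) ∷ ++⁺ (All.map inj₂ L≁x) (inj₁ refl ∷ [])))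
        arcY (Arc-reverse {p = X₂} arcZ) v~y v~z
        ((v≁ DX₁ ∷ ++⁺ LX₁ (t≁X₁ ∷ [])) , y≁Lt)
        ((All-reverse (v≁ DX₂) ∷ Anti-reverse (++⁺ LX₂ (t≁X₂ ∷ []))) , z≁Lt)
        (Anti-reverse yX₁≁X₂ , z≁X₁)
        (y?z′ {L ++ t ∷ []} λ _ → subst (1 ≤ⁿ_) (sym (length-++ L {t ∷ []})) (m≤n+m 1 (length L))))
      (solve 7 (λ x v y z Lt X₁ X₂ → (x ⊕ v ⊕ y ⊕ z ⊕ Lt ⊕ X₁ ⊕ X₂) ⊜ (v ⊕ y ⊕ z ⊕ Lt ⊕ (X₁ ⊕ x ⊕ X₂))) ↭-refl
        (x ∷ []) (v ∷ []) (y ∷ []) (z ∷ []) (L ++ t ∷ []) X₁ (reverse X₂))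
      (++⁺ DX₁ (Dx ∷ All-reverse DX₂))
      where
      t≁X₂ : All (NA t) X₂
      t≁X₂ = unattached t≁′X₂ (t∉X ∘ ∈-++⁺ʳ X₁ ∘ there)
    go (yes t~X₂) with split-last (t ~?_) t~X₂
    -- The first and the last neighbour are consecutive on `X`, so the three paths end in the
    -- triangle `t`, `x`, `x′`.
    ... | [] , x′ , X₄ , refl , t~x′ , t≁′X₄ = finish (X₁ ++ x ∷ x′ ∷ reverse X₄)
      (triangle-SolidOn {V = L} {Y = X₁} {Z = reverse X₄} vLt arcY (Arc-reverse {p = X₄} x′z) v~y v~z
        t~x (x~x′ arcZ) (~-sym t~x′)
        ((v≁ DX₁ ∷ t≁X₁ ∷ LX₁) , y≁L , All.map NA-sym L≁x , v≁D Dx , y≁t)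
        ((All-reverse (v≁ DX₄) ∷ All-reverse t≁X₄ ∷ Anti-reverse (All.map All.tail LX₂)) , z≁L ,
          All.map (λ nas → NA-sym (All.head nas)) LX₂ , v≁D Dx′ , z≁t)
        ((All-reverse (All.tail (All.head yX₁≁X₂)) ∷ All-reverse (++⁻ˡ X₄ x≁) ∷
           Anti-reverse (All.map All.tail (All.tail yX₁≁X₂))) , z≁X₁ ,
          All.map (λ nas → NA-sym (All.head nas)) (All.tail yX₁≁X₂) , All.head (All.head yX₁≁X₂) ,
          NA-sym (All.head (++⁻ʳ X₄ x≁)))
        ([ inj₁ , inj₂ ∘ proj₁ ]′ y?z))
      (solve 9 (λ v y z t x x′ L X₁ X₄ →
          (v ⊕ y ⊕ z ⊕ t ⊕ x ⊕ x′ ⊕ L ⊕ X₁ ⊕ X₄) ⊜ (v ⊕ y ⊕ z ⊕ (L ⊕ t) ⊕ (X₁ ⊕ x ⊕ x′ ⊕ X₄))) ↭-refl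
        (v ∷ []) (y ∷ []) (z ∷ []) (t ∷ []) (x ∷ []) (x′ ∷ []) L X₁ (reverse X₄))
      (++⁺ DX₁ (Dx ∷ Dx′ ∷ All-reverse DX₄))
      where
      Dx′ = All.head DX₂
      DX₄ = All.tail DX₂
      x~x′ : Arc x (x′ ∷ X₄) z → x ~ x′
      x~x′ (step e _ _) = e
      x≁ : All (NA x) (X₄ ++ z ∷ [])
      x≁ = All.head (IPath-Anti (x ∷ []) arcZ)
      x′z : Arc x′ X₄ z
      x′z = IPath-++⁻ʳ (x ∷ []) arcZ
      t≁X₄ : All (NA t) X₄
      t≁X₄ = unattached (All¬⇒¬Any t≁′X₄) (λ t∈ → t∉X (∈-++⁺ʳ X₁ (there (there t∈))))
    -- The first and the last neighbour are not consecutive on `X`. The part `X₃` between them is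
    -- dropped, and the three paths meet in `t`.
    ... | X₃@(h ∷ X₃′) , x′ , X₄ , refl , t~x′ , t≁′X₄ = finish ((X₁ ++ x ∷ []) ++ reverse (x′ ∷ X₄))
      (point-SolidOn {V = L} {Y = X₁ ++ x ∷ []} {Z = reverse (x′ ∷ X₄)} vLt
        (IPath-snoc arcY (Last-++⁺ (y ∷ X₁) refl) (~-sym t~x)
          (inj₂ y≁t ∷ ++⁺ (All.map (inj₂ ∘ NA-sym) t≁X₁) (inj₁ refl ∷ [])))
        (Arc-reverse {p = x′ ∷ X₄} (step t~x′ (++⁺ t≁X₄ (NA-sym z≁t ∷ [])) x′z)) v~y v~z
        ((++⁺ (v≁ DX₁) (v≁D Dx ∷ []) ∷ All.map (λ (a , b) → ++⁺ a (b ∷ [])) (All.zip (LX₁ , L≁x))) , y≁L)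
        ((All-reverse (v≁ (Dx′ ∷ DX₄)) ∷ Anti-reverse (All.map (++⁻ʳ X₃) LX₂)) , z≁L)
        (Anti-reverse (All.map (++⁻ʳ X₃′) (IPath-Anti (y ∷ X₁ ++ x ∷ []) yX′)) ,
         All.map (λ nas → NA-sym (All.head (++⁻ʳ (X₃′ ++ x′ ∷ X₄) nas))) (IPath-Anti (X₁ ++ x ∷ []) Xz″))
        (y?z′ {L} id))
      (solve 7 (λ t v y z L Y Z → (t ⊕ v ⊕ y ⊕ z ⊕ L ⊕ Y ⊕ Z) ⊜ (v ⊕ y ⊕ z ⊕ (L ⊕ t) ⊕ (Y ⊕ Z))) ↭-refl
        (t ∷ []) (v ∷ []) (y ∷ []) (z ∷ []) L (X₁ ++ x ∷ []) (reverse (x′ ∷ X₄)))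
      (++⁺ (++⁺ DX₁ (Dx ∷ [])) (All-reverse (Dx′ ∷ DX₄)))
      where
      Dx′ = All.head (++⁻ʳ X₃ DX₂)
      DX₄ = All.tail (++⁻ʳ X₃ DX₂)
      yX′ : IPath ((y ∷ X₁ ++ x ∷ []) ++ h ∷ X₃′ ++ x′ ∷ X₄)
      yX′ = subst (λ L → IPath (y ∷ L)) (sym (++-assoc X₁ (x ∷ []) _)) yX
      Xz″ : IPath ((X₁ ++ x ∷ []) ++ h ∷ (X₃′ ++ x′ ∷ X₄) ++ z ∷ [])
      Xz″ = subst IPath (sym (++-assoc X₁ (x ∷ []) _)) Xz′
      x′z : Arc x′ X₄ z
      x′z = IPath-++⁻ʳ (x ∷ X₃) (subst (λ L → IPath (x ∷ L)) (++-assoc X₃ (x′ ∷ X₄) (z ∷ [])) arcZ)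
      t≁X₄ : All (NA t) X₄
      t≁X₄ = unattached (All¬⇒¬Any t≁′X₄) (λ t∈ → t∉X (∈-++⁺ʳ X₁ (there (∈-++⁺ʳ X₃ (there t∈)))))

  AttachedToD : Fin n → Set
  AttachedToD x = ∃ λ d → D d × x ~ d

  -- R is a path from w of which only the last vertex r has neighbours on X;
  -- if z has a neighbour on R, then R yields a path from w to z or to y
  -- that has a neighbour of the third vertex.
  detour : ∀ {y z w X q r} → v ~ y → v ~ z → v ~ w → y ≢ z → NA w y → NA w z → IPath (y ∷ X) → All D X →
    IPath (w ∷ q ++ r ∷ []) → All D (q ++ r ∷ []) → Anti (w ∷ q) X → r ∉ X → Attached r X →
    Attached z (q ++ r ∷ []) → SolidAround (y ∷ z ∷ w ∷ [])
  detour {y} {z} {w} {X} {q} {r} v~y v~z v~w y≢z w≁y w≁z yX DX wR DR wq≁X r∉X r~X z~R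
    with split-first (z ~?_) z~R
  ... | R₁ , x , R₂ , eqR , z≁′R₁ , z~x = go (attached? y (R₁ ++ x ∷ [])) (attached? y R₂) (split-first (r ~?_) r~X)
    where
    R₁x⊆ : ∀ {u} → u ∈ R₁ ++ x ∷ [] → u ∈ q ++ r ∷ []
    R₁x⊆ {u} u∈ = subst (u ∈_) (trans (++-assoc R₁ (x ∷ []) R₂) (sym eqR)) (∈-++⁺ˡ u∈)
    DR₁x : All D (R₁ ++ x ∷ [])
    DR₁x = tabulate λ u∈ → lookup DR (R₁x⊆ u∈)
    DR₁ = ++⁻ˡ R₁ DR₁x
    wR′ : IPath (w ∷ R₁ ++ x ∷ R₂)
    wR′ = subst (λ R → IPath (w ∷ R)) eqR wR
    wR₁x : Arc w R₁ x
    wR₁x = IPath-++⁻ˡ (w ∷ R₁) wR′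
    z≁R₁ : All (NA z) R₁
    z≁R₁ = unattached (All¬⇒¬Any z≁′R₁) (∉Ds v~z DR₁)
    swap-ends : SolidAround (w ∷ z ∷ y ∷ []) → SolidAround (y ∷ z ∷ w ∷ [])
    swap-ends = SolidAround-↭ (↭-trans (swap w z ↭-refl) (↭-trans (prep z (swap w y ↭-refl)) (swap z y ↭-refl)))
    rotate : SolidAround (w ∷ y ∷ z ∷ []) → SolidAround (y ∷ z ∷ w ∷ [])
    rotate = SolidAround-↭ (↭ₚ.++-comm (w ∷ []) (y ∷ z ∷ []))
    go : Dec (Attached y (R₁ ++ x ∷ [])) → Dec (Attached y R₂) →
         (∃₂ λ I₁ i → ∃ λ I₂ → X ≡ I₁ ++ i ∷ I₂ × All (λ u → ¬ r ~ u) I₁ × r ~ i) → SolidAround (y ∷ z ∷ w ∷ [])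
    -- The path from `w` along `R₁` and `x` to `z` contains a neighbour of `y`.
    go (yes y~R₁x) _ _ = swap-ends (hub v~w v~z v~y (≢-sym (proj₁ w≁y)) y≢z
      (IPath-snoc wR₁x (Last-++⁺ (w ∷ R₁) refl) (~-sym z~x)
        (inj₂ w≁z ∷ ++⁺ (All.map (inj₂ ∘ NA-sym) z≁R₁) (inj₁ refl ∷ [])))
      DR₁x y~R₁x)
    -- The first neighbour of `y` on `R` lies beyond `x`, so the path along `R` from `w` to `y`
    -- contains the neighbour `x` of `z`.
    go (no y≁R₁x) (yes y~R₂) _ with split-first (y ~?_) y~R₂
    ... | R₃ , x′ , R₄ , refl , y≁′R₃ , y~x′ = rotate (hub v~w v~y v~z (≢-sym (proj₁ w≁z)) (≢-sym y≢z)
      (IPath-snoc {w ∷ (R₁ ++ x ∷ R₃) ++ x′ ∷ []} wX₂ (Last-++⁺ (w ∷ R₁ ++ x ∷ R₃) refl) (~-sym y~x′)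
        (inj₂ w≁y ∷ ++⁺ (All.map (inj₂ ∘ NA-sym) y≁R₃) (inj₁ refl ∷ [])))
      DX₂ (lose (∈-++⁺ˡ (∈-++⁺ʳ R₁ (here refl))) z~x))
      where
      wX₂ : IPath (w ∷ (R₁ ++ x ∷ R₃) ++ x′ ∷ [])
      wX₂ = IPath-++⁻ˡ (w ∷ R₁ ++ x ∷ R₃) (subst (λ R → IPath (w ∷ R)) (sym (++-assoc R₁ (x ∷ R₃) (x′ ∷ R₄))) wR′)
      DX₂ : All D ((R₁ ++ x ∷ R₃) ++ x′ ∷ [])
      DX₂ = tabulate λ {u} u∈ → lookup DR (subst (u ∈_) (trans (++-assoc (R₁ ++ x ∷ R₃) (x′ ∷ []) R₄)
              (trans (++-assoc R₁ (x ∷ R₃) (x′ ∷ R₄)) (sym eqR))) (∈-++⁺ˡ u∈))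
      y≁R₃ : All (NA y) (R₁ ++ x ∷ R₃)
      y≁R₃ = unattached (λ a → [ (λ a₁ → y≁R₁x (Anyₚ.++⁺ˡ a₁)) , x-or-R₃ ]′ (Anyₚ.++⁻ R₁ a))
          (∉Ds v~y (++⁻ˡ (R₁ ++ x ∷ R₃) DX₂))
        where
        x-or-R₃ : ¬ Attached y (x ∷ R₃)
        x-or-R₃ (here y~x)   = y≁R₁x (Anyₚ.++⁺ʳ R₁ (here y~x))
        x-or-R₃ (there y~R₃) = All¬⇒¬Any y≁′R₃ y~R₃
    -- Here `y` sees nothing on `R`. The path runs along all of `R`, enters `X` at the first
    -- neighbour `i` of `r` and goes back along `X` to `y`.
    go (no y≁R₁x) (no y≁R₂) (I₁ , i , I₂ , refl , r≁′I₁ , r~i) =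
        rotate (hub v~w v~y v~z (≢-sym (proj₁ w≁z)) (≢-sym y≢z)
      arc (++⁺ DR (All-reverse DI₁i)) (Anyₚ.++⁺ˡ z~R))
      where
      DI₁i : All D (I₁ ++ i ∷ [])
      DI₁i = ++⁺ (++⁻ˡ I₁ DX) (All.head (++⁻ʳ I₁ DX) ∷ [])
      back : Arc i (reverse I₁) y
      back = Arc-reverse {p = I₁} (IPath-++⁻ˡ (y ∷ I₁) yX)
      y≁R : All (NA y) (q ++ r ∷ [])
      y≁R = unattached (λ a → [ y≁R₁x , y≁R₂ ]′
          (Anyₚ.++⁻ (R₁ ++ x ∷ []) (subst (Attached y) (trans eqR (sym (++-assoc R₁ (x ∷ []) R₂))) a)))
              (∉Ds v~y DR)
      anti : Anti (w ∷ q) (i ∷ reverse I₁ ++ y ∷ [])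
      anti = tabulate λ u∈ → near (lookup wq≁X u∈) (lookup wq≁y u∈)
        where
        wq≁y : All (λ u → NA u y) (w ∷ q)
        wq≁y = w≁y ∷ All.map NA-sym (++⁻ˡ q y≁R)
        near : ∀ {u} → All (NA u) (I₁ ++ i ∷ I₂) → NA u y → All (NA u) (i ∷ reverse I₁ ++ y ∷ [])
        near nas na = All.head (++⁻ʳ I₁ nas) ∷ ++⁺ (All-reverse (++⁻ˡ I₁ nas)) (na ∷ [])
      joined : IPath ((w ∷ q) ++ r ∷ i ∷ reverse I₁ ++ y ∷ [])
      joined = IPath-link (w ∷ q) wR r~i back anti
        (++⁺ (All-reverse (unattached (All¬⇒¬Any r≁′I₁) (r∉X ∘ ∈-++⁺ˡ))) (NA-sym (All.head (++⁻ʳ q y≁R)) ∷ []))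
      arc : Arc w ((q ++ r ∷ []) ++ reverse (I₁ ++ i ∷ [])) y
      arc = subst (λ L → IPath (w ∷ L)) eq joined
        where
        eq : q ++ r ∷ i ∷ reverse I₁ ++ y ∷ [] ≡ ((q ++ r ∷ []) ++ reverse (I₁ ++ i ∷ [])) ++ y ∷ []
        eq = trans (sym (++-assoc q (r ∷ []) _))
            (trans (cong (λ I → (q ++ r ∷ []) ++ I ++ y ∷ []) (sym (reverse-++ I₁ (i ∷ []))))
               (sym (++-assoc (q ++ r ∷ []) (reverse (I₁ ++ i ∷ [])) (y ∷ []))))

  -- A path from `y` through `D` is stopped at its first vertex in `D` that sees `z`. If `y ~ z`,
  -- the whole path from `y` to `z` has that edge as a chord, so only its two overlapping halves are
  -- induced in general.
  connect : ∀ {y z} → v ~ y → v ~ z → y ≢ z → AttachedToD y → AttachedToD z →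
            ∃₂ λ p s → IPath (y ∷ p ++ s ∷ []) × IPath ((p ++ s ∷ []) ++ z ∷ []) × All D (p ++ s ∷ []) ×
                       (¬ y ~ z → Arc y (p ++ s ∷ []) z)
  connect {y} {z} v~y v~z y≢z (dy , Ddy , y~dy) (dz , Ddz , z~dz)
    with approach (z ~?_) (∉D v~y) y~dy Ddy (conn Ddy Ddz) z~dz
  ... | p , s , yX , Dp , Ds , z≁p , z~s =
    p , s , yX , IPath-snoc (tail p yX) (Last-++⁺ p refl) (~-sym z~s) ends , ++⁺ Dp (Ds ∷ []) ,
    λ y≁z → IPath-snoc yX (Last-++⁺ (y ∷ p) refl) (~-sym z~s) (inj₂ (y≢z , y≁z) ∷ ends)
    where
    ends : All (λ x → x ≡ s ⊎ NA x z) (p ++ s ∷ [])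
    ends = ++⁺ (All.map (inj₂ ∘ NA-sym) (unattached (All¬⇒¬Any z≁p) (∉Ds v~z Dp))) (inj₁ refl ∷ [])
    tail : ∀ p → IPath (y ∷ p ++ s ∷ []) → IPath (p ++ s ∷ [])
    tail []      (step _ _ π) = π
    tail (_ ∷ _) (step _ _ π) = π

  -- If `w` sees the path `X` between `y` and `z`, `junction` or `hub` applies directly. Otherwise
  -- `w` is joined to `X` by a path `R` through `D`. If neither `y` nor `z` sees `R`, this is a
  -- junction; if one does, a detour, with `X` reversed when that one is `y` and not `z`.
  tripod : ∀ {y z w} → v ~ y → v ~ z → v ~ w → y ≢ z → AttachedToD y → AttachedToD z → AttachedToD w →
           NA w y → NA w z → SolidAround (y ∷ z ∷ w ∷ [])
  tripod {y} {z} {w} v~y v~z v~w y≢z y~D z~D (dw , Ddw , w~dw) w≁y w≁z with connect v~y v~z y≢z y~D z~D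
  ... | p , s , yX , Xz , DX , arc = go (attached? w X)
    where
    X = p ++ s ∷ []
    Ds = lookup DX (∈-++⁺ʳ p (here refl))
    near? : ∀ u → Dec (Any (λ x → u ≡ x ⊎ u ~ x) X)
    near? u = Any.any? (λ x → (u Finₚ.≟ x) ⊎-dec (u ~? x)) X

    go : Dec (Attached w X) → SolidAround (y ∷ z ∷ w ∷ [])
    go (yes w~X) with y ~? z
    ... | yes y~z = junction {L = []} v~y v~z yX Xz DX (step v~w [] [ w ]) refl [] []
      (NA-sym w≁y ∷ []) (NA-sym w≁z ∷ []) (∉Ds v~w DX) w~X (inj₁ y~z)
    ... | no y≁z  = hub v~y v~z v~w (proj₁ w≁y) (proj₁ w≁z) (arc y≁z) DX w~X
    go (no w≁X) with approach near? (∉D v~w) w~dw Ddw (conn Ddw Ds) (lose (∈-++⁺ʳ p (here refl)) (inj₁ refl))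
    ... | q , r , wR , Dq , Dr , ¬near , near = route-to-X (attached? z (q ++ r ∷ [])) (attached? y (q ++ r ∷ []))
      where
      DR : All D (q ++ r ∷ [])
      DR = ++⁺ Dq (Dr ∷ [])
      wq≁X : Anti (w ∷ q) X
      wq≁X = unattached w≁X (∉Ds v~w DX) ∷
             All.map (λ far → tabulate λ x∈ → (λ eq → far (lose x∈ (inj₁ eq))) , λ u~x →
                 far (lose x∈ (inj₂ u~x))) ¬near
      r∉X : r ∉ X
      r∉X r∈X with predecessor (w ∷ q) wR refl (∈-++⁺ʳ (w ∷ q) (here refl))
      ... | inj₁ refl = ∉D v~w Dr
      ... | inj₂ r~wq with find r~wq
      ...   | u , u∈ , r~u = proj₂ (lookup (lookup wq≁X u∈) r∈X) (~-sym r~u)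
      r~X : Attached r X
      r~X with find near
      ... | x , x∈ , inj₁ refl = contradiction x∈ r∉X
      ... | x , x∈ , inj₂ r~x  = lose x∈ r~x
      y?z : y ~ z ⊎ NA y z × 1 ≤ⁿ length (w ∷ q)
      y?z with y ~? z
      ... | yes y~z = inj₁ y~z
      ... | no y≁z  = inj₂ ((y≢z , y≁z) , s≤s z≤n)
      route-to-X : Dec (Attached z (q ++ r ∷ [])) → Dec (Attached y (q ++ r ∷ [])) → SolidAround (y ∷ z ∷ w ∷ [])
      route-to-X (yes z~R) _ = detour v~y v~z v~w y≢z w≁y w≁z yX DX wR DR wq≁X r∉X r~X z~R
      route-to-X (no _) (yes y~R) = SolidAround-↭ (swap z y ↭-refl)
        (detour v~z v~y v~w (≢-sym y≢z) w≁z w≁y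
          (subst IPath (reverse-++ X (z ∷ [])) (IPath-reverse Xz)) (All-reverse DX) wR DR
          (Anti-reverse wq≁X) (r∉X ∘ Anyₚ.reverse⁻) (Anyₚ.reverse⁺ r~X) y~R)
      route-to-X (no z≁R) (no y≁R) = junction {L = w ∷ q} v~y v~z yX Xz DX (step v~w (v≁ DR) wR) refl DR wq≁X
        (NA-sym w≁y ∷ unattached y≁R (∉Ds v~y DR)) (NA-sym w≁z ∷ unattached z≁R (∉Ds v~z DR)) r∉X r~X
        y?z

  -- The path through `D` from `y` to `z` closes with `v` to an induced cycle on which `w` has the
  -- spokes `v`, `y` and `z`.
  centre : ∀ {y z w} → v ~ y → v ~ z → v ~ w → y ≢ z → AttachedToD y → AttachedToD z → ¬ y ~ z → w ~ y → w ~ z →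
           SolidAround (y ∷ z ∷ w ∷ [])
  centre {y} {z} {w} v~y v~z v~w y≢z y~D z~D y≁z w~y w~z with connect v~y v~z y≢z y~D z~D
  ... | p , s , _ , _ , DX , arc = solidAround X
    (pyramid-SolidOn (arc y≁z , v~y , v~z , v≁ DX) w∉ (here refl) (there (here refl))
        (there (there (∈-++⁺ʳ X (here refl))))
      (~-sym v~w) w~y w~z (~⇒≢ v~y) (~⇒≢ v~z) y≢z)
    (solve 5 (λ v y z w X → (w ⊕ v ⊕ y ⊕ X ⊕ z) ⊜ ((v ⊕ y ⊕ z ⊕ w) ⊕ X)) ↭-refl (v ∷ []) (y ∷ []) (z ∷ [])
        (w ∷ []) X)
    DX
    where
    X = p ++ s ∷ []
    w∉ : w ∉ v ∷ y ∷ X ++ z ∷ []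
    w∉ (here w≡v)         = ~⇒≢ v~w (sym w≡v)
    w∉ (there (here w≡y)) = ~⇒≢ w~y w≡y
    w∉ (there (there w∈)) with ∈-++⁻ X w∈
    ... | inj₁ w∈X        = ∉Ds v~w DX w∈X
    ... | inj₂ (here w≡z) = ~⇒≢ w~z w≡z

  module _ {N : Pred (Fin n) 0ℓ} (N⇒~ : ∀ {x} → N x → v ~ x)
           (good : ∀ {x} → N x → (∃ λ d → D d × x ~ d) ⊎ (∀ {u} → N u → u ≢ x → x ~ u)) where
    private
      -- A nonadjacent pair of neighbours of `v` rules out the second alternative of `good`.
      attached : ∀ {x u} → N x → N u → u ≢ x → ¬ x ~ u → AttachedToD x
      attached Nx Nu u≢x x≁u = [ id , (λ all → contradiction (all Nu u≢x) x≁u) ]′ (good Nx)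

      spread : ∀ {y z w} → N y → N z → N w → y ≢ z → y ≢ w → z ≢ w → AttachedToD y → AttachedToD z →
               ¬ w ~ y → ¬ w ~ z → SolidAround (y ∷ z ∷ w ∷ [])
      spread Ny Nz Nw y≢z y≢w z≢w y~D z~D w≁y w≁z = tripod (N⇒~ Ny) (N⇒~ Nz) (N⇒~ Nw) y≢z y~D z~D
        (attached Nw Ny y≢w w≁y) (≢-sym y≢w , w≁y) (≢-sym z≢w , w≁z)

      flip : ∀ {x y} → ¬ x ~ y → ¬ y ~ x
      flip x≁y y~x = x≁y (~-sym y~x)

    -- Cases by the edges among the three vertices. Three edges make a complete graph on four
    -- vertices, a pyramid over a triangle; two edges have a common vertex, the `centre`; with at
    -- most one edge some vertex is nonadjacent to the other two, and `tripod` applies.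
    triple-SolidAround : ∀ {a b c} → N a → N b → N c → a ≢ b → a ≢ c → b ≢ c → SolidAround (a ∷ b ∷ c ∷ [])
    triple-SolidAround {a} {b} {c} Na Nb Nc a≢b a≢c b≢c with a ~? b | a ~? c | b ~? c
    ... | yes a~b | yes a~c | yes b~c = solidAround []
      (pyramid-SolidOn {p = []} (step a~b [] [ b ] , N⇒~ Na , N⇒~ Nb , []) c∉
        (here refl) (there (here refl)) (there (there (here refl))) (~-sym (N⇒~ Nc)) (~-sym a~c) (~-sym b~c)
        (~⇒≢ (N⇒~ Na)) (~⇒≢ (N⇒~ Nb)) a≢b)
      (↭ₚ.++-comm (c ∷ []) (v ∷ a ∷ b ∷ [])) []
      where
      c∉ : c ∉ v ∷ a ∷ b ∷ []
      c∉ (here refl)                 = ~⇒≢ (N⇒~ Nc) refl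
      c∉ (there (here refl))         = a≢c refl
      c∉ (there (there (here refl))) = b≢c refl
    ... | yes a~b | yes a~c | no b≁c = SolidAround-↭ (↭ₚ.++-comm (b ∷ c ∷ []) (a ∷ []))
      (centre (N⇒~ Nb) (N⇒~ Nc) (N⇒~ Na) b≢c (attached Nb Nc (≢-sym b≢c) b≁c) (attached Nc Nb b≢c (flip b≁c))
          b≁c a~b a~c)
    ... | yes a~b | no a≁c | yes b~c = SolidAround-↭ (prep a (swap c b ↭-refl))
      (centre (N⇒~ Na) (N⇒~ Nc) (N⇒~ Nb) a≢c (attached Na Nc (≢-sym a≢c) a≁c) (attached Nc Na a≢c (flip a≁c))
          a≁c (~-sym a~b) b~c)
    ... | no a≁b | yes a~c | yes b~c =
      centre (N⇒~ Na) (N⇒~ Nb) (N⇒~ Nc) a≢b (attached Na Nb (≢-sym a≢b) a≁b) (attached Nb Na a≢b (flip a≁b))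
          a≁b (~-sym a~c) (~-sym b~c)
    ... | no a≁b | yes a~c | no b≁c = SolidAround-↭ (prep a (swap c b ↭-refl))
      (spread Na Nc Nb a≢c a≢b (≢-sym b≢c) (attached Na Nb (≢-sym a≢b) a≁b) (attached Nc Nb b≢c (flip b≁c))
          (flip a≁b) b≁c)
    ... | no a≁b | no a≁c | yes b~c = SolidAround-↭ (↭ₚ.++-comm (b ∷ c ∷ []) (a ∷ []))
      (spread Nb Nc Na b≢c (≢-sym a≢b) (≢-sym a≢c) (attached Nb Na a≢b (flip a≁b))
          (attached Nc Na a≢c (flip a≁c)) a≁b a≁c)
    ... | _ | no a≁c | no b≁c =
      spread Na Nb Nc a≢b a≢c b≢c (attached Na Nc (≢-sym a≢c) a≁c) (attached Nb Nc (≢-sym b≢c) b≁c)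
          (flip a≁c) (flip b≁c)

-- The vertex to be deleted: its existence and the solids of degree 3 at it.

module Elimination {n : ℕ} (G : Graph n) where
  open Graph G
  open InducedPaths G
  open Subsets

  -- For empty `D` this is the usual notion: the neighbours of `v` in `W` form a clique.
  record Simplicial (W : Subset n) : Set where
    field
      v    : Fin n
      v∈W  : v ∈ˢ W
      D    : Subset n
      D⊆W  : ∀ {d} → d ∈ˢ D → d ∈ˢ W
      v≁D  : ∀ {d} → d ∈ˢ D → NA v d
      conn : Conn (_∈ˢ D)
      good : ∀ {x} → x ∈ˢ W → v ~ x → (∃ λ d → d ∈ˢ D × x ~ d) ⊎ (∀ {u} → u ∈ˢ W → v ~ u → u ≢ x → x ~ u)

  module _ {W : Subset n} (simplicial : Simplicial W) where
    open Simplicial simplicial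
    open At G v W
    open Triples G v≁D conn using (triple-SolidAround)

    solids₃ : List (Subset n)
    solids₃ = filter (tracedSolid? 3) (subsets n)

    -- Every three-element set of neighbours is the trace of a solid, so `trace` maps `solids₃` onto
    -- these sets.
    triples-bound : ∣ trace W ∣ C 3 ≤ⁿ length solids₃
    triples-bound = subst (_≤ⁿ length solids₃) (count-ofSize 3 (trace W))
      (subst (length (filter (ofSize? 3 (trace W)) (subsets n)) ≤ⁿ_) (length-map trace solids₃)
        (Counting.Unique-⊆⇒length≤ (Uniqueₚ.filter⁺ (ofSize? 3 (trace W)) (subsets-Unique n))
          λ T∈ → realised _ (proj₂ (∈-filter⁻ (ofSize? 3 (trace W)) {xs = subsets n} T∈))))
      where
      good-trace : ∀ {x} → x ∈ˢ trace W →
                   (∃ λ d → d ∈ˢ D × x ~ d) ⊎ (∀ {u} → u ∈ˢ trace W → u ≢ x → x ~ u)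
      good-trace x∈ with ∈-trace⁻ {W} x∈
      ... | x∈W , v~x with good x∈W v~x
      ...   | inj₁ seen = inj₁ seen
      ...   | inj₂ all  = inj₂ λ u∈ → let u∈W , v~u = ∈-trace⁻ {W} u∈ in all u∈W v~u
      realised : ∀ T → OfSize 3 (trace W) T → T ∈ map trace solids₃
      realised T (T⊆ , size) = of-elems (elems T) (trans (length-elems T) size) (elems-Unique T) (≈-elems T)
        where
        of-elems : ∀ xs → length xs ≡ 3 → Unique xs → T ≈ xs → T ∈ map trace solids₃
        of-elems (a ∷ b ∷ c ∷ []) _ u@((a≢b ∷ a≢c ∷ []) ∷ (b≢c ∷ []) ∷ _) T≈
          with triple-SolidAround {N = _∈ˢ trace W} (proj₂ ∘ ∈-trace⁻ {W})
                 good-trace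
                 (in-trace (here refl)) (in-trace (there (here refl))) (in-trace (there (there (here refl))))
                     a≢b a≢c b≢c
          where
          in-trace : ∀ {x} → x ∈ a ∷ b ∷ c ∷ [] → x ∈ˢ trace W
          in-trace x∈ = T⊆ (Equivalence.from (T≈ _) x∈)
        ... | S , solid , v∈S ∷ abc∈S , S⊆ =
          subst (_∈ map trace solids₃) trace-S≡T
            (∈-map⁺ trace (∈-filter⁺ (tracedSolid? 3) (∈-subsets S) ((solid , v∈S , S⊆W) , ∣≈∣ trace-S≈ u)))
          where
          abc⊆trace : ∀ {x} → x ∈ a ∷ b ∷ c ∷ [] → x ∈ˢ W × v ~ x
          abc⊆trace x∈ = ∈-trace⁻ {W} (T⊆ (Equivalence.from (T≈ _) x∈))
          S⊆W : S ⊆ W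
          S⊆W x∈ with S⊆ x∈
          ... | inj₁ (here refl) = v∈W
          ... | inj₁ (there x∈)  = proj₁ (abc⊆trace x∈)
          ... | inj₂ x∈D         = D⊆W x∈D
          trace-S≈ : trace S ≈ a ∷ b ∷ c ∷ []
          trace-S≈ = trace-≈ (λ x∈ → lookup abc∈S x∈ , proj₂ (abc⊆trace x∈)) from
            where
            from : ∀ {x} → x ∈ˢ S → v ~ x → x ∈ a ∷ b ∷ c ∷ []
            from x∈ v~x with S⊆ x∈
            ... | inj₁ (here refl) = contradiction v~x (~-irr refl)
            ... | inj₁ (there x∈)  = x∈
            ... | inj₂ x∈D         = contradiction v~x (proj₂ (v≁D x∈D))
          trace-S≡T : trace S ≡ T
          trace-S≡T = trans (≈⇒≡ trace-S≈) (sym (≈⇒≡ T≈))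

  Walk-map : ∀ {D E : Pred (Fin n) 0ℓ} → (∀ {x} → D x → E x) → ∀ {x y} → Walk D x y → Walk E x y
  Walk-map f ε               = ε
  Walk-map f ((e , Dy) ◅ w)  = (e , f Dy) ◅ Walk-map f w

  private
    Seen : Subset n → Fin n → Set
    Seen D w = ∃ λ d → d ∈ˢ D × w ~ d

    seen? : ∀ D w → Dec (Seen D w)
    seen? D w = Finₚ.any? λ d → (d ∈ˢ? D) ×-dec (w ~? d)

    Away : Subset n → Subset n → Fin n → Set
    Away W D w = w ∈ˢ W × w ∉ˢ D × ¬ Seen D w

    away? : ∀ W D w → Dec (Away W D w)
    away? W D w = (w ∈ˢ? W) ×-dec ¬? (w ∈ˢ? D) ×-dec ¬? (seen? D w)

    Border : Subset n → Subset n → Fin n → Set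
    Border W D w = w ∈ˢ W × w ∉ˢ D × Seen D w

    border? : ∀ W D w → Dec (Border W D w)
    border? W D w = (w ∈ˢ? W) ×-dec ¬? (w ∈ˢ? D) ×-dec seen? D w

    ∪-conn : ∀ {D : Subset n} {b d} → Conn (_∈ˢ D) → d ∈ˢ D → b ~ d → Conn (_∈ˢ D ∪ ⁅ b ⁆)
    ∪-conn {D} {b} {d} conn d∈ b~d x∈ y∈ = go (x∈p∪q⁻ D _ x∈) (x∈p∪q⁻ D _ y∈)
      where
      D⊆ : ∀ {x} → x ∈ˢ D → x ∈ˢ D ∪ ⁅ b ⁆
      D⊆ x∈ = x∈p∪q⁺ (inj₁ x∈)
      b∈ : b ∈ˢ D ∪ ⁅ b ⁆
      b∈ = x∈p∪q⁺ (inj₂ (x∈⁅x⁆ b))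
      go : ∀ {x y} → x ∈ˢ D ⊎ x ∈ˢ ⁅ b ⁆ → y ∈ˢ D ⊎ y ∈ˢ ⁅ b ⁆ → Walk (_∈ˢ D ∪ ⁅ b ⁆) x y
      go (inj₁ x∈) (inj₁ y∈) = Walk-map D⊆ (conn x∈ y∈)
      go (inj₁ x∈) (inj₂ y∈) with x∈⁅y⁆⇒x≡y b y∈
      ... | refl = Walk-map D⊆ (conn x∈ d∈) ◅◅ ((~-sym b~d , b∈) ◅ ε)
      go (inj₂ x∈) (inj₁ y∈) with x∈⁅y⁆⇒x≡y b x∈
      ... | refl = (b~d , D⊆ d∈) ◅ Walk-map D⊆ (conn d∈ y∈)
      go (inj₂ x∈) (inj₂ y∈) with x∈⁅y⁆⇒x≡y b x∈ | x∈⁅y⁆⇒x≡y b y∈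
      ... | refl | refl = ε

    -- The neighbours of `v` in `W` are away from `D` or on its border. If `D₁` is nonempty it can
    -- be kept, since every border vertex sees it. If `D₁` is empty, `D` takes its place: border
    -- vertices see `D`, and the away neighbours of `v`, adjacent to all others away, are adjacent
    -- to the border as well.
    lift : ∀ {W D : Subset n} → (∀ {d} → d ∈ˢ D → d ∈ˢ W) → Conn (_∈ˢ D) → ∀ {d₀} → d₀ ∈ˢ D →
           (∀ {x b} → Away W D x → Border W D b → x ~ b) → Simplicial ⟪ away? W D ⟫ → Simplicial W
    lift {W} {D} D⊆W conn d₀∈ complete inner = choose (nonempty? D₁)
      where
      open Simplicial inner renaming (D to D₁; v∈W to v∈X; D⊆W to D₁⊆X; v≁D to v≁D₁; conn to conn₁; good to good₁)
      away : ∀ {x} → x ∈ˢ ⟪ away? W D ⟫ → Away W D x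
      away = ∈⟪⟫⁻ (away? W D)
      side : ∀ {x} → x ∈ˢ W → v ~ x → Away W D x ⊎ Border W D x
      side {x} x∈ v~x with seen? D x
      ... | yes s = inj₂ (x∈ , (λ x∈D → proj₂ (proj₂ (away v∈X)) (x , x∈D , v~x)) , s)
      ... | no ¬s = inj₁ (x∈ , (λ x∈D → proj₂ (proj₂ (away v∈X)) (x , x∈D , v~x)) , ¬s)
      universal : ∀ {x} → Away W D x → (∀ {u} → u ∈ˢ ⟪ away? W D ⟫ → v ~ u → u ≢ x → x ~ u) →
                  ∀ {u} → u ∈ˢ W → v ~ u → u ≢ x → x ~ u
      universal ax all u∈ v~u u≢x with side u∈ v~u
      ... | inj₁ au = all (∈⟪⟫⁺ (away? W D) au) v~u u≢x
      ... | inj₂ bu = complete ax bu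
      choose : Dec (Nonempty D₁) → Simplicial W
      choose (yes (d₁ , d₁∈)) = record
        { v = v ; v∈W = proj₁ (away v∈X) ; D = D₁ ; D⊆W = λ d∈ → proj₁ (away (D₁⊆X d∈)) ; v≁D = v≁D₁ ; conn = conn₁
        ; good = λ x∈ v~x → [ (λ ax → [ inj₁ , inj₂ ∘ universal ax ]′ (good₁ (∈⟪⟫⁺ (away? W D) ax) v~x))
                            , (λ bx → inj₁ (d₁ , d₁∈ , ~-sym (complete (away (D₁⊆X d₁∈)) bx))) ]′ (side x∈ v~x) }
      choose (no empty) = record
        { v = v ; v∈W = proj₁ (away v∈X) ; D = D ; D⊆W = D⊆W ; conn = conn
        ; v≁D = λ {d} d∈ → (λ { refl → proj₁ (proj₂ (away v∈X)) d∈ }) , λ v~d →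
            proj₂ (proj₂ (away v∈X)) (d , d∈ , v~d)
        ; good = λ x∈ v~x → [ (λ ax → [ (λ (d , d∈ , _) → contradiction (d , d∈) empty) , inj₂ ∘ universal ax ]′
                                         (good₁ (∈⟪⟫⁺ (away? W D) ax) v~x))
                            , (λ bx → inj₁ (proj₂ (proj₂ bx))) ]′ (side x∈ v~x) }

    -- In a clique any vertex will do, with `D` empty. Otherwise a nonadjacent pair `x`, `d` starts
    -- the growth from the single vertex `d`, with `x` away from it.
    simplicial-in : ∀ m W → ∣ W ∣ ≤ⁿ m → ∀ {w} → w ∈ˢ W → Simplicial W

    -- Grow the connected set D until the vertices away from it are complete to
    -- its border, then recurse into them.
    grow : ∀ m k W D → ∣ W ∣ ≤ⁿ suc m → n ≤ⁿ k +ⁿ ∣ D ∣ → (∀ {d} → d ∈ˢ D → d ∈ˢ W) → Conn (_∈ˢ D) →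
           ∀ {d₀ x₀} → d₀ ∈ˢ D → Away W D x₀ → Simplicial W
    grow m k W D ∣W∣≤ fuel D⊆W conn {d₀} {x₀} d₀∈ ax₀
      with Finₚ.any? (λ x → Finₚ.any? λ b → away? W D x ×-dec border? W D b ×-dec ¬? (x ~? b))
    ... | no none = lift D⊆W conn d₀∈ complete
                      (simplicial-in m ⟪ away? W D ⟫ (s≤s⁻¹ (≤-trans smaller ∣W∣≤)) (∈⟪⟫⁺ (away? W D) ax₀))
      where
      complete : ∀ {x b} → Away W D x → Border W D b → x ~ b
      complete {x} {b} ax bb with x ~? b
      ... | yes x~b = x~b
      ... | no x≁b  = contradiction (x , b , ax , bb , x≁b) none
      smaller : ∣ ⟪ away? W D ⟫ ∣ <ⁿ ∣ W ∣
      smaller = p⊂q⇒∣p∣<∣q∣ ((λ x∈ → proj₁ (∈⟪⟫⁻ (away? W D) x∈)) ,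
                  d₀ , D⊆W d₀∈ , λ d₀∈X → proj₁ (proj₂ (∈⟪⟫⁻ (away? W D) d₀∈X)) d₀∈)
    -- Without fuel `D` would contain all vertices, but `x` lies outside it.
    grow m zero W D _ fuel _ _ _ _ | yes (x , b , (x∈W , x∉D , _) , _) =
      contradiction (≤-trans (p⊂q⇒∣p∣<∣q∣ (⊆-max D , x , ∈⊤ , x∉D)) (∣p∣≤n ⊤))
                    (≤⇒≯ fuel)
    -- The border vertex `b` is not adjacent to `x`, so adding it leaves `x` away from `D`; having a
    -- neighbour in `D`, it also keeps `D` connected.
    grow m (suc k) W D ∣W∣≤ fuel D⊆W conn d₀∈ _ | yes
        (x , b , (x∈W , x∉D , x≁D) , (b∈W , b∉D , d , d∈ , b~d) , x≁b) =
      grow m k W (D ∪ ⁅ b ⁆) ∣W∣≤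
        (≤-trans fuel (≤-trans (≤-reflexive (sym (+-suc k ∣ D ∣))) (+-monoʳ-≤ k larger)))
        (λ d∈ → [ D⊆W , (λ d∈b → subst (_∈ˢ W) (sym (x∈⁅y⁆⇒x≡y b d∈b)) b∈W) ]′ (x∈p∪q⁻ D _ d∈))
        (∪-conn conn d∈ b~d) (x∈p∪q⁺ (inj₁ d₀∈))
        (x∈W , (λ x∈ → [ x∉D , (λ x∈b → x≢b (x∈⁅y⁆⇒x≡y b x∈b)) ]′ (x∈p∪q⁻ D _ x∈)) ,
         λ (e , e∈ , x~e) → [ (λ e∈D → x≁D (e , e∈D , x~e)) ,
                              (λ e∈b → x≁b (subst (x ~_) (x∈⁅y⁆⇒x≡y b e∈b) x~e)) ]′ (x∈p∪q⁻ D _ e∈))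
      where
      x≢b : x ≢ b
      x≢b refl = x≁D (d , d∈ , b~d)
      larger : ∣ D ∣ <ⁿ ∣ D ∪ ⁅ b ⁆ ∣
      larger = p⊂q⇒∣p∣<∣q∣ (p⊆p∪q ⁅ b ⁆ , b , x∈p∪q⁺ (inj₂ (x∈⁅x⁆ b)) , b∉D)

    simplicial-in zero W ∣W∣≤ w∈ = contradiction (≤-trans (x∈p⇒∣p-x∣<∣p∣ w∈) ∣W∣≤) λ ()
    simplicial-in (suc m) W ∣W∣≤ {w} w∈
      with Finₚ.any? (λ x → Finₚ.any? λ d → (x ∈ˢ? W) ×-dec (d ∈ˢ? W) ×-dec ¬? (x Finₚ.≟ d) ×-dec ¬? (x ~? d))
    ... | yes (x , d , x∈ , d∈ , x≢d , x≁d) =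
      grow m n W ⁅ d ⁆ ∣W∣≤ (m≤m+n n _) (λ e∈ → subst (_∈ˢ W) (sym (x∈⁅y⁆⇒x≡y d e∈)) d∈)
        single (x∈⁅x⁆ d)
        (x∈ , (λ x∈d → x≢d (x∈⁅y⁆⇒x≡y d x∈d)) ,
         λ (e , e∈ , x~e) → x≁d (subst (x ~_) (x∈⁅y⁆⇒x≡y d e∈) x~e))
      where
      single : Conn (_∈ˢ ⁅ d ⁆)
      single x∈ y∈ with x∈⁅y⁆⇒x≡y d x∈ | x∈⁅y⁆⇒x≡y d y∈
      ... | refl | refl = ε
    ... | no clique = record
      { v = w ; v∈W = w∈ ; D = ∅ ; D⊆W = λ d∈ → contradiction d∈ ∉⊥ ; v≁D = λ d∈ → contradiction d∈ ∉⊥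
      ; conn = λ x∈ → contradiction x∈ ∉⊥
      ; good = λ {x} x∈ _ → inj₂ λ {u} u∈ _ u≢x → adjacent x∈ u∈ (≢-sym u≢x) }
      where
      adjacent : ∀ {x u} → x ∈ˢ W → u ∈ˢ W → x ≢ u → x ~ u
      adjacent {x} {u} x∈ u∈ x≢u with x ~? u
      ... | yes x~u = x~u
      ... | no x≁u  = contradiction (x , u , x∈ , u∈ , x≢u , x≁u) clique

  simplicial-exists : ∀ {W w} → w ∈ˢ W → Simplicial W
  simplicial-exists {W} = simplicial-in n W (∣p∣≤n W)

-- Binomial identities.

module Binomials where
  open import Data.Nat using (_+_; _≤_)
  open Subsets using (nC0≡1)

  pascal : ∀ n k → suc n C suc k ≡ n C k + n C suc k
  pascal n k = sym (nCk+nC[k+1]≡[n+1]C[k+1] n k)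

  C-monoˡ-≤ : ∀ k {m n} → m ≤ n → m C k ≤ n C k
  C-monoˡ-≤ zero    {m} {n} _ = ≤-reflexive (trans (nC0≡1 m) (sym (nC0≡1 n)))
  C-monoˡ-≤ (suc k) z≤n     = z≤n
  C-monoˡ-≤ (suc k) {suc m} {suc n} (s≤s m≤n) = begin
    suc m C suc k       ≡⟨ pascal m k ⟩
    m C k + m C suc k   ≤⟨ +-mono-≤ (C-monoˡ-≤ k m≤n) (C-monoˡ-≤ (suc k) m≤n) ⟩
    n C k + n C suc k   ≡⟨ pascal n k ⟨
    suc n C suc k       ∎
    where open ℕₚ.≤-Reasoning

  -- The gain of a deletion at degree `suc d`, with the negative terms moved across to stay in the
  -- natural numbers.
  C-alternating₃ : ∀ d → suc d C 3 + suc d ≡ suc d C 2 + 1 + d C 3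
  C-alternating₃ d rewrite pascal d 2 | pascal d 1 | nC1≡n d = eq d (d C 2) (d C 3)
    where
    eq : ∀ d c₂ c₃ → c₂ + c₃ + suc d ≡ d + c₂ + 1 + c₃
    eq = solve-∀

  C-alternating₄ : ∀ k → suc k C 4 + suc k C 2 + 1 ≡ suc k C 3 + suc k C 1 + k C 4
  C-alternating₄ k rewrite pascal k 3 | pascal k 2 | pascal k 1 | pascal k 0 | nC1≡n k | nC0≡1 k =
      eq k (k C 2) (k C 3) (k C 4)
    where
    eq : ∀ k c₂ c₃ c₄ → c₃ + c₄ + (k + c₂) + 1 ≡ c₂ + c₃ + (1 + k) + c₄
    eq = solve-∀

-- Counts and colourings relative to a vertex set.

module Measures {n : ℕ} (G : Graph n) where
  open import Data.Nat using (_+_; _≤_; _<_)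
  open Graph G
  open Subsets
  open Counting

  CycleIn SolidIn : Subset n → Subset n → Set
  CycleIn W S = InducedCycle G S × S ⊆ W
  SolidIn W S = InducedSolid G S × S ⊆ W

  EdgeIn : Subset n → Fin n × Fin n → Set
  EdgeIn W (u , w) = (u <ᶠ w × u ~ w) × u ∈ˢ W × w ∈ˢ W

  abstract
    cycleIn? : ∀ W → Decidable (CycleIn W)
    cycleIn? W S = inducedCycle? G S ×-dec (S ⊆? W)

    solidIn? : ∀ W → Decidable (SolidIn W)
    solidIn? W S = inducedSolid? G S ×-dec (S ⊆? W)

    edgeIn? : ∀ W → Decidable (EdgeIn W)
    edgeIn? W (u , w) = ((u <ᶠ? w) ×-dec (u ~? w)) ×-dec (u ∈ˢ? W) ×-dec (w ∈ˢ? W)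

  pairs : List (Fin n × Fin n)
  pairs = cartesianProduct (allFin n) (allFin n)

  #C #S #E : Subset n → ℕ
  #C W = count (cycleIn? W) (subsets n)
  #S W = count (solidIn? W) (subsets n)
  #E W = count (edgeIn? W) pairs

  ColorableOn : Subset n → ℕ → Set
  ColorableOn W k = ∃ λ (c : Fin n → Fin k) → ∀ {u w} → u ∈ˢ W → w ∈ˢ W → u ~ w → c u ≢ c w

  -- The invariant without subtraction. Any number `suc k` of colours that suffices for `W` may
  -- occur: in the end `χ` is at most `suc k`, and `k C 4` is monotone in `k`. So no chromatic
  -- number has to be tracked during the deletions.
  Bounded : Subset n → Set
  Bounded W = ∃ λ k → ColorableOn W (suc k) × #C W + ∣ W ∣ + k C 4 ≤ #S W + #E W + 1

  missing : ∀ {k} (xs : List (Fin k)) → length xs < k → ∃ λ j → j ∉ xs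
  missing {k} xs short with Finₚ.any? (λ j → ¬? (j ∈ˡ? xs))
  ... | yes found = found
  ... | no none   = contradiction (≤-trans short (subst (_≤ length xs) (length-tabulate id)
                      (Unique-⊆⇒length≤ (Uniqueₚ.allFin⁺ k) λ {j} _ → all j))) (<-irrefl refl)
    where
    all : ∀ j → j ∈ xs
    all j with j ∈ˡ? xs
    ... | yes j∈ = j∈
    ... | no j∉  = contradiction (j , j∉) none

-- The effect of deleting `v` on the counts, on connectedness and on colourings.

module Deletion {n : ℕ} (G : Graph n) {W : Subset n} (simplicial : Elimination.Simplicial G W) where
  open import Data.Nat using (_+_; _≤_; _<_; _≤?_)
  open Graph G
  open InducedPaths G
  open Subsets
  open Counting
  open Binomials
  open Elimination G
  open Measures G
  open Simplicial simplicial
  open At G v W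
  open CycleBound G v∈W using (cycles-bound)

  W′ : Subset n
  W′ = W ∖ v

  d : ℕ
  d = ∣ trace W ∣

  W′⁺ : ∀ {x} → x ∈ˢ W → x ≢ v → x ∈ˢ W′
  W′⁺ = x∈p∧x≢y⇒x∈p-y

  W′⊆W : W′ ⊆ W
  W′⊆W = p─q⊆p W ⁅ v ⁆

  v∉W′ : v ∉ˢ W′
  -- Removing `v` again changes nothing, whereas removing a member would lower the size.
  v∉W′ v∈ = <-irrefl refl (subst (_< ∣ W′ ∣) (cong ∣_∣ W′-v≡W′) (x∈p⇒∣p-x∣<∣p∣ v∈))
    where
    W′-v≡W′ : W′ ∖ v ≡ W′
    W′-v≡W′ = p─q─q≡p─q W ⁅ v ⁆

  solids-split : length solids₂ + length (solids₃ simplicial) ≤ count solidAt? (subsets n)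
  solids-split = count-disjoint (tracedSolid? 2) (tracedSolid? 3) solidAt? (subsets-Unique n) proj₁ proj₁
    λ (_ , two) (_ , three) → case trans (sym two) three of λ ()

  #S-split : #S W′ + count solidAt? (subsets n) ≤ #S W
  #S-split = count-disjoint (solidIn? W′) solidAt? (solidIn? W) (subsets-Unique n)
    (λ (solid , S⊆) → solid , λ {x} x∈ → W′⊆W (S⊆ x∈)) (λ (solid , _ , S⊆) → solid , λ {x} → S⊆ {x})
    λ (_ , S⊆) (_ , v∈ , _) → v∉W′ (S⊆ v∈)

  #C-split : #C W ≤ #C W′ + length cycles
  #C-split = count-cover (cycleIn? W′) cycleAt? (cycleIn? W) (subsets-Unique n) split
    where
    split : ∀ {S} → CycleIn W S → CycleIn W′ S ⊎ CycleAt S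
    split {S} (cyc , S⊆) with v ∈ˢ? S
    ... | yes v∈ = inj₂ (cyc , v∈ , λ {x} → S⊆ {x})
    ... | no v∉  = inj₁ (cyc , λ {x} x∈ → W′⁺ (S⊆ x∈) λ { refl → v∉ x∈ })

  -- The edge between `u` and `v` in the increasing order in which edges are counted.
  pair : Fin n → Fin n × Fin n
  pair u with u <ᶠ? v
  ... | yes _ = u , v
  ... | no _  = v , u

  pair-injective : ∀ {u w} → pair u ≡ pair w → u ≡ w
  pair-injective {u} {w} eq with u <ᶠ? v | w <ᶠ? v | eq
  ... | yes _   | yes _   | refl = refl
  ... | yes u<v | no _    | refl = contradiction u<v (Finₚ.<-irrefl refl)
  ... | no _    | yes w<v | refl = contradiction w<v (Finₚ.<-irrefl refl)
  ... | no _    | no _    | refl = refl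

  pair-EdgeIn : ∀ {u} → u ∈ˢ trace W → EdgeIn W (pair u)
  pair-EdgeIn {u} u∈ with ∈-trace⁻ {W} u∈ | u <ᶠ? v
  ... | u∈W , v~u | yes u<v = (u<v , ~-sym v~u) , u∈W , v∈W
  ... | u∈W , v~u | no u≮v  = (≤∧≢⇒< (≮⇒≥ u≮v) (λ eq → ~⇒≢ v~u (Finₚ.toℕ-injective eq)) , v~u) , v∈W , u∈W

  pair-v : ∀ u → proj₁ (pair u) ≡ v ⊎ proj₂ (pair u) ≡ v
  pair-v u with u <ᶠ? v
  ... | yes _ = inj₂ refl
  ... | no _  = inj₁ refl

  ∈-pairs : ∀ e → e ∈ pairs
  ∈-pairs (u , w) = ∈-cartesianProduct⁺ (∈-allFin u) (∈-allFin w)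

  pairs-Unique : Unique pairs
  pairs-Unique = Uniqueₚ.cartesianProduct⁺ (Uniqueₚ.allFin⁺ n) (Uniqueₚ.allFin⁺ n)

  #E-split : #E W′ + d ≤ #E W
  #E-split = subst (_≤ #E W)
    (trans (length-++ (filter (edgeIn? W′) pairs))
           (cong (#E W′ +_) (trans (length-map pair (elems (trace W))) (length-elems (trace W)))))
    (Unique-⊆⇒length≤
      (Uniqueₚ.++⁺ (Uniqueₚ.filter⁺ (edgeIn? W′) pairs-Unique)
          (Uniqueₚ.map⁺ pair-injective (elems-Unique (trace W))) disjoint)
      λ e∈ → [ old , new ]′ (∈-++⁻ (filter (edgeIn? W′) pairs) e∈))
    where
    disjoint : ∀ {e} → ¬ (e ∈ filter (edgeIn? W′) pairs × e ∈ map pair (elems (trace W)))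
    disjoint (e∈ , e∈′) with ∈-map⁻ pair e∈′ | proj₂ (∈-filter⁻ (edgeIn? W′) {xs = pairs} e∈)
    ... | u , _ , refl | _ , ∈₁ , ∈₂ =
      [ (λ eq → v∉W′ (subst (_∈ˢ W′) eq ∈₁)) , (λ eq → v∉W′ (subst (_∈ˢ W′) eq ∈₂)) ]′ (pair-v u)
    old : ∀ {e} → e ∈ filter (edgeIn? W′) pairs → e ∈ filter (edgeIn? W) pairs
    old e∈ with ∈-filter⁻ (edgeIn? W′) {xs = pairs} e∈
    ... | e∈ , edge , ∈₁ , ∈₂ = ∈-filter⁺ (edgeIn? W) e∈ (edge , W′⊆W ∈₁ , W′⊆W ∈₂)
    new : ∀ {e} → e ∈ map pair (elems (trace W)) → e ∈ filter (edgeIn? W) pairs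
    new e∈ with ∈-map⁻ pair e∈
    ... | u , u∈ , refl = ∈-filter⁺ (edgeIn? W) (∈-pairs _) (pair-EdgeIn (∈-elems⁻ (trace W) u∈))

  ∣W∣≤1+∣W′∣ : ∣ W ∣ ≤ suc ∣ W′ ∣
  ∣W∣≤1+∣W′∣ = subst₂ _≤_ (length-elems W) (cong suc (length-elems W′))
    (Unique-⊆⇒length≤ {ys = v ∷ elems W′} (elems-Unique W) λ {x} x∈ → place x (∈-elems⁻ W x∈))
    where
    place : ∀ x → x ∈ˢ W → x ∈ v ∷ elems W′
    place x x∈ with x Finₚ.≟ v
    ... | yes x≡v = here x≡v
    ... | no x≢v  = there (∈-elems⁺ (W′⁺ x∈ x≢v))

  local-bound : length cycles + d C 3 ≤ count solidAt? (subsets n) + d C 2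
  local-bound = begin
    length cycles + d C 3                        ≤⟨ +-mono-≤ (cycles-bound) (triples-bound simplicial) ⟩
    (d C 2 + length solids₂) + length (solids₃ simplicial) ≡⟨ +-assoc (d C 2) _ _ ⟩
    d C 2 + (length solids₂ + length (solids₃ simplicial)) ≤⟨ +-monoʳ-≤ (d C 2) solids-split ⟩
    d C 2 + count solidAt? (subsets n)           ≡⟨ +-comm (d C 2) _ ⟩
    count solidAt? (subsets n) + d C 2           ∎
    where open ℕₚ.≤-Reasoning

  -- A visit of `v` is bridged between the vertices before and after it. By `good` they are
  -- adjacent, or both see `D`, which is connected and does not contain `v`.
  delete-conn : Conn (_∈ˢ W) → Conn (_∈ˢ W′)
  delete-conn connW x∈ y∈ = avoid x∈ y∈ (connW (W′⊆W x∈) (W′⊆W y∈))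
    where
    D⊆W′ : ∀ {d} → d ∈ˢ D → d ∈ˢ W′
    D⊆W′ d∈ = W′⁺ (D⊆W d∈) (≢-sym (proj₁ (v≁D d∈)))
    bridge : ∀ {x y} → x ∈ˢ W′ → y ∈ˢ W′ → v ~ x → v ~ y → Walk (_∈ˢ W′) x y
    bridge {x} {y} x∈ y∈ v~x v~y with x Finₚ.≟ y
    ... | yes refl = ε
    ... | no x≢y with good (W′⊆W x∈) v~x | good (W′⊆W y∈) v~y
    ...   | inj₂ all            | _                   = (all (W′⊆W y∈) v~y (≢-sym x≢y) , y∈) ◅ ε
    ...   | inj₁ _              | inj₂ all            = (~-sym (all (W′⊆W x∈) v~x x≢y) , y∈) ◅ ε
    ...   | inj₁ (c , c∈ , x~c) | inj₁ (e , e∈ , y~e) =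
      (x~c , D⊆W′ c∈) ◅ (Walk-map D⊆W′ (conn c∈ e∈) ◅◅ ((~-sym y~e , y∈) ◅ ε))
    avoid : ∀ {x y} → x ∈ˢ W′ → y ∈ˢ W′ → Walk (_∈ˢ W) x y → Walk (_∈ˢ W′) x y
    avoid x∈ y∈ ε = ε
    avoid x∈ y∈ (_◅_ {j = z} (x~z , z∈) w) with z Finₚ.≟ v
    ... | no z≢v = (x~z , W′⁺ z∈ z≢v) ◅ avoid (W′⁺ z∈ z≢v) y∈ w
    avoid x∈ y∈ ((x~v , _) ◅ ε) | yes refl = contradiction y∈ v∉W′
    avoid x∈ y∈ ((x~v , _) ◅ ((v~u , u∈) ◅ w)) | yes refl =
      bridge x∈ u∈W′ (~-sym x~v) v~u ◅◅ avoid u∈W′ y∈ w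
      where
      u∈W′ = W′⁺ u∈ (≢-sym (~⇒≢ v~u))

  positive-degree : Conn (_∈ˢ W) → ∀ {u} → u ∈ˢ W′ → 0 < d
  positive-degree connW {u} u∈ with connW v∈W (W′⊆W u∈)
  ... | ε              = contradiction u∈ v∉W′
  ... | (v~x , x∈) ◅ _ = ≤-trans (s≤s z≤n) (x∈p⇒∣p-x∣<∣p∣ (∈-trace⁺ {W} x∈ v~x))

  color-v : ∀ {k} ((c , _) : ColorableOn W′ k) j → (∀ {u} → u ∈ˢ W → v ~ u → c u ≢ j) → ColorableOn W k
  color-v {k} (c , proper) j fresh = recolor , λ u∈ w∈ → proper′ u∈ w∈
    where
    recolor : Fin n → Fin k
    recolor u with u Finₚ.≟ v
    ... | yes _ = j
    ... | no _  = c u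
    proper′ : ∀ {u w} → u ∈ˢ W → w ∈ˢ W → u ~ w → recolor u ≢ recolor w
    proper′ {u} {w} u∈ w∈ u~w with u Finₚ.≟ v | w Finₚ.≟ v
    ... | yes refl | yes refl = contradiction u~w (~-irr refl)
    ... | yes refl | no _     = ≢-sym (fresh w∈ u~w)
    ... | no _     | yes refl = fresh u∈ (~-sym u~w)
    ... | no u≢v   | no w≢v   = proper (W′⁺ u∈ u≢v) (W′⁺ w∈ w≢v) u~w

  color-greedily : ∀ {k} → ColorableOn W′ k → d < k → ColorableOn W k
  color-greedily {k} colors@(c , _) d<k with missing (map c (elems (trace W)))
    (subst (_< k) (sym (trans (length-map c (elems (trace W))) (length-elems (trace W)))) d<k)
  ... | j , j∉ = color-v colors j λ u∈ v~u eq →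
    j∉ (subst (_∈ map c (elems (trace W))) eq (∈-map⁺ c (∈-elems⁺ (∈-trace⁺ {W} u∈ v~u))))

  color-anew : ∀ {k} → ColorableOn W′ k → ColorableOn W (suc k)
  color-anew (c , proper) =
    color-v (suc ∘ c , λ u∈ w∈ u~w → proper u∈ w∈ u~w ∘ Finₚ.suc-injective) zero λ _ _ ()

  -- Positivity of `d` matters: for `d` = 0 the truncated `(d ∸ 1) C 3` is 0, although the deletion
  -- of an isolated vertex accounts for a change of -1.
  step-bound : 0 < d → #C W + ∣ W ∣ + (d ∸ 1) C 3 + (#S W′ + #E W′) ≤ #C W′ + ∣ W′ ∣ + (#S W + #E W)
  step-bound 0<d = begin
    #C W + ∣ W ∣ + q + (#S W′ + #E W′)
      ≤⟨ +-monoˡ-≤ _ (+-monoˡ-≤ q (+-mono-≤ #C-split ∣W∣≤1+∣W′∣)) ⟩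
    #C W′ + cᵥ + suc ∣ W′ ∣ + q + (#S W′ + #E W′)           ≡⟨ regroup₁ (#C W′) cᵥ ∣ W′ ∣ q (#S W′) (#E W′) ⟩
    #C W′ + ∣ W′ ∣ + (#S W′ + #E W′ + (cᵥ + 1 + q))         ≤⟨ +-monoʳ-≤ (#C W′ + ∣ W′ ∣)
        (+-monoʳ-≤ (#S W′ + #E W′) gain) ⟩
    #C W′ + ∣ W′ ∣ + (#S W′ + #E W′ + (sᵥ + d))             ≡⟨ cong (#C W′ + ∣ W′ ∣ +_)
        (regroup₂ (#S W′) (#E W′) sᵥ d) ⟩
    #C W′ + ∣ W′ ∣ + (#S W′ + sᵥ + (#E W′ + d))             ≤⟨ +-monoʳ-≤ (#C W′ + ∣ W′ ∣)
        (+-mono-≤ #S-split #E-split) ⟩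
    #C W′ + ∣ W′ ∣ + (#S W + #E W)                          ∎
    where
    open ℕₚ.≤-Reasoning
    q cᵥ sᵥ : ℕ
    q  = (d ∸ 1) C 3
    cᵥ = length cycles
    sᵥ = count solidAt? (subsets n)
    regroup₁ : ∀ c cᵥ w q s e → c + cᵥ + suc w + q + (s + e) ≡ c + w + (s + e + (cᵥ + 1 + q))
    regroup₁ = solve-∀
    regroup₂ : ∀ s e sᵥ d → s + e + (sᵥ + d) ≡ s + sᵥ + (e + d)
    regroup₂ = solve-∀
    regroup₃ : ∀ cᵥ q c₂ → cᵥ + 1 + q + c₂ ≡ cᵥ + (c₂ + 1 + q)
    regroup₃ = solve-∀
    regroup₄ : ∀ sᵥ c₂ d → sᵥ + c₂ + d ≡ sᵥ + d + c₂
    regroup₄ = solve-∀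
    alternating : ∀ d → 0 < d → d C 3 + d ≡ d C 2 + 1 + (d ∸ 1) C 3
    alternating (suc d) _ = C-alternating₃ d
    gain : cᵥ + 1 + q ≤ sᵥ + d
    gain = +-cancelʳ-≤ (d C 2) (cᵥ + 1 + q) (sᵥ + d) (begin
      cᵥ + 1 + q + d C 2       ≡⟨ regroup₃ cᵥ q (d C 2) ⟩
      cᵥ + (d C 2 + 1 + q)     ≡⟨ cong (cᵥ +_) (alternating d 0<d) ⟨
      cᵥ + (d C 3 + d)         ≡⟨ +-assoc cᵥ (d C 3) d ⟨
      cᵥ + d C 3 + d           ≤⟨ +-monoˡ-≤ d local-bound ⟩
      sᵥ + d C 2 + d           ≡⟨ regroup₄ sᵥ (d C 2) d ⟩
      sᵥ + d + d C 2           ∎)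

  -- The base of the induction, where `W` consists of `v` alone. One colour suffices, and the `+ 1`
  -- of `Bounded` pays for the vertex.
  bounded-isolated : (∀ {u} → u ∉ˢ W′) → Bounded W
  bounded-isolated empty = 0 , ((λ _ → zero) , λ u∈ w∈ u~w _ → ~-irr (trans (only u∈) (sym (only w∈))) u~w) , (begin
    #C W + ∣ W ∣ + 0 C 4                ≡⟨ +-identityʳ _ ⟩
    #C W + ∣ W ∣                        ≤⟨ +-mono-≤ #C-split ∣W∣≤1+∣W′∣ ⟩
    #C W′ + cᵥ + suc ∣ W′ ∣             ≡⟨ cong₂ (λ x y → x + cᵥ + suc y) no-cycles (∣empty∣ empty) ⟩
    cᵥ + 1                              ≤⟨ +-monoˡ-≤ 1 cᵥ≤ ⟩
    #S W + 1                            ≤⟨ +-monoˡ-≤ 1 (m≤m+n (#S W) (#E W)) ⟩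
    #S W + #E W + 1                     ∎)
    where
    open ℕₚ.≤-Reasoning
    cᵥ = length cycles
    ∣empty∣ : ∀ {S : Subset n} → (∀ {u} → u ∉ˢ S) → ∣ S ∣ ≡ 0
    ∣empty∣ {S} none = trans (cong ∣_∣ (Empty-unique {p = S} λ (u , u∈) → none u∈)) (∣⊥∣≡0 n)
    only : ∀ {u} → u ∈ˢ W → u ≡ v
    only {u} u∈ with u Finₚ.≟ v
    ... | yes eq = eq
    ... | no neq = contradiction (W′⁺ u∈ neq) empty
    no-cycles : #C W′ ≡ 0
    no-cycles = count-none (cycleIn? W′)
      (λ { ((_ , _ , cycle x _ _ _ , S≈ , _) , S⊆) → empty (S⊆ (Equivalence.from (S≈ x) (here refl))) }) (subsets n)
    d≡0 : d ≡ 0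
    d≡0 = ∣empty∣ λ u∈ → let u∈W , v~u = ∈-trace⁻ {W} u∈ in ~⇒≢ v~u (sym (only u∈W))
    -- For `d` = 0 the local bound compares the cycles through `v` directly with the solids through
    -- `v`, so it need not be shown that there are none.
    cᵥ≤ : cᵥ ≤ #S W
    cᵥ≤ = begin
      cᵥ                                   ≤⟨ m≤m+n cᵥ (d C 3) ⟩
      cᵥ + d C 3                           ≤⟨ local-bound ⟩
      count solidAt? (subsets n) + d C 2   ≡⟨ cong (λ d → count solidAt? (subsets n) + d C 2) d≡0 ⟩
      count solidAt? (subsets n) + 0       ≡⟨ +-identityʳ _ ⟩
      count solidAt? (subsets n)           ≤⟨ m≤n+m _ (#S W′) ⟩
      #S W′ + count solidAt? (subsets n)   ≤⟨ #S-split ⟩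
      #S W                                 ∎

  bounded-extend : 0 < d → Bounded W′ → Bounded W
  bounded-extend 0<d (k , colors , bound) = choose (d ≤? k)
    where
    open ℕₚ.≤-Reasoning
    q : ℕ
    q = (d ∸ 1) C 3
    regroup₁ : ∀ x p y t → x + p + (y + t) ≡ x + t + (y + p)
    regroup₁ = solve-∀
    regroup₂ : ∀ y z t → y + z + (t + 1) ≡ z + 1 + (y + t)
    regroup₂ = solve-∀
    add-bounds : ∀ x y z t p → x + t ≤ y + z → y + p ≤ t + 1 → x + p ≤ z + 1
    add-bounds x y z t p ≤₁ ≤₂ = +-cancelʳ-≤ (y + t) (x + p) (z + 1) (begin
      x + p + (y + t)     ≡⟨ regroup₁ x p y t ⟩
      x + t + (y + p)     ≤⟨ +-mono-≤ ≤₁ ≤₂ ⟩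
      y + z + (t + 1)     ≡⟨ regroup₂ y z t ⟩
      z + 1 + (y + t)     ∎)
    total : #C W + ∣ W ∣ + q + k C 4 ≤ #S W + #E W + 1
    total = add-bounds (#C W + ∣ W ∣ + q) (#C W′ + ∣ W′ ∣) (#S W + #E W) (#S W′ + #E W′) (k C 4)
        (step-bound 0<d) bound
    choose : Dec (d ≤ k) → Bounded W
    -- Among `suc k` colours one is left for `v`, and the gain `q` is given away.
    choose (yes d≤k) = k , color-greedily colors (s≤s d≤k) ,
      ≤-trans (+-monoˡ-≤ (k C 4) (m≤m+n (#C W + ∣ W ∣) q)) total
    choose (no d≰k) = suc k , color-anew colors , (begin
      #C W + ∣ W ∣ + suc k C 4             ≡⟨ cong (#C W + ∣ W ∣ +_) (pascal k 3) ⟩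
      #C W + ∣ W ∣ + (k C 3 + k C 4)       ≤⟨ +-monoʳ-≤ (#C W + ∣ W ∣) (+-monoˡ-≤ (k C 4)
                                                (C-monoˡ-≤ 3 (∸-monoˡ-≤ 1 (≰⇒> d≰k)))) ⟩
      #C W + ∣ W ∣ + (q + k C 4)           ≡⟨ +-assoc (#C W + ∣ W ∣) q (k C 4) ⟨
      #C W + ∣ W ∣ + q + k C 4             ≤⟨ total ⟩
      #S W + #E W + 1                      ∎)

-- Deleting all vertices of a connected set.

module Induction {n : ℕ} (G : Graph n) where
  open import Data.Nat using (_≤_)
  open Graph G
  open InducedPaths G
  open Elimination G
  open Measures G
  open Deletion G

  connected⇒bounded : ∀ m W → ∣ W ∣ ≤ m → ∀ {w} → w ∈ˢ W → Conn (_∈ˢ W) → Bounded W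
  connected⇒bounded zero    W ∣W∣≤ w∈ _    = contradiction (≤-trans (x∈p⇒∣p-x∣<∣p∣ w∈) ∣W∣≤) λ ()
  connected⇒bounded (suc m) W ∣W∣≤ w∈ conn with simplicial-exists w∈
  ... | simplicial with nonempty? (W ∖ Simplicial.v simplicial)
  ...   | no empty        = bounded-isolated simplicial λ u∈ → empty (_ , u∈)
  ...   | yes (u , u∈) = bounded-extend simplicial (positive-degree simplicial conn u∈)
    (connected⇒bounded m _ (s≤s⁻¹ (≤-trans (x∈p⇒∣p-x∣<∣p∣ (Simplicial.v∈W simplicial)) ∣W∣≤))
      u∈ (delete-conn simplicial conn))

-- Cycles, edges and solids of complete graphs.

module CompleteGraphs (t : ℕ) where
  open import Data.Nat using (_+_; _≤_)
  open Graph (K t)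
  open InducedPaths (K t)
  open Subsets
  open Counting
  open Solids (K t)
  open Cycles (K t)

  ⊤-count : ∀ k → count (ofSize? k (⊤ {t})) (subsets t) ≡ t C k
  ⊤-count k = trans (count-ofSize k (⊤ {t})) (cong (_C k) (∣⊤∣≡n t))

  -- Cycles enter the characteristic negatively, so for an upper bound it is enough to exhibit the
  -- triangles.
  nC3≤∣C∣ : t C 3 ≤ ∣C∣ (K t)
  nC3≤∣C∣ = subst (_≤ ∣C∣ (K t)) (⊤-count 3)
      (count-mono (ofSize? 3 ⊤) (inducedCycle? (K t)) triangle-cycle (subsets t))
    where
    triangle-cycle : ∀ {S} → OfSize 3 ⊤ S → InducedCycle (K t) S
    triangle-cycle {S} (_ , size) = of-elems (elems S) (trans (length-elems S) size) (elems-Unique S) (≈-elems S)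
      where
      of-elems : ∀ xs → length xs ≡ 3 → Unique xs → S ≈ xs → InducedCycle (K t) S
      of-elems (a ∷ b ∷ c ∷ []) _ ((a≢b ∷ a≢c ∷ []) ∷ (b≢c ∷ []) ∷ _) S≈ =
        Rim-InducedCycle {p = []} (step b≢c [] [ c ] , a≢b , a≢c , []) S≈

  map-Unique : ∀ {A B : Set} (f : A → B) {xs} → (∀ {x y} → x ∈ xs → y ∈ xs → f x ≡ f y → x ≡ y) →
               Unique xs → Unique (map f xs)
  map-Unique f inj []       = []
  map-Unique f inj (x∉ ∷ u) =
    map⁺ (tabulate λ y∈ eq → lookup x∉ y∈ (inj (here refl) (there y∈) eq)) ∷
    map-Unique f (λ x∈ y∈ → inj (there x∈) (there y∈)) u

  set : Fin t × Fin t → Subset t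
  set (u , w) = ⟦ u ∷ w ∷ [] ⟧

  set-injective : ∀ {u w u′ w′} → u <ᶠ w → u′ <ᶠ w′ → set (u , w) ≡ set (u′ , w′) → (u , w) ≡ (u′ , w′)
  set-injective {u} {w} {u′} {w′} u<w u′<w′ eq
    with ∈⟦⟧⁻ {xs = u′ ∷ w′ ∷ []} (subst (u ∈ˢ_) eq (∈⟦⟧⁺ {xs = u ∷ w ∷ []} (here refl)))
       | ∈⟦⟧⁻ {xs = u′ ∷ w′ ∷ []} (subst (w ∈ˢ_) eq (∈⟦⟧⁺ {xs = u ∷ w ∷ []} (there (here refl))))
  ... | here refl         | here refl         = contradiction u<w (Finₚ.<-irrefl refl)
  ... | here refl         | there (here refl) = refl
  ... | there (here refl) | here refl         = contradiction u<w (Finₚ.<-asym u′<w′)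
  ... | there (here refl) | there (here refl) = contradiction u<w (Finₚ.<-irrefl refl)

  ∣E∣≤nC2 : ∣E∣ (K t) ≤ t C 2
  ∣E∣≤nC2 = subst₂ _≤_ (length-map set edges) (⊤-count 2)
    (Unique-⊆⇒length≤ {ys = filter (ofSize? 2 ⊤) (subsets t)}
      (map-Unique set (λ x∈ y∈ → set-injective (proj₁ (edge⁻ x∈)) (proj₁ (edge⁻ y∈)))
        (Uniqueₚ.filter⁺ _ (Uniqueₚ.cartesianProduct⁺ (Uniqueₚ.allFin⁺ t) (Uniqueₚ.allFin⁺ t))))
      λ S∈ → two-set (∈-map⁻ set S∈))
    where
    edge? : Decidable (λ ((u , w) : Fin t × Fin t) → u <ᶠ w × u ~ w)
    edge? (u , w) = (u <ᶠ? w) ×-dec (u ~? w)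
    edges : List (Fin t × Fin t)
    edges = filter edge? (cartesianProduct (allFin t) (allFin t))
    edge⁻ : ∀ {e} → e ∈ edges → proj₁ e <ᶠ proj₂ e × proj₁ e ~ proj₂ e
    edge⁻ e∈ = proj₂ (∈-filter⁻ edge? {xs = cartesianProduct (allFin t) (allFin t)} e∈)
    two-set : ∀ {S} → (∃ λ e → e ∈ edges × S ≡ set e) → S ∈ filter (ofSize? 2 ⊤) (subsets t)
    two-set ((u , w) , e∈ , refl) = ∈-filter⁺ (ofSize? 2 ⊤) (∈-subsets _)
      (⊆-max _ , ∣≈∣ (⟦⟧-≈ (u ∷ w ∷ [])) ((proj₂ (edge⁻ e∈) ∷ []) ∷ [] ∷ []))

  Joined-path : ∀ {a} p {b u w} → Joined (path a p b) u w → u ∈ a ∷ p ++ b ∷ [] × w ∈ a ∷ p ++ b ∷ []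
  Joined-path {a} p {b} (inj₁ e∈) = let u∈ , w∈ = path-∈ p e∈ in ∈-++⁺ˡ u∈ , there w∈
  Joined-path {a} p {b} (inj₂ e∈) = let w∈ , u∈ = path-∈ p e∈ in there u∈ , ∈-++⁺ˡ w∈

  Joined-++ : ∀ es {fs u w} → Joined (es ++ fs) u w → Joined es u w ⊎ Joined fs u w
  Joined-++ es (inj₁ e∈) = [ inj₁ ∘ inj₁ , inj₂ ∘ inj₁ ]′ (∈-++⁻ es e∈)
  Joined-++ es (inj₂ e∈) = [ inj₁ ∘ inj₂ , inj₂ ∘ inj₂ ]′ (∈-++⁻ es e∈)

  off-path : ∀ {a} p {b u w} → All (u ≢_) (a ∷ p ++ b ∷ []) → ¬ Joined (path a p b) u w
  off-path p u∉ j = lookup u∉ (proj₁ (Joined-path p j)) refl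

  Joined-ends : ∀ {a} p {b} → All (a ≢_) (p ++ b ∷ []) → All (b ≢_) p → Joined (path a p b) a b → p ≡ []
  Joined-ends []      _  _  _ = refl
  Joined-ends (x ∷ p) a∉ b∉ (inj₁ (here refl)) = contradiction refl (All.head b∉)
  Joined-ends (x ∷ p) a∉ b∉ (inj₁ (there e∈))  = contradiction refl (lookup a∉ (∈-++⁺ˡ (proj₁ (path-∈ p e∈))))
  Joined-ends (x ∷ p) a∉ b∉ (inj₂ e∈)          = contradiction refl (lookup a∉ (proj₂ (path-∈ (x ∷ p) e∈)))

  Joined-triangle : ∀ {x y z u w} → Joined (triangle {Fin t} x y z) u w → u ∈ x ∷ y ∷ z ∷ []
  Joined-triangle (inj₁ (here refl))                 = here refl
  Joined-triangle (inj₁ (there (here refl)))         = there (here refl)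
  Joined-triangle (inj₁ (there (there (here refl)))) = there (there (here refl))
  Joined-triangle (inj₂ (here refl))                 = there (here refl)
  Joined-triangle (inj₂ (there (here refl)))         = there (there (here refl))
  Joined-triangle (inj₂ (there (there (here refl)))) = here refl

  AllJoined : List (Fin t) → Edges (Fin t) → Set
  AllJoined vs es = ∀ {u w} → u ∈ vs → w ∈ vs → u ≢ w → Joined es u w

  -- On a cycle with at least four vertices, `v` and the vertex `b` two places further are not
  -- joined by an edge of the cycle; the spokes at `w` cannot join them either.
  Cycle-length : ∀ {cs es w ns} → Cycle cs es → All (w ≢_) cs → AllJoined (w ∷ cs) (es ++ map (w ,_) ns) →
                 Unique cs × length cs ≡ 3
  Cycle-length (cycle v []           u (s≤s ()) ) w≢ joined
  Cycle-length (cycle v (_ ∷ [])     u (s≤s (s≤s ()))) w≢ joined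
  Cycle-length (cycle v (_ ∷ _ ∷ []) u l) w≢ joined = u , refl
  Cycle-length {w = w} {ns} (cycle v (a ∷ b ∷ d ∷ c) u@((v≢a ∷ v≢b ∷ v∉) ∷ (a≢b ∷ a∉) ∷ (b∉ ∷ _)) l) w≢ joined =
    ⊥-elim ([ not-joined , [ spoke (lookup w≢ (here refl)) , spoke (lookup w≢ (there (there (here refl)))) ]′ ]′
      (Joined-++ (path v (a ∷ b ∷ d ∷ c) v) (joined (there (here refl)) (there (there (there (here refl)))) v≢b)))
    where
    spoke : ∀ {x y} → w ≢ x → (x , y) ∉ map (w ,_) ns
    spoke w≢x e∈ with ∈-map⁻ (w ,_) e∈
    ... | _ , _ , refl = w≢x refl
    not-joined : ¬ Joined (path v (a ∷ b ∷ d ∷ c) v) v b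
    not-joined (inj₁ (here refl)) = a≢b refl
    not-joined (inj₁ (there e∈))  = lookup (v≢a ∷ v≢b ∷ v∉) (proj₁ (path-∈ (b ∷ d ∷ c) e∈)) refl
    not-joined (inj₂ (here refl)) = v≢b refl
    not-joined (inj₂ (there (here refl))) = a≢b refl
    not-joined (inj₂ (there (there (here refl)))) = All.head v∉ refl
    not-joined (inj₂ (there (there (there e∈)))) = lookup b∉ (proj₁ (path-∈ c e∈)) refl

  split³ : ∀ {P : Pred (Fin t) 0ℓ} p₁ p₂ {p₃} → All P (p₁ ++ p₂ ++ p₃) → All P p₁ × All P p₂ × All P p₃
  split³ p₁ p₂ ps = ++⁻ˡ p₁ ps , ++⁻ˡ p₂ (++⁻ʳ p₁ ps) , ++⁻ʳ p₂ (++⁻ʳ p₁ ps)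

  snoc : ∀ {P : Pred (Fin t) 0ℓ} {p x} → All P p → P x → All P (p ++ x ∷ [])
  snoc ps px = ++⁺ ps (px ∷ [])

  -- A solid with all edges present has four vertices. The ends of a trihedron are never joined, nor
  -- are `x₁` and `y₂` in a prism. In a stamp the apex can be joined to `xᵢ` only by the leg from
  -- `xᵢ`, which is then a single edge. In a pyramid the cycle must be a triangle.
  Solid-length : ∀ {vs es} → Solid vs es → AllJoined vs es → Unique vs × length vs ≡ 4
  Solid-length (inj₁ (pyramid w ns cyc w≢ _ _ _)) joined =
    let u , len = Cycle-length cyc w≢ joined in (w≢ ∷ u) , cong suc len
  Solid-length (inj₂ (inj₁ (trihedron a b p₁ p₂ p₃ ((a≢b ∷ a∉) ∷ b∉ ∷ _) l₁ l₂ l₃))) joined =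
    let a₁ , a₂ , a₃ = split³ p₁ p₂ a∉ ; b₁ , b₂ , b₃ = split³ p₁ p₂ b∉ in
    ⊥-elim ([ apart l₁ a₁ b₁ , [ apart l₂ a₂ b₂ , apart l₃ a₃ b₃ ]′ ∘ Joined-++ (path a p₂ b) ]′
              (Joined-++ (path a p₁ b) (joined (here refl) (there (here refl)) a≢b)))
    where
    apart : ∀ {p} → 1 ≤ length p → All (a ≢_) p → All (b ≢_) p → ¬ Joined (path a p b) a b
    apart {p} 1≤p a∉ b∉ j with Joined-ends p (snoc a∉ a≢b) b∉ j
    ... | refl = case 1≤p of λ ()
  Solid-length (inj₂ (inj₂ (inj₁ (stamp x₁ x₂ x₃ x p₁ p₂ p₃
    u@((x₁≢x₂ ∷ x₁≢x₃ ∷ x₁≢x ∷ x₁∉) ∷ (x₂≢x₃ ∷ x₂≢x ∷ x₂∉) ∷ (x₃≢x ∷ x₃∉) ∷ x∉ ∷ _))))) joined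
    with split³ p₁ p₂ x₁∉ | split³ p₁ p₂ x₂∉ | split³ p₁ p₂ x₃∉ | split³ p₁ p₂ x∉
  ... | x₁p₁ , x₁p₂ , x₁p₃ | x₂p₁ , x₂p₂ , x₂p₃ | x₃p₁ , x₃p₂ , x₃p₃ | xp₁ , xp₂ , xp₃ =
    u , cong (λ p → 4 + length p) (trans (cong (_++ p₂ ++ p₃) e₁) (trans (cong (_++ p₃) e₂) e₃))
    where
    x∉T : ¬ (x ∈ x₁ ∷ x₂ ∷ x₃ ∷ [])
    x∉T (here eq)                 = x₁≢x (sym eq)
    x∉T (there (here eq))         = x₂≢x (sym eq)
    x∉T (there (there (here eq))) = x₃≢x (sym eq)
    on-paths : ∀ {y} → y ∈ x₁ ∷ x₂ ∷ x₃ ∷ x ∷ p₁ ++ p₂ ++ p₃ → y ≢ x →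
               Joined (path x₁ p₁ x) y x ⊎ Joined (path x₂ p₂ x) y x ⊎ Joined (path x₃ p₃ x) y x
    on-paths y∈ y≢x with Joined-++ (triangle x₁ x₂ x₃) (joined y∈ (there (there (there (here refl)))) y≢x)
    ... | inj₁ j = contradiction (Joined-triangle (Joined-sym j)) x∉T
    ... | inj₂ j with Joined-++ (path x₁ p₁ x) j
    ...   | inj₁ j₁ = inj₁ j₁
    ...   | inj₂ j′ = inj₂ (Joined-++ (path x₂ p₂ x) j′)
    e₁ : p₁ ≡ []
    e₁ with on-paths (here refl) x₁≢x
    ... | inj₁ j        = Joined-ends p₁ (snoc x₁p₁ x₁≢x) xp₁ j
    ... | inj₂ (inj₁ j) = contradiction j (off-path p₂ (x₁≢x₂ ∷ snoc x₁p₂ x₁≢x))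
    ... | inj₂ (inj₂ j) = contradiction j (off-path p₃ (x₁≢x₃ ∷ snoc x₁p₃ x₁≢x))
    e₂ : p₂ ≡ []
    e₂ with on-paths (there (here refl)) x₂≢x
    ... | inj₁ j        = contradiction j (off-path p₁ (≢-sym x₁≢x₂ ∷ snoc x₂p₁ x₂≢x))
    ... | inj₂ (inj₁ j) = Joined-ends p₂ (snoc x₂p₂ x₂≢x) xp₂ j
    ... | inj₂ (inj₂ j) = contradiction j (off-path p₃ (x₂≢x₃ ∷ snoc x₂p₃ x₂≢x))
    e₃ : p₃ ≡ []
    e₃ with on-paths (there (there (here refl))) x₃≢x
    ... | inj₁ j        = contradiction j (off-path p₁ (≢-sym x₁≢x₃ ∷ snoc x₃p₁ x₃≢x))
    ... | inj₂ (inj₁ j) = contradiction j (off-path p₂ (≢-sym x₂≢x₃ ∷ snoc x₃p₂ x₃≢x))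
    ... | inj₂ (inj₂ j) = Joined-ends p₃ (snoc x₃p₃ x₃≢x) xp₃ j
  Solid-length (inj₂ (inj₂ (inj₂ (prism x₁ x₂ x₃ y₁ y₂ y₃ p₁ p₂ p₃
    ((x₁≢x₂ ∷ x₁≢x₃ ∷ x₁≢y₁ ∷ x₁≢y₂ ∷ x₁≢y₃ ∷ x₁∉) ∷ (_ ∷ _ ∷ x₂≢y₂ ∷ _) ∷ (_ ∷ x₃≢y₂ ∷ _) ∷
     (y₁≢y₂ ∷ _) ∷ (_ ∷ y₂∉) ∷ _))))) joined
    with split³ p₁ p₂ x₁∉ | split³ p₁ p₂ y₂∉
       | Joined-++ (triangle x₁ x₂ x₃) (joined (here refl) (there (there (there (there (here refl))))) x₁≢y₂)
  ... | x₁p₁ , x₁p₂ , x₁p₃ | y₂p₁ , y₂p₂ , y₂p₃ | j = ⊥-elim (not-joined j)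
    where
    not-joined : ¬ (Joined (triangle x₁ x₂ x₃) x₁ y₂ ⊎
                    Joined (triangle y₁ y₂ y₃ ++ path x₁ p₁ y₁ ++ path x₂ p₂ y₂ ++ path x₃ p₃ y₃) x₁ y₂)
    not-joined (inj₁ j) with Joined-triangle (Joined-sym j)
    ... | here eq                 = x₁≢y₂ (sym eq)
    ... | there (here eq)         = x₂≢y₂ (sym eq)
    ... | there (there (here eq)) = x₃≢y₂ (sym eq)
    not-joined (inj₂ j) with Joined-++ (triangle y₁ y₂ y₃) j
    ... | inj₁ j with Joined-triangle j
    ...   | here eq                 = x₁≢y₁ eq
    ...   | there (here eq)         = x₁≢y₂ eq
    ...   | there (there (here eq)) = x₁≢y₃ eq
    not-joined (inj₂ j) | inj₂ j′ with Joined-++ (path x₁ p₁ y₁) j′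
    ... | inj₁ j₁ = off-path p₁ (≢-sym x₁≢y₂ ∷ snoc y₂p₁ (≢-sym y₁≢y₂)) (Joined-sym j₁)
    ... | inj₂ j″ with Joined-++ (path x₂ p₂ y₂) j″
    ...   | inj₁ j₂ = off-path p₂ (x₁≢x₂ ∷ snoc x₁p₂ x₁≢y₂) j₂
    ...   | inj₂ j₃ = off-path p₃ (x₁≢x₃ ∷ snoc x₁p₃ x₁≢y₃) j₃

  ∣S∣≤nC4 : ∣S∣ (K t) ≤ t C 4
  ∣S∣≤nC4 = subst (∣S∣ (K t) ≤_) (⊤-count 4) (count-mono (inducedSolid? (K t)) (ofSize? 4 ⊤) four (subsets t))
    where
    four : ∀ {S} → InducedSolid (K t) S → OfSize 4 ⊤ S
    four {S} (vs , es , solid , S≈ , ind) = ⊆-max S , trans (∣≈∣ S≈ (proj₁ sized)) (proj₂ sized)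
      where
      sized = Solid-length solid λ {u} {w} u∈ w∈ u≢w →
        Equivalence.to (ind u w (Equivalence.from (S≈ u) u∈) (Equivalence.from (S≈ w) w∈)) u≢w

-- From inequalities of natural numbers to the alternating sums of integers.

module Integers where
  import Data.Integer as ℤ
  import Data.Integer.Properties as ℤₚ
  import Data.Integer.Tactic.RingSolver as ℤSolver
  open ℤ using (ℤ; +_; -_; _+_; _-_; _≤_)

  private
    left : ∀ (a b c d q s : ℤ) → (a + c + (q + s)) + - (b + d + (q + s)) ≡ a - b + c - d
    left = ℤSolver.solve-∀

    right : ∀ (p q r s b d : ℤ) → (p + r + (b + d)) + - (b + d + (q + s)) ≡ p - q + r - s
    right = ℤSolver.solve-∀

  -- Adding the same integer `- (b + d + (q + s))` to both sides of the hypothesis produces the two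
  -- alternating sums.
  alternating-≤ : ∀ a b c d p q r s → (a +ⁿ c) +ⁿ (q +ⁿ s) ≤ⁿ (p +ⁿ r) +ⁿ (b +ⁿ d) →
                  + a - + b + + c - + d ≤ + p - + q + + r - + s
  alternating-≤ a b c d p q r s le =
    subst₂ _≤_ (left (+ a) (+ b) (+ c) (+ d) (+ q) (+ s)) (right (+ p) (+ q) (+ r) (+ s) (+ b) (+ d))
      (ℤₚ.+-monoˡ-≤ (- (+ b + + d + (+ q + + s))) (ℤ.+≤+ le))

  -- Proved for a variable t: for t = χ G the type checker would evaluate the
  -- search for an optimal colouring.
  module _ (t : ℕ) where
    open CompleteGraphs t

    ℶ³-complete-≤ : ℶ³ (K t) ≤ + (t C 4) - + (t C 3) + + (t C 2) - + (t C 1)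
    ℶ³-complete-≤ = alternating-≤ (∣S∣ (K t)) (∣C∣ (K t)) (∣E∣ (K t)) t (t C 4) (t C 3) (t C 2) (t C 1)
      (+-mono-≤ (+-mono-≤ ∣S∣≤nC4 ∣E∣≤nC2) (+-mono-≤ nC3≤∣C∣ (≤-reflexive (nC1≡n t))))

    binomial-≤-ℶ³ : ∀ {n} (G : Graph n) →
      (t C 4 +ⁿ t C 2) +ⁿ (∣C∣ G +ⁿ n) ≤ⁿ (∣S∣ G +ⁿ ∣E∣ G) +ⁿ (t C 3 +ⁿ t C 1) →
      + (t C 4) - + (t C 3) + + (t C 2) - + (t C 1) ≤ ℶ³ G
    binomial-≤-ℶ³ {n} G = alternating-≤ (t C 4) (t C 3) (t C 2) (t C 1) (∣S∣ G) (∣C∣ G) (∣E∣ G) n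

-- From the invariant for all vertices to the chromatic number.

module ChromaticBound where
  open import Data.Nat using (_+_; _≤_)
  open Counting
  open Binomials

  alternating-bound : ∀ j c n s e → c + n + j C 4 ≤ s + e + 1 →
                      (suc j C 4 + suc j C 2) + (c + n) ≤ (s + e) + (suc j C 3 + suc j C 1)
  alternating-bound j c n s e bound = +-cancelʳ-≤ (1 + j C 4) _ _ (begin
    suc j C 4 + suc j C 2 + (c + n) + (1 + j C 4)       ≡⟨ regroup₁ (suc j C 4) (suc j C 2) (c + n) (j C 4) ⟩
    (suc j C 4 + suc j C 2 + 1) + (c + n + j C 4)       ≤⟨ +-mono-≤ (≤-reflexive (C-alternating₄ j)) bound ⟩
    (suc j C 3 + suc j C 1 + j C 4) + (s + e + 1)       ≡⟨ regroup₂ (suc j C 3 + suc j C 1) (j C 4) (s + e) ⟩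
    (s + e) + (suc j C 3 + suc j C 1) + (1 + j C 4)     ∎)
    where
    open ℕₚ.≤-Reasoning
    regroup₁ : ∀ a b c d → a + b + c + (1 + d) ≡ (a + b + 1) + (c + d)
    regroup₁ = solve-∀
    regroup₂ : ∀ a b c → (a + b) + (c + 1) ≡ c + a + (1 + b)
    regroup₂ = solve-∀

  module _ {n : ℕ} (G : Graph n) (connected : Connected G) where
    open Graph G
    open Measures G
    open Induction G

    private
      bounded : Bounded ⊤
      bounded = connected⇒bounded n ⊤ (∣p∣≤n ⊤) {proj₁ connected} ∈⊤
        λ {x} {y} _ _ → walk (proj₂ connected x y)
        where
        walk : ∀ {x y} → Star _~_ x y → InducedPaths.Walk G (_∈ˢ ⊤) x y
        walk ε       = ε
        walk (e ◅ w) = (e , ∈⊤) ◅ walk w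

      ∣C∣≤ : ∣C∣ G ≤ #C ⊤
      ∣C∣≤ = count-mono (inducedCycle? G) (cycleIn? ⊤) (λ cyc → cyc , λ {x} _ → ∈⊤) (subsets n)

      ≤∣S∣ : #S ⊤ ≤ ∣S∣ G
      ≤∣S∣ = count-mono (solidIn? ⊤) (inducedSolid? G) proj₁ (subsets n)

      ≤∣E∣ : #E ⊤ ≤ ∣E∣ G
      ≤∣E∣ = count-mono (edgeIn? ⊤) (λ (u , w) → (u <ᶠ? w) ×-dec (u ~? w)) proj₁ pairs

      -- Stated for a variable `x` so that it can be split. The value 0 is impossible, since a
      -- connected graph has a vertex to colour; for `suc j`, minimality gives `j ≤ k`.
      chromatic-bound : ∀ x → IsChromaticNumber G x → Bounded ⊤ →
                        (x C 4 + x C 2) + (∣C∣ G + n) ≤ (∣S∣ G + ∣E∣ G) + (x C 3 + x C 1)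
      chromatic-bound zero    ((c , _) , _) _ = case c (proj₁ connected) of λ ()
      chromatic-bound (suc j) (_ , minimal) (k , (c , proper) , bound) =
        alternating-bound j (∣C∣ G) n (∣S∣ G) (∣E∣ G)
          (≤-trans (+-mono-≤ (+-mono-≤ ∣C∣≤ (≤-reflexive (sym (∣⊤∣≡n n)))) (C-monoˡ-≤ 4 j≤k))
            (≤-trans bound (+-monoˡ-≤ 1 (+-mono-≤ ≤∣S∣ ≤∣E∣))))
        where
        j≤k : j ≤ k
        j≤k = s≤s⁻¹ (minimal (suc k) (c , λ u w → proper ∈⊤ ∈⊤))

    binomial-bound : (χ G C 4 + χ G C 2) + (∣C∣ G + n) ≤ (∣S∣ G + ∣E∣ G) + (χ G C 3 + χ G C 1)
    binomial-bound = chromatic-bound (χ G) (proj₂ (chromaticNumber G)) bounded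

open import Data.Integer using (+_; _+_; _-_; _≤_)
import Data.Integer.Properties as ℤₚ

corollary4p3p1 : ∀ {n} (G : Graph n) → Connected G →
    (ℶ³ (K (χ G)) ≤ ℶ³ G) ×
    (+ (χ G C 4) - + (χ G C 3) + + (χ G C 2) - + (χ G C 1) ≤ ℶ³ G)
corollary4p3p1 G connected = ℤₚ.≤-trans (Integers.ℶ³-complete-≤ (χ G)) binomial≤ , binomial≤
  where
  binomial≤ : + (χ G C 4) - + (χ G C 3) + + (χ G C 2) - + (χ G C 1) ≤ ℶ³ G
  binomial≤ = Integers.binomial-≤-ℶ³ (χ G) G (ChromaticBound.binomial-bound G connected)
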